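{- Let $C$ be a cycle on $n$ vertices, let $I, J$ be two distinct $k$-path vertex covers of $C$, and let $\mathsf{R} \in \{\mathsf{TS}, \mathsf{TJ}\}$. If $|I| = |J| = \lceil n/k \rceil$ and $n = c \cdot k$ for some integer $c$, then $I$ and $J$ are not reconfigurable under $\mathsf{R}$. Otherwise, $I$ and $J$ are reconfigurable under $\mathsf{R}$ if and only if $|I| = |J|$. Moreover, a reconfiguration sequence (when one exists) can be computed in $O(n)$ time for the rule $\mathsf{TJ}$ and in $O(n^2)$ time for the rule $\mathsf{TS}$.
   Context: Fix an integer $k \geq 2$. A $k$-path is a path on $k$ vertices. A vertex subset $I \subseteq V(G)$ is a $k$-path vertex cover of $G$ if every $k$-path in $G$ contains at least one vertex of $I$. A sequence $\langle I_0, \dots, I_\ell \rangle$ of $k$-path vertex covers of $G$ is a $\mathsf{TS}$-sequence if for each $i<\ell$ there are vertices $x_i,y_i$ with $I_i \setminus I_{i+1} = \{x_i\}$, $I_{i+1}\setminus I_i = \{y_i\}$ and $x_iy_i \in E(G)$; it is a $\mathsf{TJ}$-sequence if the same holds without requiring $x_iy_i \in E(G)$. Two $k$-path vertex covers are reconfigurable under a rule if a sequence of that type exists between them.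
   Formalization: The exceptional case is taken with n = c·k for some c ≥ 2: for c = 1 the claim is false, e.g. n = k = 3, I = {0}, J = {1} are distinct covers of size ⌈n/k⌉ one slide apart. The case n = k then falls under "otherwise". -}

module Defs where

open import Data.Bool.Base using (if_then_else_)
open import Data.Fin.Base using (Fin; toℕ)
open import Data.Fin.Subset using (Subset; Side; inside; outside; _∈_; _─_; ⁅_⁆; ∣_∣)
open import Data.List.Base using (List; []; _∷_; _∷ʳ_)
open import Data.Nat.Base
open import Data.Nat.Properties using (1+n≢n; <⇒≱)
open import Data.Product.Base using (Σ-syntax; ∃-syntax; _×_; _,_)
open import Data.Sum.Base using (_⊎_; inj₁; inj₂; swap)
open import Data.Unit.Base using (⊤)
open import Data.Vec.Base using ([]; _∷_)
open import Function.Definitions using (Injective)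
open import Relation.Binary.Construct.Closure.ReflexiveTransitive using (Star; ε; _◅_)
open import Relation.Binary.Definitions using (Irreflexive; Symmetric)
open import Relation.Binary.PropositionalEquality using (_≡_; _≢_; refl; sym; trans; cong; subst)
open import Relation.Nullary.Negation.Core using (¬_)

-- ⌈ n / k ⌉ as ⌊ (n + (k - 1)) / k ⌋.
⌈_/_⌉ : (n k : ℕ) .{{_ : NonZero k}} → ℕ
⌈ n / k ⌉ = (n + pred k) / k

------------------------------------------------------------------------
-- Graphs and cycles

record Graph (n : ℕ) : Set₁ where
  field
    Adj    : Fin n → Fin n → Set
    symm   : Symmetric Adj
    irrefl : Irreflexive _≡_ Adj

-- j is the successor of i in the cyclic order 0, 1, …, n - 1.
Next : ∀ {n} → Fin n → Fin n → Set
Next {n} i j = toℕ j ≡ suc (toℕ i) ⊎ (suc (toℕ i) ≡ n × toℕ j ≡ 0)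

cycle : (n : ℕ) → 3 ≤ n → Graph n
cycle n 3≤n = record
  { Adj    = λ i j → Next i j ⊎ Next j i
  ; symm   = swap
  ; irrefl = λ { {i} refl (inj₁ p) → noLoop i p ; {i} refl (inj₂ p) → noLoop i p }
  }
  where
  noLoop : (i : Fin n) → ¬ Next i i
  noLoop i (inj₁ i≡1+i)         = 1+n≢n (sym i≡1+i)
  noLoop i (inj₂ (1+i≡n , i≡0)) =
    <⇒≱ (subst (3 ≤_) (trans (sym 1+i≡n) (cong suc i≡0)) 3≤n) (s≤s z≤n)

------------------------------------------------------------------------
-- k-path vertex covers and their reconfiguration

-- Paths are subgraphs, not necessarily induced.
record Path {n} (G : Graph n) (k : ℕ) : Set where
  field
    vertex    : Fin k → Fin n
    injective : Injective _≡_ _≡_ vertex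
    adjacent  : ∀ i j → toℕ j ≡ suc (toℕ i) → Graph.Adj G (vertex i) (vertex j)

IsPathCover : ∀ {n} → Graph n → ℕ → Subset n → Set
IsPathCover G k I = (P : Path G k) → ∃[ i ] Path.vertex P i ∈ I

data Rule : Set where
  TS TJ : Rule

AllowedBy : ∀ {n} → Rule → Graph n → Fin n → Fin n → Set
AllowedBy TS G x y = Graph.Adj G x y
AllowedBy TJ G x y = ⊤

record Step {n} (R : Rule) (G : Graph n) (k : ℕ) (I I′ : Subset n) : Set where
  field
    cover   : IsPathCover G k I
    cover′  : IsPathCover G k I′
    x y     : Fin n
    I─I′    : I ─ I′ ≡ ⁅ x ⁆
    I′─I    : I′ ─ I ≡ ⁅ y ⁆
    allowed : AllowedBy R G x y

-- The sequence of length zero does not assert that its single term is a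
-- cover; endpoints are always assumed to be covers where this type is used.
Reconfigurable : ∀ {n} → Rule → Graph n → ℕ → Subset n → Subset n → Set
Reconfigurable R G k = Star (Step R G k)

-- A single k-path meets every vertex when n ≡ k, so then every nonempty set
-- is a cover and nothing is frozen: this is why c ≥ 2 is required.
Frozen : (n k : ℕ) .{{_ : NonZero k}} → Subset n → Subset n → Set
Frozen n k I J =
  ∣ I ∣ ≡ ⌈ n / k ⌉ × ∣ J ∣ ≡ ⌈ n / k ⌉ × (∃[ c ] (2 ≤ c × n ≡ c * k))

------------------------------------------------------------------------
-- Unit-cost random access machine: while programs over natural-number
-- variables and arrays, both named by numbers fixed in the program text.
-- The only arithmetic is addition and truncated subtraction.

data Expr : Set where
  lit     : ℕ → Expr
  var     : ℕ → Expr
  _[_]    : ℕ → Expr → Expr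
  _⊕_ _⊖_ : Expr → Expr → Expr

data Cmd : Set where
  skip            : Cmd
  _:=_            : ℕ → Expr → Cmd
  _[_]:=_         : ℕ → Expr → Expr → Cmd
  emit            : Expr → Cmd
  _⨾_             : Cmd → Cmd → Cmd
  ifnz_then_else_ : Expr → Cmd → Cmd → Cmd
  while_loop_     : Expr → Cmd → Cmd

infixl 6 _⊕_ _⊖_
infix  7 _[_]
infix  4 _:=_ _[_]:=_
infixr 3 _⨾_

record State : Set where
  field
    vars   : ℕ → ℕ
    arrays : ℕ → ℕ → ℕ
    output : List ℕ

open State

_[_↦_] : ∀ {A : Set} → (ℕ → A) → ℕ → A → (ℕ → A)
(f [ x ↦ a ]) y = if x ≡ᵇ y then a else f y

⟦_⟧ : Expr → State → ℕ
⟦ lit v ⟧   s = v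
⟦ var x ⟧   s = vars s x
⟦ a [ e ] ⟧ s = arrays s a (⟦ e ⟧ s)
⟦ e ⊕ e′ ⟧  s = ⟦ e ⟧ s + ⟦ e′ ⟧ s
⟦ e ⊖ e′ ⟧  s = ⟦ e ⟧ s ∸ ⟦ e′ ⟧ s

cost : Expr → ℕ
cost (lit v)   = 1
cost (var x)   = 1
cost (a [ e ]) = suc (cost e)
cost (e ⊕ e′)  = suc (cost e + cost e′)
cost (e ⊖ e′)  = suc (cost e + cost e′)

setVar : ℕ → ℕ → State → State
setVar x v s = record s { vars = vars s [ x ↦ v ] }

setArray : ℕ → ℕ → ℕ → State → State
setArray a i v s = record s { arrays = arrays s [ a ↦ arrays s a [ i ↦ v ] ] }

write : ℕ → State → State
write v s = record s { output = output s ∷ʳ v }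

-- p ∶ s ⇓ s′ in-time t: started in s, the program p halts in s′ after
-- exactly t elementary operations.
data _∶_⇓_in-time_ : Cmd → State → State → ℕ → Set where
  skip   : ∀ {s} → skip ∶ s ⇓ s in-time 1
  assign : ∀ {x e s} →
           (x := e) ∶ s ⇓ setVar x (⟦ e ⟧ s) s in-time suc (cost e)
  store  : ∀ {a i e s} →
           (a [ i ]:= e) ∶ s ⇓ setArray a (⟦ i ⟧ s) (⟦ e ⟧ s) s
             in-time suc (cost i + cost e)
  emit   : ∀ {e s} →
           emit e ∶ s ⇓ write (⟦ e ⟧ s) s in-time suc (cost e)
  seq    : ∀ {p q s s′ s″ t u} →
           p ∶ s ⇓ s′ in-time t → q ∶ s′ ⇓ s″ in-time u →
           (p ⨾ q) ∶ s ⇓ s″ in-time (t + u)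
  if≢0   : ∀ {e p q s s′ t} → ⟦ e ⟧ s ≢ 0 →
           p ∶ s ⇓ s′ in-time t →
           (ifnz e then p else q) ∶ s ⇓ s′ in-time (suc (cost e) + t)
  if≡0   : ∀ {e p q s s′ t} → ⟦ e ⟧ s ≡ 0 →
           q ∶ s ⇓ s′ in-time t →
           (ifnz e then p else q) ∶ s ⇓ s′ in-time (suc (cost e) + t)
  again  : ∀ {e p s s′ s″ t u} → ⟦ e ⟧ s ≢ 0 →
           p ∶ s ⇓ s′ in-time t → (while e loop p) ∶ s′ ⇓ s″ in-time u →
           (while e loop p) ∶ s ⇓ s″ in-time (suc (cost e) + (t + u))
  exit   : ∀ {e p s} → ⟦ e ⟧ s ≡ 0 →
           (while e loop p) ∶ s ⇓ s in-time suc (cost e)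

------------------------------------------------------------------------
-- Computing reconfiguration sequences on cycles

indicator : ∀ {n} → Subset n → ℕ → ℕ
indicator []            i       = 0
indicator (inside  ∷ I) zero    = 1
indicator (outside ∷ I) zero    = 0
indicator (_       ∷ I) (suc i) = indicator I i

-- Variable 0 holds n and arrays 0 and 1 hold I and J; all else is zero.
initial : ∀ {n} → Subset n → Subset n → State
initial {n} I J = record
  { vars   = (λ _ → 0) [ 0 ↦ n ]
  ; arrays = ((λ _ _ → 0) [ 0 ↦ indicator I ]) [ 1 ↦ indicator J ]
  ; output = []
  }

-- A sequence ⟨I₀, …, I_ℓ⟩ is output as the list x₀, y₀, …, x_{ℓ-1}, y_{ℓ-1}
-- of its moves, which together with I₀ determines it. Writing out all the
-- sets I_i would in general take more than linear time.
moves : ∀ {n R} {G : Graph n} {k I J} → Reconfigurable R G k I J → List ℕ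
moves ε       = []
moves (s ◅ σ) = toℕ (Step.x s) ∷ toℕ (Step.y s) ∷ moves σ

-- Some program, fixed once k and R are, finds a sequence in O(f n) time
-- whenever one exists.
CycleSequencesComputableIn : (f : ℕ → ℕ) → Rule → (k : ℕ) → Set
CycleSequencesComputableIn f R k =
  ∃[ p ] ∃[ C ]
    ((n : ℕ) (3≤n : 3 ≤ n) (I J : Subset n) →
     IsPathCover (cycle n 3≤n) k I → IsPathCover (cycle n 3≤n) k J → I ≢ J →
     Reconfigurable R (cycle n 3≤n) k I J →
     Σ[ σ ∈ Reconfigurable R (cycle n 3≤n) k I J ]
       ∃[ s ] ∃[ t ]
         (p ∶ initial I J ⇓ s in-time t × output s ≡ moves σ × t ≤ C * f n))

{-# OPTIONS --safe #-}

-- Counting the tokens of a set in the cyclic order, starting from a base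
-- vertex, turns it into a height function f: the set has a token where f
-- increases, and for k < n it is a cover exactly when f(v) < f(v + k) for all
-- v. If n = ck and there are c tokens, c ≥ 2, then f(v + k) = f(v) + 1, so the set is
-- invariant under rotation by k, which no single move preserves.
--
-- Otherwise let K be k, or n + 1 if n ≤ k; there are m tokens with n < mK.
-- Sliding a token from v - 1 to v lowers f by 1 at v, and is possible unless
-- f(v - 1), f(v + 1) or f(v - K) forbids it. First I is made to contain a
-- base vertex of J: at most K sweeps, each lowering f wherever possible,
-- bring the last token to the base. Then both sets contain the base.
-- For token sliding, sweeps move each height towards its target; linear
-- potentials show that 5n + 1 sweeps reach it. For token jumping, the i-th
-- element of I \ J jumps to the i-th element of J \ I, the upward jumps in
-- ascending order followed by the downward ones in descending order; all
-- intermediate heights are obtained from good ones by minima and maxima.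

module Submission where

open import Defs
open import Data.Bool.Base using (true; false; T)
open import Data.Bool.Properties using (T-≡)
open import Data.Fin.Base using (Fin; toℕ; fromℕ<; punchOut) renaming (zero to fzero; suc to fsuc)
open import Data.Fin.Properties using (toℕ-injective; toℕ<n; toℕ-fromℕ<; injective⇒≤; punchOut-injective; any?) renaming (_≟_ to _≟ᶠ_)
open import Data.Fin.Subset using (Subset; inside; outside; _∈_; _∉_; _─_; ⁅_⁆; ∣_∣; Nonempty) renaming (⊥ to ∅)
open import Data.Fin.Subset.Properties using (⊆-antisym; x∈⁅x⁆; x∈⁅y⁆⇒x≡y; ∣⁅x⁆∣≡1; x∈p∧x∉q⇒x∈p─q; p─q⊆p; _∈?_; nonempty?; Empty-unique; ∣⊥∣≡0)
open import Data.List.Base using (List; []; _∷_; _∷ʳ_; _++_)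
open import Data.List.Properties using (++-assoc)
open import Data.Nat.Base
open import Data.Nat.DivMod
open import Data.Nat.Divisibility using (n∣m*n)
open import Data.Nat.Properties
open import Data.Nat.Tactic.RingSolver using (solve-∀)
open import Data.Product.Base using (Σ-syntax; ∃-syntax; ∃₂; _×_; _,_; proj₁; proj₂)
open import Data.Sum.Base using (_⊎_; inj₁; inj₂)
open import Data.Unit.Base using (tt)
open import Data.Vec.Base using ([]; _∷_; here; there; tabulate)
open import Data.Vec.Properties using (lookup∘tabulate; []=⇒lookup; lookup⇒[]=)
open import Function.Base using (_∘_; _$_)
open import Function.Bundles using (Equivalence; _⇔_; mk⇔)
open import Relation.Binary.Construct.Closure.ReflexiveTransitive using (ε; _◅_; _◅◅_)
open import Relation.Binary.Definitions using (tri<; tri≈; tri>)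
open import Relation.Binary.PropositionalEquality hiding ([_])
open import Relation.Nullary using (¬_; yes; no; contradiction)

open State

-- Heights on a cycle are fixed only up to a constant, and a window that passes the base compares
-- values from two different turns. A token shared by both sets at the base cuts the cycle open:
-- both heights then have `f 0 = 0`, `f 1 = 1` and `f n = m`, and a window that passes the base
-- contains the token there, so only windows inside `[0, n]` can obstruct. The price is that a token
-- has to be carried to the base, and only this stage spends the slack `n < m * K`. It takes `K`
-- sweeps, and `K` is at most `k + 1`, a constant for a fixed program; this keeps token jumping
-- linear. For jumping from height `F` to height `G`, the upward jumps lower `F` to the minimum of
-- `F` and `G` and the downward jumps raise that minimum to `G`. The minimum is symmetric in the two
-- sets, so the second phase is the first one with the sets exchanged, run backwards.

-- Prefix sums and functions that grow over every window.

cum : (ℕ → ℕ) → ℕ → ℕ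
cum g zero    = 0
cum g (suc v) = cum g v + g v

cum-cong : ∀ {g h} v → (∀ i → i < v → g i ≡ h i) → cum g v ≡ cum h v
cum-cong zero    eq = refl
cum-cong (suc v) eq = cong₂ _+_ (cum-cong v (λ i i<v → eq i (m<n⇒m<1+n i<v))) (eq v ≤-refl)

cum-+ : ∀ g a l → cum g (a + l) ≡ cum g a + cum (λ i → g (a + i)) l
cum-+ g a zero    = trans (cong (cum g) (+-identityʳ a)) (sym (+-identityʳ _))
cum-+ g a (suc l) = begin
  cum g (a + suc l)                              ≡⟨ cong (cum g) (+-suc a l) ⟩
  cum g (a + l) + g (a + l)                      ≡⟨ cong (_+ g (a + l)) (cum-+ g a l) ⟩
  cum g a + cum (λ i → g (a + i)) l + g (a + l)  ≡⟨ +-assoc (cum g a) _ _ ⟩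
  cum g a + cum (λ i → g (a + i)) (suc l)        ∎
  where open ≡-Reasoning

cum-mono : ∀ g {u v} → u ≤ v → cum g u ≤ cum g v
cum-mono g {u} {v} u≤v = begin
  cum g u                                    ≤⟨ m≤m+n _ _ ⟩
  cum g u + cum (λ i → g (u + i)) (v ∸ u)    ≡⟨ cum-+ g u (v ∸ u) ⟨
  cum g (u + (v ∸ u))                        ≡⟨ cong (cum g) (m+[n∸m]≡n u≤v) ⟩
  cum g v                                    ∎
  where open ≤-Reasoning

cum-periodic : ∀ g n → (∀ a → g (a + n) ≡ g a) → ∀ v → cum g (v + n) ≡ cum g v + cum g n
cum-periodic g n per v = begin
  cum g (v + n)                        ≡⟨ cong (cum g) (+-comm v n) ⟩
  cum g (n + v)                        ≡⟨ cum-+ g n v ⟩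
  cum g n + cum (λ i → g (n + i)) v    ≡⟨ cong (cum g n +_) (cum-cong v λ i _ → trans (cong g (+-comm n i)) (per i)) ⟩
  cum g n + cum g v                    ≡⟨ +-comm (cum g n) _ ⟩
  cum g v + cum g n                    ∎
  where open ≡-Reasoning

cum-rotate : ∀ g n → (∀ a → g (a + n) ≡ g a) → ∀ b → cum (λ i → g (b + i)) n ≡ cum g n
cum-rotate g n per b =
  +-cancelˡ-≡ (cum g b) _ _ (trans (sym (cum-+ g b n)) (cum-periodic g n per b))

-- A discrete intermediate value argument: it turns a strict inequality across a window into a token
-- inside the window.
crossing : ∀ (f : ℕ → ℕ) l v → f v < f (v + l) → ∃[ i ] (i < l × f (v + i) < f (suc (v + i)))
crossing f zero    v lt = contradiction (subst (λ w → f v < f w) (+-identityʳ v) lt) (n≮n _)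
crossing f (suc l) v lt with f v <? f (v + l)
... | yes lt′ = let i , i<l , up = crossing f l v lt′ in i , m<n⇒m<1+n i<l , up
... | no  ≮  = l , ≤-refl , ≤-<-trans (≮⇒≥ ≮) (subst (λ w → f v < f w) (+-suc v l) lt)

module _ (f : ℕ → ℕ) (k : ℕ) (grow : ∀ v → f v < f (v + k)) where

  grow-multiple : ∀ j v → f v + j ≤ f (v + j * k)
  grow-multiple zero    v = ≤-reflexive (trans (+-identityʳ _) (cong f (sym (+-identityʳ v))))
  grow-multiple (suc j) v = begin
    f v + suc j          ≡⟨ +-suc (f v) j ⟩
    suc (f v) + j        ≤⟨ +-monoˡ-≤ j (grow v) ⟩
    f (v + k) + j        ≤⟨ grow-multiple j (v + k) ⟩
    f (v + k + j * k)    ≡⟨ cong f (+-assoc v k (j * k)) ⟩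
    f (v + suc j * k)    ∎
    where open ≤-Reasoning

  -- The last `c` of the `suc c` windows gain at least `c`, so a total gain of `suc c` leaves at
  -- most 1 for the first.
  grow-exact : ∀ c v → f (v + suc c * k) ≡ f v + suc c → f (v + k) ≡ suc (f v)
  grow-exact c v eq = ≤-antisym (+-cancelʳ-≤ c _ _ (begin
    f (v + k) + c        ≤⟨ grow-multiple c (v + k) ⟩
    f (v + k + c * k)    ≡⟨ cong f (+-assoc v k (c * k)) ⟩
    f (v + suc c * k)    ≡⟨ eq ⟩
    f v + suc c          ≡⟨ +-suc (f v) c ⟩
    suc (f v) + c        ∎)) (grow v)
    where open ≤-Reasoning

  module _ (n m : ℕ) (per : ∀ v → f (v + n) ≡ f v + m) where

    periodic-multiple : ∀ j v → f (v + j * n) ≡ f v + j * m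
    periodic-multiple zero    v = trans (cong f (+-identityʳ v)) (sym (+-identityʳ _))
    periodic-multiple (suc j) v = begin
      f (v + (n + j * n))    ≡⟨ cong f (+-assoc v n (j * n)) ⟨
      f (v + n + j * n)      ≡⟨ periodic-multiple j (v + n) ⟩
      f (v + n) + j * m      ≡⟨ cong (_+ j * m) (per v) ⟩
      f v + m + j * m        ≡⟨ +-assoc (f v) m (j * m) ⟩
      f v + (m + j * m)      ∎
      where open ≡-Reasoning

    -- A stretch of length `n * k` is read in two ways: as `n` windows that gain at least 1 each,
    -- and as `k` turns that gain exactly `m` each.
    period≤ : n ≤ m * k
    period≤ = +-cancelˡ-≤ (f 0) _ _ (begin
      f 0 + n          ≤⟨ grow-multiple n 0 ⟩
      f (n * k)        ≡⟨ cong f (*-comm n k) ⟩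
      f (k * n)        ≡⟨ periodic-multiple k 0 ⟩
      f 0 + k * m      ≡⟨ cong (f 0 +_) (*-comm k m) ⟩
      f 0 + m * k      ∎)
      where open ≤-Reasoning

-- Total-correctness triples with time bounds.

Runs : Cmd → State → (State → Set) → ℕ → Set
Runs p s Q T = ∃₂ λ s′ t → p ∶ s ⇓ s′ in-time t × Q s′ × t ≤ T

module _ {s : State} {Q : State → Set} where

  run-skip : Q s → Runs skip s Q 1
  run-skip q = _ , _ , skip , q , ≤-refl

  run-assign : ∀ {x e} → Q (setVar x (⟦ e ⟧ s) s) → Runs (x := e) s Q (suc (cost e))
  run-assign q = _ , _ , assign , q , ≤-refl

  run-store : ∀ {a i e} → Q (setArray a (⟦ i ⟧ s) (⟦ e ⟧ s) s) →
              Runs (a [ i ]:= e) s Q (suc (cost i + cost e))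
  run-store q = _ , _ , store , q , ≤-refl

  run-emit : ∀ {e} → Q (write (⟦ e ⟧ s) s) → Runs (emit e) s Q (suc (cost e))
  run-emit q = _ , _ , emit , q , ≤-refl

  -- The triple of the second command is the postcondition of the first, so proofs follow the
  -- program text and no intermediate assertion has to be written.
  run-seq : ∀ {p q T U} → Runs p s (λ s′ → Runs q s′ Q U) T → Runs (p ⨾ q) s Q (T + U)
  run-seq (_ , _ , r , (_ , _ , r′ , q , u≤U) , t≤T) = _ , _ , seq r r′ , q , +-mono-≤ t≤T u≤U

  run-if : ∀ {e p q T U} → (⟦ e ⟧ s ≢ 0 → Runs p s Q T) → (⟦ e ⟧ s ≡ 0 → Runs q s Q U) →
           Runs (ifnz e then p else q) s Q (suc (cost e) + (T ⊔ U))
  run-if {e} {T = T} {U} then′ else′ with ⟦ e ⟧ s ≟ 0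
  ... | no  ≢0 = let _ , _ , r , q , t≤T = then′ ≢0 in
    _ , _ , if≢0 ≢0 r , q , +-monoʳ-≤ (suc (cost e)) (≤-trans t≤T (m≤m⊔n T U))
  ... | yes ≡0 = let _ , _ , r , q , t≤U = else′ ≡0 in
    _ , _ , if≡0 ≡0 r , q , +-monoʳ-≤ (suc (cost e)) (≤-trans t≤U (m≤n⊔m T U))

run-weaken : ∀ {p s T U} {Q Q′ : State → Set} →
             (∀ {s′} → Q s′ → Q′ s′) → T ≤ U → Runs p s Q T → Runs p s Q′ U
run-weaken Q⇒Q′ T≤U (_ , _ , r , q , t≤T) = _ , _ , r , Q⇒Q′ q , ≤-trans t≤T T≤U

loopTime : Expr → ℕ → ℕ → ℕ
loopTime e d T = d * (suc (cost e) + T) + suc (cost e)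

-- The guard has to equal the number of remaining rounds; one induction on `d` then yields
-- termination, the final index and the time together.
run-while : ∀ {e p T} (Inv : ℕ → State → Set) N →
            (∀ {v s} → v ≤ N → Inv v s → ⟦ e ⟧ s ≡ N ∸ v) →
            (∀ {v s} → v < N → Inv v s → Runs p s (Inv (suc v)) T) →
            ∀ {v s} d → v + d ≡ N → Inv v s →
            Runs (while e loop p) s (Inv N) (loopTime e d T)
run-while Inv N guard body {v} zero eq inv rewrite +-identityʳ v with refl ← eq =
  _ , _ , exit (trans (guard ≤-refl inv) (n∸n≡0 N)) , inv , ≤-refl
run-while {e} {T = T} Inv N guard body {v} (suc d) eq inv =
  let _ , _ , r  , inv′ , t≤ = body v<N inv
      _ , _ , r′ , inv″ , u≤ = run-while Inv N guard body d (trans (sym (+-suc v d)) eq) inv′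
  in _ , _ , again ≢0 r r′ , inv″ ,
     ≤-trans (+-monoʳ-≤ (suc (cost e)) (+-mono-≤ t≤ u≤))
             (≤-reflexive (trans (sym (+-assoc (suc (cost e)) T _)) (sym (+-assoc (suc (cost e) + T) (d * (suc (cost e) + T)) _))))
  where
  v<N : v < N
  v<N = subst (v <_) eq (m<m+n v z<s)
  ≢0 : ⟦ e ⟧ _ ≢ 0
  ≢0 ≡0 = m>n⇒m∸n≢0 v<N (trans (sym (guard (<⇒≤ v<N) inv)) ≡0)

update-same : ∀ (f : ℕ → ℕ) x a → (f [ x ↦ a ]) x ≡ a
update-same f x a with x ≡ᵇ x in eq
... | true  = refl
... | false = contradiction (≡⇒≡ᵇ x x refl) (subst (λ c → ¬ T c) (sym eq) λ ())

update-other : ∀ (f : ℕ → ℕ) {x y} a → x ≢ y → (f [ x ↦ a ]) y ≡ f y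
update-other f {x} {y} a x≢y with x ≡ᵇ y in eq
... | true  = contradiction (≡ᵇ⇒≡ x y (subst T (sym eq) tt)) x≢y
... | false = refl

-- Indicators, set differences and single moves.

indicator-∈ : ∀ {n} {I : Subset n} {i} → i ∈ I → indicator I (toℕ i) ≡ 1
indicator-∈                   here      = refl
indicator-∈ {I = inside  ∷ I} (there p) = indicator-∈ p
indicator-∈ {I = outside ∷ I} (there p) = indicator-∈ p

indicator-∉ : ∀ {n} {I : Subset n} {i} → i ∉ I → indicator I (toℕ i) ≡ 0
indicator-∉ {I = inside  ∷ I} {fzero}  i∉ = contradiction here i∉
indicator-∉ {I = outside ∷ I} {fzero}  i∉ = refl
indicator-∉ {I = inside  ∷ I} {fsuc i} i∉ = indicator-∉ (i∉ ∘ there)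
indicator-∉ {I = outside ∷ I} {fsuc i} i∉ = indicator-∉ (i∉ ∘ there)

indicator-positive : ∀ {n} {I : Subset n} {i} → 0 < indicator I (toℕ i) → i ∈ I
indicator-positive {I = I} {i} pos with i ∈? I
... | yes i∈ = i∈
... | no  i∉ = contradiction (subst (0 <_) (indicator-∉ i∉) pos) (n≮n 0)

indicator≤1 : ∀ {n} (I : Subset n) i → indicator I i ≤ 1
indicator≤1 []            i       = z≤n
indicator≤1 (inside  ∷ I) zero    = ≤-refl
indicator≤1 (outside ∷ I) zero    = z≤n
indicator≤1 (inside  ∷ I) (suc i) = indicator≤1 I i
indicator≤1 (outside ∷ I) (suc i) = indicator≤1 I i

cum-indicator : ∀ {n} (I : Subset n) → cum (indicator I) n ≡ ∣ I ∣
cum-indicator         []            = refl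
cum-indicator {suc n} (inside  ∷ I) =
  trans (cum-+ (indicator (inside ∷ I)) 1 n) (cong suc (cum-indicator I))
cum-indicator {suc n} (outside ∷ I) =
  trans (cum-+ (indicator (outside ∷ I)) 1 n) (cum-indicator I)

-- Both sides count the union of `I` and `J`.
∣∣-exchange : ∀ {n} (I J : Subset n) → ∣ I ∣ + ∣ J ─ I ∣ ≡ ∣ J ∣ + ∣ I ─ J ∣
∣∣-exchange []            []            = refl
∣∣-exchange (inside  ∷ I) (inside  ∷ J) = cong suc (∣∣-exchange I J)
∣∣-exchange (inside  ∷ I) (outside ∷ J) =
  trans (cong suc (∣∣-exchange I J)) (sym (+-suc ∣ J ∣ _))
∣∣-exchange (outside ∷ I) (inside  ∷ J) =
  trans (+-suc ∣ I ∣ _) (cong suc (∣∣-exchange I J))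
∣∣-exchange (outside ∷ I) (outside ∷ J) = ∣∣-exchange I J

∈─⇒∉ : ∀ {n} (I J : Subset n) {i} → i ∈ I ─ J → i ∉ J
∈─⇒∉ (x ∷ I) (outside ∷ J) (there p) (there q) = ∈─⇒∉ I J p q
∈─⇒∉ (x ∷ I) (inside  ∷ J) (there p) (there q) = ∈─⇒∉ I J p q

─-singleton : ∀ {n} {I J : Subset n} {x} → x ∈ I → x ∉ J →
              (∀ {i} → i ≢ x → i ∈ I → i ∈ J) → I ─ J ≡ ⁅ x ⁆
─-singleton {I = I} {J} {x} x∈I x∉J rest = ⊆-antisym to from
  where
  to : ∀ {i} → i ∈ I ─ J → i ∈ ⁅ x ⁆
  to {i} i∈ with i ≟ᶠ x
  ... | yes refl = x∈⁅x⁆ x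
  ... | no  i≢x  = contradiction (rest i≢x (p─q⊆p I J i∈)) (∈─⇒∉ I J i∈)
  from : ∀ {i} → i ∈ ⁅ x ⁆ → i ∈ I ─ J
  from i∈ with refl ← x∈⁅y⁆⇒x≡y x i∈ = x∈p∧x∉q⇒x∈p─q x∈I x∉J

module _ {n} {R : Rule} {G : Graph n} {k : ℕ} where

  Step-sym : ∀ {I J} → Step R G k I J → Step R G k J I
  Step-sym s = record
    { cover = cover′ ; cover′ = cover ; x = y ; y = x ; I─I′ = I′─I ; I′─I = I─I′
    ; allowed = allowed-sym R allowed }
    where
    open Step s
    allowed-sym : ∀ R {x y} → AllowedBy R G x y → AllowedBy R G y x
    allowed-sym TS = Graph.symm G
    allowed-sym TJ _ = tt

  module _ {I J} (s : Step R G k I J) where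
    open Step s

    Step-x∈ : x ∈ I
    Step-x∈ = p─q⊆p I J (subst (x ∈_) (sym I─I′) (x∈⁅x⁆ x))

    Step-x∉ : x ∉ J
    Step-x∉ = ∈─⇒∉ I J (subst (x ∈_) (sym I─I′) (x∈⁅x⁆ x))

    Step-only-x : ∀ {i} → i ∈ I → i ∉ J → i ≡ x
    Step-only-x i∈ i∉ = x∈⁅y⁆⇒x≡y x (subst (_ ∈_) I─I′ (x∈p∧x∉q⇒x∈p─q i∈ i∉))

    Step-∣∣ : ∣ I ∣ ≡ ∣ J ∣
    Step-∣∣ = +-cancelʳ-≡ 1 _ _ (begin
      ∣ I ∣ + 1          ≡⟨ cong (∣ I ∣ +_) (trans (cong ∣_∣ I′─I) (∣⁅x⁆∣≡1 y)) ⟨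
      ∣ I ∣ + ∣ J ─ I ∣  ≡⟨ ∣∣-exchange I J ⟩
      ∣ J ∣ + ∣ I ─ J ∣  ≡⟨ cong (∣ J ∣ +_) (trans (cong ∣_∣ I─I′) (∣⁅x⁆∣≡1 x)) ⟩
      ∣ J ∣ + 1          ∎)
      where open ≡-Reasoning

-- The cycle

suc-% : ∀ n .{{_ : NonZero n}} z →
        suc z % n ≡ suc (z % n) ⊎ (suc (z % n) ≡ n × suc z % n ≡ 0)
suc-% n z with m≤n⇒m<n∨m≡n (m%n<n z n)
  | trans (cong (λ w → suc w % n) (m≡m%n+[m/n]*n z n)) ([m+kn]%n≡m%n (suc (z % n)) (z / n) n)
... | inj₁ lt | reduce = inj₁ (trans reduce (m<n⇒m%n≡m lt))
... | inj₂ eq | reduce = inj₂ (eq , trans reduce (trans (cong (_% n) eq) (n%n≡0 n)))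

module _ (n : ℕ) .{{_ : NonZero n}} where

  toℕ-mod : ∀ z → toℕ (z mod n) ≡ z % n
  toℕ-mod z = toℕ-fromℕ< (m%n<n z n)

  mod-cong : ∀ {y z} → y % n ≡ z % n → y mod n ≡ z mod n
  mod-cong {y} {z} eq = toℕ-injective (trans (toℕ-mod y) (trans eq (sym (toℕ-mod z))))

  toℕ-mod-inverse : ∀ (i : Fin n) → toℕ i mod n ≡ i
  toℕ-mod-inverse i = toℕ-injective (trans (toℕ-mod _) (m<n⇒m%n≡m (toℕ<n i)))

  %-absorbˡ : ∀ y z → (y % n + z) % n ≡ (y + z) % n
  %-absorbˡ y z = sym (begin
    (y + z) % n                        ≡⟨ cong (λ w → (w + z) % n) (m≡m%n+[m/n]*n y n) ⟩
    (y % n + y / n * n + z) % n        ≡⟨ cong (_% n) (lemma (y % n) (y / n * n) z) ⟩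
    (y % n + z + y / n * n) % n        ≡⟨ [m+kn]%n≡m%n (y % n + z) (y / n) n ⟩
    (y % n + z) % n                    ∎)
    where
    open ≡-Reasoning
    lemma : ∀ a b c → a + b + c ≡ a + c + b
    lemma = solve-∀

  opposite% : ℕ → ℕ
  opposite% b = n ∸ b % n

  opposite%-inverse : ∀ b z → (z + (b + opposite% b)) % n ≡ z % n
  opposite%-inverse b z = trans (cong (λ w → (z + w) % n) sum) ([m+kn]%n≡m%n z (suc (b / n)) n)
    where
    open ≡-Reasoning
    lemma : ∀ r q s → r + q + s ≡ r + s + q
    lemma = solve-∀
    sum : b + opposite% b ≡ suc (b / n) * n
    sum = begin
      b + (n ∸ b % n)                    ≡⟨ cong (_+ (n ∸ b % n)) (m≡m%n+[m/n]*n b n) ⟩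
      b % n + b / n * n + (n ∸ b % n)    ≡⟨ lemma (b % n) _ _ ⟩
      b % n + (n ∸ b % n) + b / n * n    ≡⟨ cong (_+ b / n * n) (m+[n∸m]≡n (m%n≤n b n)) ⟩
      n + b / n * n                      ∎

  unrotate : ∀ b z → ((b + z) % n + opposite% b) % n ≡ z % n
  unrotate b z = trans (%-absorbˡ (b + z) (opposite% b))
    (trans (cong (_% n) (lemma b z (opposite% b))) (opposite%-inverse b z))
    where
    lemma : ∀ b z o → b + z + o ≡ z + (b + o)
    lemma = solve-∀

  rotate-unrotate : ∀ b y → (b + (y + opposite% b) % n) % n ≡ y % n
  rotate-unrotate b y = trans (cong (_% n) (+-comm b _))
    (trans (%-absorbˡ (y + opposite% b) b)
      (trans (cong (_% n) (lemma y (opposite% b) b)) (opposite%-inverse b y)))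
    where
    lemma : ∀ y o b → y + o + b ≡ y + (b + o)
    lemma = solve-∀

  +-%-injective : ∀ a {i j} → i < n → j < n → (a + i) % n ≡ (a + j) % n → i ≡ j
  +-%-injective a {i} {j} i<n j<n eq = begin
    i                                   ≡⟨ m<n⇒m%n≡m i<n ⟨
    i % n                               ≡⟨ unrotate a i ⟨
    ((a + i) % n + opposite% a) % n     ≡⟨ cong (λ w → (w + opposite% a) % n) eq ⟩
    ((a + j) % n + opposite% a) % n     ≡⟨ unrotate a j ⟩
    j % n                               ≡⟨ m<n⇒m%n≡m j<n ⟩
    j                                   ∎
    where open ≡-Reasoning

  Next-mod : ∀ z → Next (z mod n) (suc z mod n)
  Next-mod z rewrite toℕ-mod z | toℕ-mod (suc z) = suc-% n z

  Next-functional : ∀ {i j : Fin n} → Next i j → j ≡ suc (toℕ i) mod n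
  Next-functional {i} {j} (inj₁ eq) = trans (sym (toℕ-mod-inverse j)) (cong (_mod n) eq)
  Next-functional {i} {j} (inj₂ (eq , eq0)) = toℕ-injective
    (trans eq0 (sym (trans (toℕ-mod _) (trans (cong (_% n) eq) (n%n≡0 n)))))

  Next-injective : ∀ {i i′ j : Fin n} → Next i j → Next i′ j → i ≡ i′
  Next-injective (inj₁ p)        (inj₁ q)        = toℕ-injective (suc-injective (trans (sym p) q))
  Next-injective (inj₁ p)        (inj₂ (_ , q))  = contradiction (trans (sym p) q) λ ()
  Next-injective (inj₂ (_ , p))  (inj₁ q)        = contradiction (trans (sym q) p) λ ()
  Next-injective (inj₂ (p , _))  (inj₂ (q , _))  = toℕ-injective (suc-injective (trans p (sym q)))

  Windowed : ℕ → Subset n → Set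
  Windowed K I = ∀ a → ∃[ i ] (i < K × (a + i) mod n ∈ I)

  -- The window width: for n ≤ k every nonempty set is a cover, which width
  -- n + 1 expresses while keeping all gaps of a one-element set strictly
  -- below the width.
  Width : ℕ → ℕ → Set
  Width k K = (k < n × K ≡ k) ⊎ (n ≤ k × K ≡ suc n)

  module _ (3≤n : 3 ≤ n) (k : ℕ) where

    module _ (2≤k : 2 ≤ k) (P : Path (cycle n 3≤n) k) where
      open Path P

      private
        p : ∀ i → i < k → Fin n
        p i i<k = vertex (fromℕ< i<k)

        p-adj : ∀ i (h : i < k) (h′ : suc i < k) →
                Next (p i h) (p (suc i) h′) ⊎ Next (p (suc i) h′) (p i h)
        p-adj i h h′ = adjacent _ _ (trans (toℕ-fromℕ< h′) (cong suc (sym (toℕ-fromℕ< h))))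

        p-injective : ∀ {i j} (h : i < k) (h′ : j < k) → p i h ≡ p j h′ → i ≡ j
        p-injective h h′ eq =
          trans (sym (toℕ-fromℕ< h)) (trans (cong toℕ (injective eq)) (toℕ-fromℕ< h′))

        no-turn : ∀ {i} (h : i < k) (h′ : suc (suc i) < k) → p i h ≢ p (suc (suc i)) h′
        no-turn h h′ eq = contradiction (p-injective h h′ eq) λ ()

        forward : (h : 0 < k) (h′ : 1 < k) → Next (p 0 h) (p 1 h′) →
                  ∀ i (g : i < k) (g′ : suc i < k) → Next (p i g) (p (suc i) g′)
        forward h h′ first zero    g g′ = first
        forward h h′ first (suc i) g g′ with p-adj (suc i) g g′
        ... | inj₁ next = next
        ... | inj₂ prev = contradiction
          (Next-injective (forward h h′ first i (<⇒≤ g) g) prev) (no-turn (<⇒≤ g) g′)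

        backward : (h : 0 < k) (h′ : 1 < k) → Next (p 1 h′) (p 0 h) →
                   ∀ i (g : i < k) (g′ : suc i < k) → Next (p (suc i) g′) (p i g)
        backward h h′ first zero    g g′ = first
        backward h h′ first (suc i) g g′ with p-adj (suc i) g g′
        ... | inj₂ prev = prev
        ... | inj₁ next = contradiction
          (trans (Next-functional (backward h h′ first i (<⇒≤ g) g)) (sym (Next-functional next)))
          (no-turn (<⇒≤ g) g′)

        step-mod : ∀ {i j} a m → i ≡ (a + m) mod n → Next i j → j ≡ (a + suc m) mod n
        step-mod {i} {j} a m eq next = toℕ-injective (begin
          toℕ j                       ≡⟨ cong toℕ (Next-functional next) ⟩
          toℕ (suc (toℕ i) mod n)     ≡⟨ toℕ-mod _ ⟩
          suc (toℕ i) % n             ≡⟨ cong (λ w → suc w % n) (trans (cong toℕ eq) (toℕ-mod _)) ⟩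
          suc ((a + m) % n) % n       ≡⟨ cong (_% n) (+-comm 1 _) ⟩
          ((a + m) % n + 1) % n       ≡⟨ %-absorbˡ (a + m) 1 ⟩
          (a + m + 1) % n             ≡⟨ cong (_% n) (trans (+-assoc a m 1) (cong (a +_) (+-comm m 1))) ⟩
          (a + suc m) % n             ≡⟨ toℕ-mod _ ⟨
          toℕ ((a + suc m) mod n)     ∎)
          where open ≡-Reasoning

      -- An injective walk on a cycle cannot turn back, so its first edge decides the direction of
      -- all the others. A path that runs backwards is the arc starting at its last vertex.
      path-is-arc : ∃[ a ] (∀ m → m < k → ∃[ i ] vertex i ≡ (a + m) mod n)
      path-is-arc with p-adj 0 (<⇒≤ 2≤k) 2≤k
      ... | inj₁ first = toℕ (p 0 0<k) , λ m m<k → _ , arc m m<k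
        where
        0<k : 0 < k
        0<k = <⇒≤ 2≤k
        arc : ∀ m (h : m < k) → p m h ≡ (toℕ (p 0 0<k) + m) mod n
        arc zero    h = trans (sym (toℕ-mod-inverse _)) (cong (_mod n) (sym (+-identityʳ _)))
        arc (suc m) h = step-mod _ m (arc m (<⇒≤ h)) (forward 0<k 2≤k first m (<⇒≤ h) h)
      ... | inj₂ first = toℕ (p (pred k) k-1<k) , λ m m<k →
          _ , arc m (k ∸ suc m) (cong pred (m+[n∸m]≡n m<k)) (∸-monoʳ-< z<s m<k)
        where
        0<k : 0 < k
        0<k = <⇒≤ 2≤k
        k-1<k : pred k < k
        k-1<k = ≤-reflexive (suc-pred k {{>-nonZero 0<k}})
        arc : ∀ m j → m + j ≡ pred k → (h : j < k) → p j h ≡ (toℕ (p (pred k) k-1<k) + m) mod n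
        arc zero    j refl h = trans (sym (toℕ-mod-inverse _)) (cong (_mod n) (sym (+-identityʳ _)))
        arc (suc m) j eq   h = step-mod _ m (arc m (suc j) eq′ h′) (backward 0<k 2≤k first j h h′)
          where
          eq′ : m + suc j ≡ pred k
          eq′ = trans (+-suc m j) eq
          h′ : suc j < k
          h′ = ≤-<-trans (subst (suc j ≤_) eq (s≤s (m≤n+m j m))) k-1<k

    -- In the wide case the window condition merely supplies some token `v`, and every `k`-path
    -- visits it: a path avoiding `v` would inject `k ≥ n` vertices into the other `n - 1`.
    windowed⇒cover : ∀ {K I} → 2 ≤ k → Width k K → Windowed K I → IsPathCover (cycle n 3≤n) k I
    windowed⇒cover {I = I} 2≤k (inj₁ (_ , refl)) win P =
      let a , arc = path-is-arc 2≤k P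
          m , m<k , ∈I = win a
          i , eq = arc m m<k
      in i , subst (_∈ I) (sym eq) ∈I
    windowed⇒cover {I = I} 2≤k (inj₂ (n≤k , _)) win P with v , v∈ ← _ , proj₂ (proj₂ (win 0))
      with any? (λ i → Path.vertex P i ≟ᶠ v)
    ... | yes (i , eq) = i , subst (_∈ I) (sym eq) v∈
    ... | no  missed = contradiction (onto n refl P v missed) (<⇒≱ (s≤s n≤k))
      where
      onto : ∀ l → n ≡ l → (P : Path (cycle n 3≤n) k) → ∀ v →
             ¬ (∃[ i ] Path.vertex P i ≡ v) → suc k ≤ n
      onto (suc l) refl P v missed = s≤s (injective⇒≤ λ {i} {j} eq →
        Path.injective P (punchOut-injective (λ e → missed (i , sym e)) (λ e → missed (j , sym e)) eq))

    -- For `k < n` every arc of `k` vertices is itself a path. For `n < k` there are no `k`-paths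
    -- and even the empty set is a cover, so a token has to be given; it lies less than `n` steps
    -- after any starting point.
    cover⇒windowed : ∀ {K I} → Width k K → IsPathCover (cycle n 3≤n) k I → Nonempty I → Windowed K I
    cover⇒windowed {I = I} (inj₁ (k<n , refl)) cov _ a = let i , ∈I = cov P in toℕ i , toℕ<n i , ∈I
      where
      P : Path (cycle n 3≤n) k
      P = record
        { vertex    = λ i → (a + toℕ i) mod n
        ; injective = λ {i} {j} eq → toℕ-injective
            (+-%-injective a (<-trans (toℕ<n i) k<n) (<-trans (toℕ<n j) k<n)
              (trans (sym (toℕ-mod _)) (trans (cong toℕ eq) (toℕ-mod _))))
        ; adjacent  = λ i j eq → inj₁ (subst (Next ((a + toℕ i) mod n))
            (cong (_mod n) (trans (sym (+-suc a (toℕ i))) (cong (a +_) (sym eq)))) (Next-mod (a + toℕ i)))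
        }
    cover⇒windowed {I = I} (inj₂ (_ , refl)) _ (v , v∈) a =
      (toℕ v + opposite% a) % n , m<n⇒m<1+n (m%n<n _ n) ,
      subst (_∈ I) (sym (trans (mod-cong (rotate-unrotate a (toℕ v))) (toℕ-mod-inverse v))) v∈

-- Sizes of covers: frozen sets and slack.

∣∣≡0⇒≡∅ : ∀ {n} (I : Subset n) → ∣ I ∣ ≡ 0 → I ≡ ∅
∣∣≡0⇒≡∅ []            eq = refl
∣∣≡0⇒≡∅ (outside ∷ I) eq = cong (outside ∷_) (∣∣≡0⇒≡∅ I eq)

distinct⇒positive : ∀ {n} {I J : Subset n} → ∣ I ∣ ≡ ∣ J ∣ → I ≢ J → 0 < ∣ I ∣
distinct⇒positive {I = I} {J} eq I≢J with ∣ I ∣ in eq₀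
... | zero  = contradiction (trans (∣∣≡0⇒≡∅ I eq₀) (sym (∣∣≡0⇒≡∅ J (sym eq)))) I≢J
... | suc _ = z<s

positive⇒nonempty : ∀ {n} {I : Subset n} → 0 < ∣ I ∣ → Nonempty I
positive⇒nonempty {n} {I} pos with nonempty? I
... | yes ne = ne
... | no  em = contradiction (subst (0 <_) (trans (cong ∣_∣ (Empty-unique em)) (∣⊥∣≡0 n)) pos) (n≮n 0)

⌈c*k/k⌉≡c : ∀ c k .{{_ : NonZero k}} → ⌈ c * k / k ⌉ ≡ c
⌈c*k/k⌉≡c c k = begin
  (c * k + pred k) / k        ≡⟨ +-distrib-/-∣ˡ (pred k) (n∣m*n c) ⟩
  c * k / k + pred k / k      ≡⟨ cong₂ _+_ (m*n/n≡m c k) (m<n⇒m/n≡0 (≤-reflexive (suc-pred k))) ⟩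
  c + 0                       ≡⟨ +-identityʳ c ⟩
  c                           ∎
  where open ≡-Reasoning

module _ (n : ℕ) .{{_ : NonZero n}} where

  around : Subset n → ℕ → ℕ
  around I a = indicator I (a % n)

  around-periodic : ∀ I a → around I (a + n) ≡ around I a
  around-periodic I a = cong (indicator I) ([m+n]%n≡m%n a n)

  around-∈ : ∀ {I} a → a mod n ∈ I → around I a ≡ 1
  around-∈ {I} a a∈ = trans (cong (indicator I) (sym (toℕ-mod n a))) (indicator-∈ a∈)

  around-toℕ : ∀ I (i : Fin n) → around I (toℕ i) ≡ indicator I (toℕ i)
  around-toℕ I i = cong (indicator I) (m<n⇒m%n≡m (toℕ<n i))

  cum-around : ∀ I → cum (around I) n ≡ ∣ I ∣
  cum-around I = trans (cum-cong n λ i i<n → cong (indicator I) (m<n⇒m%n≡m i<n)) (cum-indicator I)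

  heightFrom : Subset n → ℕ → ℕ → ℕ
  heightFrom I b = cum (λ i → around I (b + i))

  heightFrom-periodic : ∀ I b v → heightFrom I b (v + n) ≡ heightFrom I b v + ∣ I ∣
  heightFrom-periodic I b v =
    trans (cum-periodic _ n (λ a → trans (cong (around I) (sym (+-assoc b a n))) (around-periodic I (b + a))) v)
          (cong (heightFrom I b v +_) (trans (cum-rotate (around I) n (around-periodic I) b) (cum-around I)))

  heightFrom-grow : ∀ {I K} → Windowed n K I → ∀ b v → heightFrom I b v < heightFrom I b (v + K)
  heightFrom-grow {I} {K} win b v with i , i<K , ∈I ← win (b + v) = begin-strict
    f v                                ≤⟨ cum-mono _ (m≤m+n v i) ⟩
    f (v + i)                          <⟨ n<1+n _ ⟩
    suc (f (v + i))                    ≡⟨ +-comm 1 _ ⟩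
    f (v + i) + 1                      ≡⟨ cong (f (v + i) +_) (around-∈ (b + (v + i)) (subst (λ w → w mod n ∈ I) (+-assoc b v i) ∈I)) ⟨
    f (suc (v + i))                    ≤⟨ cum-mono _ (≤-trans (≤-reflexive (sym (+-suc v i))) (+-monoʳ-≤ v i<K)) ⟩
    f (v + K)                          ∎
    where
    open ≤-Reasoning
    f : ℕ → ℕ
    f = heightFrom I b

  -- With exactly n / k tokens every window holds exactly one of them.
  tight⇒periodic : ∀ {I k} c → Windowed n k I → ∣ I ∣ ≡ suc c → n ≡ suc c * k →
                   ∀ a → around I (a + k) ≡ around I a
  tight⇒periodic {I} {k} c win size n≡ a = +-cancelˡ-≡ (suc (f a)) _ _ (begin
    suc (f a) + around I (a + k)     ≡⟨ cong (_+ around I (a + k)) (exact a) ⟨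
    f (suc (a + k))                  ≡⟨ exact (suc a) ⟩
    suc (f a) + around I a           ∎)
    where
    open ≡-Reasoning
    f : ℕ → ℕ
    f = heightFrom I 0
    exact : ∀ v → f (v + k) ≡ suc (f v)
    exact v = grow-exact f k (heightFrom-grow win 0) c v
      (trans (cong (λ w → f (v + w)) (sym n≡)) (trans (heightFrom-periodic I 0 v) (cong (f v +_) size)))

  module _ (3≤n : 3 ≤ n) (k : ℕ) .{{_ : NonZero k}} where

    -- `I` and `J` are both invariant under rotation by `k`. If `x` leaves `I`, then `x + k` also
    -- lies in `I` and not in `J`, and it differs from `x` because `0 < k < n`; but a step removes a
    -- single vertex.
    frozen⇒no-step : ∀ {R I J} c → ∣ I ∣ ≡ suc c → n ≡ suc c * k → k < n →
                     ¬ Step R (cycle n 3≤n) k I J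
    frozen⇒no-step {R} {I} {J} c size n≡ k<n s =
      contradiction (+-%-injective n (toℕ x) k<n (>-nonZero⁻¹ n) (begin
        (toℕ x + k) % n     ≡⟨ toℕ-mod n _ ⟨
        toℕ y               ≡⟨ cong toℕ (Step-only-x s y∈I y∉J) ⟩
        toℕ x               ≡⟨ m<n⇒m%n≡m (toℕ<n x) ⟨
        toℕ x % n           ≡⟨ cong (_% n) (+-identityʳ (toℕ x)) ⟨
        (toℕ x + 0) % n     ∎)) (≢-nonZero⁻¹ k)
      where
      open ≡-Reasoning
      open Step s using (x; cover; cover′)
      y : Fin n
      y = (toℕ x + k) mod n
      windowed : ∀ {I} → IsPathCover (cycle n 3≤n) k I → ∣ I ∣ ≡ suc c → Windowed n k I
      windowed cov size = cover⇒windowed n 3≤n k (inj₁ (k<n , refl)) cov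
        (positive⇒nonempty (subst (0 <_) (sym size) z<s))
      shift : ∀ {I} → IsPathCover (cycle n 3≤n) k I → ∣ I ∣ ≡ suc c → indicator I (toℕ y) ≡ indicator I (toℕ x)
      shift {I} cov size = begin
        indicator I (toℕ y)      ≡⟨ cong (indicator I) (toℕ-mod n _) ⟩
        around I (toℕ x + k)     ≡⟨ tight⇒periodic c (windowed cov size) size n≡ (toℕ x) ⟩
        around I (toℕ x)         ≡⟨ around-toℕ I x ⟩
        indicator I (toℕ x)      ∎
      y∈I : y ∈ I
      y∈I = indicator-positive (subst (0 <_) (sym (trans (shift cover size) (indicator-∈ (Step-x∈ s)))) z<s)
      y∉J : y ∉ J
      y∉J y∈ = contradiction (trans (sym (indicator-∈ y∈))
        (trans (shift cover′ (trans (sym (Step-∣∣ s)) size)) (indicator-∉ (Step-x∉ s)))) λ ()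

    frozen⇒irreconfigurable : ∀ {R I J} → 2 ≤ k → I ≢ J → Frozen n k I J →
                              ¬ Reconfigurable R (cycle n 3≤n) k I J
    frozen⇒irreconfigurable 2≤k I≢J _ ε = I≢J refl
    frozen⇒irreconfigurable 2≤k I≢J (size , _ , suc c , s≤s 1≤c , n≡) (s ◅ _) =
      frozen⇒no-step c (trans size (trans (cong (λ w → ⌈ w / k ⌉) n≡) (⌈c*k/k⌉≡c (suc c) k))) n≡
        (subst (k <_) (sym n≡) (m<m+n k (positive-product c 1≤c))) s
      where
      positive-product : ∀ c → 1 ≤ c → 0 < c * k
      positive-product (suc c) _ = <-≤-trans (>-nonZero⁻¹ k) (m≤m+n k _)

    unfrozen⇒slack : ∀ {I J K} → Width n k K → Windowed n K I → 0 < ∣ I ∣ → ∣ I ∣ ≡ ∣ J ∣ →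
                     ¬ Frozen n k I J → n < ∣ I ∣ * K
    unfrozen⇒slack {I} (inj₂ (_ , refl)) win pos eq unfrozen =
      ≤-trans (≤-reflexive (sym (+-identityʳ (suc n)))) (*-monoˡ-≤ (suc n) pos)
    unfrozen⇒slack {I} (inj₁ (k<n , refl)) win pos eq unfrozen
      with m≤n⇒m<n∨m≡n (period≤ (heightFrom I 0) k (heightFrom-grow win 0) n ∣ I ∣ (heightFrom-periodic I 0))
    ... | inj₁ lt = lt
    ... | inj₂ n≡ = contradiction
      (size , trans (sym eq) size , ∣ I ∣ , several ∣ I ∣ n≡ , n≡) unfrozen
      where
      size : ∣ I ∣ ≡ ⌈ n / k ⌉
      size = trans (sym (⌈c*k/k⌉≡c ∣ I ∣ k)) (cong (λ w → ⌈ w / k ⌉) (sym n≡))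
      several : ∀ m → n ≡ m * k → 2 ≤ m
      several zero          eq = contradiction eq (≢-nonZero⁻¹ n)
      several (suc zero)    eq = contradiction (trans (sym (+-identityʳ k)) (sym eq)) (<⇒≢ k<n)
      several (suc (suc m)) eq = s≤s (s≤s z≤n)

  reconfigurable⇒∣∣≡ : ∀ {R G k I J} → Reconfigurable {n} R G k I J → ∣ I ∣ ≡ ∣ J ∣
  reconfigurable⇒∣∣≡ ε       = refl
  reconfigurable⇒∣∣≡ (s ◅ σ) = trans (Step-∣∣ s) (reconfigurable⇒∣∣≡ σ)

-- Recorded sequences

Traced : ∀ {n} → Rule → Graph n → ℕ → Subset n → Subset n → List ℕ → Set
Traced R G k I X out = Σ[ σ ∈ Reconfigurable R G k I X ] out ≡ moves σ

Traced-snoc : ∀ {n R} {G : Graph n} {k I X Y out} → Traced R G k I X out → (s : Step R G k X Y) →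
              ∀ {x y} → toℕ (Step.x s) ≡ x → toℕ (Step.y s) ≡ y → Traced R G k I Y (out ∷ʳ x ∷ʳ y)
Traced-snoc (σ , refl) s refl refl = σ ◅◅ (s ◅ ε) ,
  trans (++-assoc (moves σ) (_ ∷ []) (_ ∷ [])) (sym (moves-snoc σ))
  where
  moves-snoc : ∀ {I} (σ : Reconfigurable _ _ _ I _) →
               moves (σ ◅◅ (s ◅ ε)) ≡ moves σ ++ toℕ (Step.x s) ∷ toℕ (Step.y s) ∷ []
  moves-snoc ε       = refl
  moves-snoc (r ◅ σ) = cong (λ l → _ ∷ _ ∷ l) (moves-snoc σ)

-- Heights on `[0, n]` and the sets they encode.

width≥2 : ∀ {n k K} .{{_ : NonZero n}} → 3 ≤ n → 2 ≤ k → Width n k K → 2 ≤ K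
width≥2 3≤n 2≤k (inj₁ (_ , refl)) = 2≤k
width≥2 3≤n 2≤k (inj₂ (_ , refl)) = s≤s (≤-trans (s≤s z≤n) 3≤n)

width≤1+n : ∀ {n k K} .{{_ : NonZero n}} → Width n k K → K ≤ suc n
width≤1+n {n} (inj₁ (k<n , refl)) = ≤-trans (<⇒≤ k<n) (n≤1+n n)
width≤1+n     (inj₂ (_ , refl))   = ≤-refl

module Heights (n : ℕ) .{{_ : NonZero n}} (3≤n : 3 ≤ n) (k K m b : ℕ)
               (2≤k : 2 ≤ k) (width : Width n k K) where

  G : Graph n
  G = cycle n 3≤n

  2≤K : 2 ≤ K
  2≤K = width≥2 3≤n 2≤k width

  K≤1+n : K ≤ suc n
  K≤1+n = width≤1+n width

  label : ℕ → ℕ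
  label z = (b + z) % n

  at : ℕ → Fin n
  at z = (b + z) mod n

  index : Fin n → ℕ
  index i = (toℕ i + opposite% n b) % n

  index<n : ∀ i → index i < n
  index<n i = m%n<n _ n

  toℕ-at : ∀ z → toℕ (at z) ≡ label z
  toℕ-at z = toℕ-mod n (b + z)

  at-index : ∀ i → at (index i) ≡ i
  at-index i = trans (mod-cong n (rotate-unrotate n b (toℕ i))) (toℕ-mod-inverse n i)

  index-at : ∀ {z} → z < n → index (at z) ≡ z
  index-at {z} z<n = trans (cong (λ w → (w + opposite% n b) % n) (toℕ-at z))
    (trans (unrotate n b z) (m<n⇒m%n≡m z<n))

  at-+n : ∀ z → at (n + z) ≡ at z
  at-+n z = mod-cong n (trans (cong (_% n) (trans (cong (b +_) (+-comm n z)) (sym (+-assoc b z n)))) ([m+n]%n≡m%n (b + z) n))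

  -- A set is encoded by a height function: position z, counted from the
  -- base vertex b, carries a token when the height increases from z to z + 1.
  tokens : (ℕ → ℕ) → Subset n
  tokens f = tabulate λ i → f (index i) <ᵇ f (suc (index i))

  tokens-∈ : ∀ f {i} → f (index i) < f (suc (index i)) → i ∈ tokens f
  tokens-∈ f {i} up = lookup⇒[]= i _ (trans (lookup∘tabulate _ i) (Equivalence.to T-≡ (<⇒<ᵇ up)))

  tokens-∋ : ∀ f {i} → i ∈ tokens f → f (index i) < f (suc (index i))
  tokens-∋ f {i} i∈ = <ᵇ⇒< _ _ (Equivalence.from T-≡ (trans (sym (lookup∘tabulate _ i)) ([]=⇒lookup i∈)))

  tokens-at : ∀ f {z} → z < n → f z < f (suc z) → at z ∈ tokens f
  tokens-at f z<n up = tokens-∈ f (subst (λ w → f w < f (suc w)) (sym (index-at z<n)) up)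

  tokens-at⁻ : ∀ f {z} → z < n → at z ∈ tokens f → f z < f (suc z)
  tokens-at⁻ f z<n z∈ = subst (λ w → f w < f (suc w)) (index-at z<n) (tokens-∋ f z∈)

  tokens-⊆ : ∀ {f f′} → (∀ z → z < n → f z < f (suc z) → f′ z < f′ (suc z)) →
             ∀ {i} → i ∈ tokens f → i ∈ tokens f′
  tokens-⊆ {f} {f′} imp {i} i∈ = tokens-∈ f′ (imp (index i) (index<n i) (tokens-∋ f i∈))

  tokens-shift : ∀ {f f′} c → (∀ z → z ≤ n → f′ z ≡ c + f z) → tokens f ≡ tokens f′
  tokens-shift {f} {f′} c eq = ⊆-antisym
    (tokens-⊆ λ z z<n up → subst₂ _<_ (sym (eq z (<⇒≤ z<n))) (sym (eq (suc z) z<n)) (+-monoʳ-< c up))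
    (tokens-⊆ λ z z<n up → +-cancelˡ-< c _ _ (subst₂ _<_ (eq z (<⇒≤ z<n)) (eq (suc z) z<n) up))

  tokens-cong : ∀ {f f′} → (∀ z → z ≤ n → f′ z ≡ f z) → tokens f ≡ tokens f′
  tokens-cong = tokens-shift 0

  tokens-indicator : ∀ {f} I → (∀ z → z < n → f (suc z) ≡ f z + indicator I (label z)) → tokens f ≡ I
  tokens-indicator {f} I rec = ⊆-antisym
    (λ {i} i∈ → subst (_∈ I) (at-index i) (indicator-positive
      (+-cancelˡ-< (f (index i)) _ _ (subst₂ _<_ (sym (+-identityʳ _))
        (trans (rec _ (index<n i)) (cong (λ w → f (index i) + indicator I w) (sym (toℕ-at _)))) (tokens-∋ f i∈)))))
    (λ {i} i∈ → tokens-∈ f (subst (f (index i) <_)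
      (sym (trans (rec _ (index<n i)) (cong (f (index i) +_)
        (trans (cong (indicator I) (trans (sym (toℕ-at _)) (cong toℕ (at-index i)))) (indicator-∈ i∈)))))
      (m<m+n _ z<s)))

  -- The growth condition of the periodic extension, expressed on `[0, n]` alone: in `outer` the
  -- window starting at `v` passes the base and ends at `u` of the next turn, where heights are
  -- larger by `m`. The restriction `v < n` keeps `u` within range even for `K = n + 1`.
  record Spanning (f : ℕ → ℕ) : Set where
    field
      total : f n ≡ f 0 + m
      inner : ∀ v → v + K ≤ n → f v < f (v + K)
      outer : ∀ u v → u + n ≡ v + K → v < n → f v < f u + m

  open Spanning

  wrapped≤n : ∀ {u v} → u + n ≡ v + K → v < n → u ≤ n
  wrapped≤n {u} {v} eq v<n = +-cancelʳ-≤ n u n (begin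
    u + n        ≡⟨ eq ⟩
    v + K        ≤⟨ +-monoʳ-≤ v K≤1+n ⟩
    v + suc n    ≡⟨ +-suc v n ⟩
    suc v + n    ≤⟨ +-monoˡ-≤ n v<n ⟩
    n + n        ∎)
    where open ≤-Reasoning

  spanning⇒windowed : ∀ {f} → Spanning f → Windowed n K (tokens f)
  spanning⇒windowed {f} sp a = let i , i<K , ∈f = window in
    i , i<K , subst (_∈ tokens f) (sym (shift i)) ∈f
    where
    v : ℕ
    v = (a + opposite% n b) % n
    v<n : v < n
    v<n = m%n<n _ n
    shift : ∀ i → (a + i) mod n ≡ at (v + i)
    shift i = mod-cong n (begin
      (a + i) % n              ≡⟨ %-absorbˡ n a i ⟨
      (a % n + i) % n          ≡⟨ cong (λ w → (w + i) % n) (rotate-unrotate n b a) ⟨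
      ((b + v) % n + i) % n    ≡⟨ %-absorbˡ n (b + v) i ⟩
      (b + v + i) % n          ≡⟨ cong (_% n) (+-assoc b v i) ⟩
      (b + (v + i)) % n        ∎)
      where open ≡-Reasoning
    window : ∃[ i ] (i < K × at (v + i) ∈ tokens f)
    window with v + K ≤? n
    ... | yes v+K≤n = let i , i<K , up = crossing f K v (inner sp v v+K≤n) in
      i , i<K , tokens-at f (<-≤-trans (+-monoʳ-< v i<K) v+K≤n) up
    ... | no  v+K≰n = window-outer (v + K ∸ n) (m∸n+n≡m (<⇒≤ (≰⇒> v+K≰n)))
      where
      n∸v≤K : n ∸ v ≤ K
      n∸v≤K = ≤-trans (∸-monoˡ-≤ v (<⇒≤ (≰⇒> v+K≰n))) (≤-reflexive (m+n∸m≡n v K))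
      window-outer : ∀ u → u + n ≡ v + K → ∃[ i ] (i < K × at (v + i) ∈ tokens f)
      -- Either a token lies before the base, or `f v` is already at least `f 0 + m`, and then
      -- `outer` forces a rise between the base and `u`.
      window-outer u eq with f v <? f n
      ... | yes lt = let i , i< , up = crossing f (n ∸ v) v (subst (λ w → f v < f w) (sym (m+[n∸m]≡n (<⇒≤ v<n))) lt) in
        i , <-≤-trans i< n∸v≤K ,
        tokens-at f (<-≤-trans (+-monoʳ-< v i<) (≤-reflexive (m+[n∸m]≡n (<⇒≤ v<n)))) up
      ... | no  ≮ = let i , i<u , up = crossing f u 0 f0<fu in
        n ∸ v + i , i+<K i<u ,
        subst (_∈ tokens f) (sym (trans (cong at (trans (sym (+-assoc v (n ∸ v) i)) (cong (_+ i) (m+[n∸m]≡n (<⇒≤ v<n))))) (at-+n i)))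
          (tokens-at f (<-≤-trans i<u (wrapped≤n eq v<n)) up)
        where
        f0<fu : f 0 < f u
        f0<fu = +-cancelʳ-< m _ _ (≤-<-trans (≤-trans (≤-reflexive (sym (total sp))) (≮⇒≥ ≮)) (outer sp u v eq v<n))
        i+<K : ∀ {i} → i < u → n ∸ v + i < K
        i+<K {i} i<u = +-cancelˡ-< v _ _ (begin-strict
          v + (n ∸ v + i)    ≡⟨ +-assoc v (n ∸ v) i ⟨
          v + (n ∸ v) + i    ≡⟨ cong (_+ i) (m+[n∸m]≡n (<⇒≤ v<n)) ⟩
          n + i              <⟨ +-monoʳ-< n i<u ⟩
          n + u              ≡⟨ +-comm n u ⟩
          u + n              ≡⟨ eq ⟩
          v + K              ∎)
          where open ≤-Reasoning

  spanning⇒cover : ∀ {f} → Spanning f → IsPathCover G k (tokens f)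
  spanning⇒cover sp = windowed⇒cover n 3≤n k 2≤k width (spanning⇒windowed sp)

  -- Lowering helps wherever the changed height is the smaller side of an inequality. Only windows
  -- ending at a changed position need a check, and there the old height at the start may be used,
  -- being an upper bound for the new one.
  Spanning-lower : ∀ {f f′} → Spanning f → f′ n ≡ f′ 0 + m → (∀ w → w ≤ n → f′ w ≤ f w) →
    (∀ w → w ≤ n → f w ≡ f′ w ⊎ ((∀ v → v + K ≡ w → f v < f′ w) ×
                                 (∀ v → w + n ≡ v + K → v < n → f v < f′ w + m))) →
    Spanning f′
  Spanning-lower {f} {f′} sp total′ below clear = record
    { total = total′
    ; inner = λ v v+K≤n → ≤-<-trans (below v (≤-trans (m≤m+n v K) v+K≤n)) (case₁ v v+K≤n)
    ; outer = λ u v eq v<n → ≤-<-trans (below v (<⇒≤ v<n)) (case₂ u v eq v<n) }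
    where
    case₁ : ∀ v → v + K ≤ n → f v < f′ (v + K)
    case₁ v v+K≤n with clear (v + K) v+K≤n
    ... | inj₁ same     = subst (f v <_) same (inner sp v v+K≤n)
    ... | inj₂ (ok , _) = ok v refl
    case₂ : ∀ u v → u + n ≡ v + K → v < n → f v < f′ u + m
    case₂ u v eq v<n with clear u (wrapped≤n eq v<n)
    ... | inj₁ same     = subst (λ w → f v < w + m) same (outer sp u v eq v<n)
    ... | inj₂ (_ , ok) = ok v eq v<n

  -- Dual to `Spanning-lower`: only windows that start at a changed position can break.
  Spanning-raise : ∀ {f f′} → Spanning f → f′ n ≡ f′ 0 + m → (∀ w → w ≤ n → f w ≤ f′ w) →
    (∀ w → w ≤ n → f w ≡ f′ w ⊎ ((w + K ≤ n → f′ w < f (w + K)) ×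
                                 (∀ u → u + n ≡ w + K → f′ w < f u + m))) →
    Spanning f′
  Spanning-raise {f} {f′} sp total′ above clear = record
    { total = total′
    ; inner = λ v v+K≤n → <-≤-trans (case₁ v v+K≤n) (above (v + K) v+K≤n)
    ; outer = λ u v eq v<n → <-≤-trans (case₂ u v eq v<n) (+-monoˡ-≤ m (above u (wrapped≤n eq v<n))) }
    where
    case₁ : ∀ v → v + K ≤ n → f′ v < f (v + K)
    case₁ v v+K≤n with clear v (≤-trans (m≤m+n v K) v+K≤n)
    ... | inj₁ same     = subst (_< f (v + K)) same (inner sp v v+K≤n)
    ... | inj₂ (ok , _) = ok v+K≤n
    case₂ : ∀ u v → u + n ≡ v + K → v < n → f′ v < f u + m
    case₂ u v eq v<n with clear v (<⇒≤ v<n)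
    ... | inj₁ same     = subst (_< f u + m) same (outer sp u v eq v<n)
    ... | inj₂ (_ , ok) = ok u eq

  tokens-step : ∀ {R f f′ x y} → Spanning f → Spanning f′ → x < n → y < n →
    f x < f (suc x) → ¬ f′ x < f′ (suc x) → ¬ f y < f (suc y) → f′ y < f′ (suc y) →
    (∀ z → z < n → z ≢ x → z ≢ y → (f z < f (suc z) → f′ z < f′ (suc z)) × (f′ z < f′ (suc z) → f z < f (suc z))) →
    AllowedBy R G (at x) (at y) → Step R G k (tokens f) (tokens f′)
  tokens-step {f = f} {f′} {x} {y} sp sp′ x<n y<n fx f′x fy f′y other ok = record
    { cover  = spanning⇒cover sp
    ; cover′ = spanning⇒cover sp′
    ; x = at x ; y = at y
    ; I─I′ = ─-singleton (tokens-at f x<n fx) (f′x ∘ tokens-at⁻ f′ x<n) λ {i} i≢ i∈ →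
        tokens-∈ f′ (proj₁ (other (index i) (index<n i) (differs i≢)
          λ eq → fy (subst (λ z → f z < f (suc z)) eq (tokens-∋ f i∈))) (tokens-∋ f i∈))
    ; I′─I = ─-singleton (tokens-at f′ y<n f′y) (fy ∘ tokens-at⁻ f y<n) λ {i} i≢ i∈ →
        tokens-∈ f (proj₂ (other (index i) (index<n i)
          (λ eq → f′x (subst (λ z → f′ z < f′ (suc z)) eq (tokens-∋ f′ i∈))) (differs i≢)) (tokens-∋ f′ i∈))
    ; allowed = ok }
    where
    differs : ∀ {i z} → i ≢ at z → index i ≢ z
    differs {i} i≢ eq = i≢ (trans (sym (at-index i)) (cong at eq))

  adjacent⇒allowed : ∀ R {x y} → Graph.Adj G x y → AllowedBy R G x y
  adjacent⇒allowed TS adj = adj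
  adjacent⇒allowed TJ adj = tt

  at-adjacent : ∀ z → Graph.Adj G (at z) (at (suc z))
  at-adjacent z = inj₁ (subst (λ w → Next (at z) (w mod n)) (sym (+-suc b z)) (Next-mod n (b + z)))

  -- Lowering the height at z + 1 slides the token at z to z + 1.
  slide : ∀ {R f f′ z} → suc z < n → Spanning f → Spanning f′ →
          f (suc z) ≡ suc (f z) → f (suc (suc z)) ≡ f (suc z) → f (suc z) ≡ suc (f′ (suc z)) →
          (∀ w → w ≤ n → w ≢ suc z → f w ≡ f′ w) → Step R G k (tokens f) (tokens f′)
  slide {R} {f} {f′} {z} 1+z<n sp sp′ up flat dec same =
    tokens-step sp sp′ (<⇒≤ 1+z<n) 1+z<n
      (≤-reflexive (sym up))
      (≤⇒≯ (≤-reflexive (suc-injective (trans (sym dec) (trans up (cong suc (same z (<⇒≤ (<⇒≤ 1+z<n)) (<⇒≢ ≤-refl))))))))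
      (≤⇒≯ (≤-reflexive flat))
      (≤-reflexive (trans (sym dec) (trans (sym flat) (same (suc (suc z)) 1+z<n (>⇒≢ ≤-refl)))))
      (λ w w<n w≢z w≢1+z → subst₂ _<_ (same w (<⇒≤ w<n) w≢1+z) (same (suc w) w<n (w≢z ∘ suc-injective)) ,
                           subst₂ _<_ (sym (same w (<⇒≤ w<n) w≢1+z)) (sym (same (suc w) w<n (w≢z ∘ suc-injective))))
      (adjacent⇒allowed R (at-adjacent z))

  -- Position `n` is the base one turn later, so this slide lowers the heights at `n` and at 0
  -- together.
  slide-to-base : ∀ {R f f′ z} → suc z ≡ n → z ≢ 0 → Spanning f → Spanning f′ →
          f n ≡ suc (f z) → f 1 ≡ f 0 → f n ≡ suc (f′ n) → f 0 ≡ suc (f′ 0) →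
          (∀ w → w ≤ n → w ≢ 0 → w ≢ n → f w ≡ f′ w) →
          Σ[ s ∈ Step R G k (tokens f) (tokens f′) ] (Step.x s ≡ at z × Step.y s ≡ at 0)
  slide-to-base {R} {f} {f′} {z} refl z≢0 sp sp′ up flat dec dec₀ same =
    _,_ (tokens-step {x = z} {y = 0} sp sp′ ≤-refl z<s
      (≤-reflexive (sym up))
      (≤⇒≯ (≤-reflexive (suc-injective (trans (sym dec) (trans up (cong suc (same z (n≤1+n z) z≢0 (<⇒≢ ≤-refl))))))))
      (≤⇒≯ (≤-reflexive flat))
      (≤-reflexive (trans (sym dec₀) (trans (sym flat) (same 1 (s≤s z≤n) (λ ()) (λ eq → z≢0 (sym (suc-injective eq)))))))
      (λ w w<n w≢z w≢0 → let eq₁ = same w (<⇒≤ w<n) w≢0 (<⇒≢ w<n) ; eq₂ = same (suc w) w<n (λ ()) (w≢z ∘ suc-injective) in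
         subst₂ _<_ eq₁ eq₂ , subst₂ _<_ (sym eq₁) (sym eq₂))
      (adjacent⇒allowed R (subst (Graph.Adj G (at z)) (trans (cong at (sym (+-identityʳ (suc z)))) (at-+n 0)) (at-adjacent z)))) (refl , refl)

-- Comparing two heights with increments 0 and 1.

Gentle : ℕ → (ℕ → ℕ) → Set
Gentle n f = ∀ z → z < n → f z ≤ f (suc z) × f (suc z) ≤ suc (f z)

gentle-mono : ∀ {n f} → Gentle n f → ∀ {u v} → u ≤ v → v ≤ n → f u ≤ f v
gentle-mono {n} {f} gf {u} {v} u≤v v≤n = go (≤⇒≤′ u≤v) v≤n
  where
  go : ∀ {v} → u ≤′ v → v ≤ n → f u ≤ f v
  go (≤′-reflexive refl) _   = ≤-refl
  go (≤′-step u≤v)       v<n = ≤-trans (go u≤v (<⇒≤ v<n)) (proj₁ (gf _ v<n))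

Leave : (F G : ℕ → ℕ) → ℕ → Set
Leave F G z = F (suc z) ≡ suc (F z) × G (suc z) ≡ G z

-- For gentle heights this is 1 exactly at the tokens of `F` that `G` lacks. It is the very
-- expression that `collectStep` evaluates, truncated subtraction included.
leaving : (F G : ℕ → ℕ) → ℕ → ℕ
leaving F G z = (F (suc z) ∸ F z) ∸ (G (suc z) ∸ G z)

suc∸ : ∀ {a c} → a ≡ suc c → a ∸ c ≡ 1
suc∸ {c = c} refl = m+n∸n≡m 1 c

same∸ : ∀ {a c : ℕ} → a ≡ c → a ∸ c ≡ 0
same∸ {c = c} refl = n∸n≡0 c

Leave⇒leaving : ∀ F G z → Leave F G z → leaving F G z ≡ 1 × leaving G F z ≡ 0
Leave⇒leaving F G z (up , flat) rewrite suc∸ up | same∸ flat = refl , refl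

leave-cases : ∀ {n F G} → Gentle n F → Gentle n G → ∀ z → z < n →
              Leave F G z ⊎ Leave G F z ⊎
              (leaving F G z ≡ 0 × leaving G F z ≡ 0 × F (suc z) + G z ≡ G (suc z) + F z)
leave-cases {F = F} {G} gF gG z z<n
  with m≤n⇒m<n∨m≡n (proj₂ (gF z z<n)) | m≤n⇒m<n∨m≡n (proj₂ (gG z z<n))
... | inj₂ up   | inj₂ up′   rewrite suc∸ up | suc∸ up′ =
  inj₂ (inj₂ (refl , refl , trans (cong (_+ G z) up) (trans (cong suc (+-comm (F z) (G z))) (cong (_+ F z) (sym up′)))))
... | inj₂ up   | inj₁ lt    = inj₁ (up , ≤-antisym (s≤s⁻¹ lt) (proj₁ (gG z z<n)))
... | inj₁ lt   | inj₂ up    = inj₂ (inj₁ (up , ≤-antisym (s≤s⁻¹ lt) (proj₁ (gF z z<n))))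
... | inj₁ lt   | inj₁ lt′
  with flat ← ≤-antisym (s≤s⁻¹ lt) (proj₁ (gF z z<n)) | flat′ ← ≤-antisym (s≤s⁻¹ lt′) (proj₁ (gG z z<n))
  rewrite same∸ flat | same∸ flat′ =
  inj₂ (inj₂ (refl , refl , trans (cong (_+ G z) flat) (trans (+-comm (F z) (G z)) (cong (_+ F z) (sym flat′)))))

left : (F G : ℕ → ℕ) → ℕ → ℕ
left F G = cum (leaving F G)

left-suc : ∀ F G z → Leave F G z → left F G (suc z) ≡ suc (left F G z) × left G F (suc z) ≡ left G F z
left-suc F G z lv = let eq , eq′ = Leave⇒leaving F G z lv in
  trans (cong (left F G z +_) eq) (+-comm _ 1) , trans (cong (left G F z +_) eq′) (+-identityʳ _)

-- Both sides count the positions below `v` that carry a token of at least one of the two sets.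
balance : ∀ {n F G} → Gentle n F → Gentle n G → F 0 ≡ 0 → G 0 ≡ 0 →
          ∀ v → v ≤ n → F v + left G F v ≡ G v + left F G v
balance gF gG F0 G0 zero    _   = cong (_+ 0) (trans F0 (sym G0))
balance {F = F} {G} gF gG F0 G0 (suc v) v<n
  with ih ← balance gF gG F0 G0 v (<⇒≤ v<n) | leave-cases gF gG v v<n
... | inj₁ lv = let up , flat = lv ; eq , eq′ = left-suc F G v lv in begin
  F (suc v) + left G F (suc v)       ≡⟨ cong₂ _+_ up eq′ ⟩
  suc (F v + left G F v)             ≡⟨ cong suc ih ⟩
  suc (G v + left F G v)             ≡⟨ +-suc (G v) _ ⟨
  G v + suc (left F G v)             ≡⟨ cong₂ _+_ flat eq ⟨
  G (suc v) + left F G (suc v)       ∎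
  where open ≡-Reasoning
... | inj₂ (inj₁ lv) = let up , flat = lv ; eq , eq′ = left-suc G F v lv in begin
  F (suc v) + left G F (suc v)       ≡⟨ cong₂ _+_ flat eq ⟩
  F v + suc (left G F v)             ≡⟨ +-suc (F v) _ ⟩
  suc (F v + left G F v)             ≡⟨ cong suc ih ⟩
  suc (G v + left F G v)             ≡⟨ cong₂ _+_ up eq′ ⟨
  G (suc v) + left F G (suc v)       ∎
  where open ≡-Reasoning
... | inj₂ (inj₂ (eq , eq′ , flat)) = +-cancelʳ-≡ (F v + G v) _ _ (begin
  F (suc v) + left G F (suc v) + (F v + G v)    ≡⟨ cong (λ w → F (suc v) + w + (F v + G v)) (trans (cong (left G F v +_) eq′) (+-identityʳ _)) ⟩
  F (suc v) + left G F v + (F v + G v)          ≡⟨ lemma (F (suc v)) _ (F v) (G v) ⟩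
  F (suc v) + G v + (F v + left G F v)          ≡⟨ cong₂ _+_ flat ih ⟩
  G (suc v) + F v + (G v + left F G v)          ≡⟨ lemma′ (G (suc v)) _ (F v) (G v) ⟩
  G (suc v) + left F G v + (F v + G v)          ≡⟨ cong (λ w → G (suc v) + w + (F v + G v)) (trans (cong (left F G v +_) eq) (+-identityʳ _)) ⟨
  G (suc v) + left F G (suc v) + (F v + G v)    ∎)
  where
  open ≡-Reasoning
  lemma : ∀ a l f g → a + l + (f + g) ≡ a + g + (f + l)
  lemma = solve-∀
  lemma′ : ∀ a l f g → a + f + (g + l) ≡ a + l + (f + g)
  lemma′ = solve-∀

-- Intermediate heights of token jumping.

module Jumps (n : ℕ) .{{_ : NonZero n}} (3≤n : 3 ≤ n) (k K m b : ℕ)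
             (2≤k : 2 ≤ k) (width : Width n k K) where
  open Heights n 3≤n k K m b 2≤k width hiding (G)
  open Spanning

  record Based (f : ℕ → ℕ) : Set where
    field
      spanning : Spanning f
      gentle   : Gentle n f
      at-0     : f 0 ≡ 0
      at-1     : f 1 ≡ 1

    at-n : f n ≡ m
    at-n = trans (total spanning) (cong (_+ m) at-0)

    ≤m : ∀ {v} → v ≤ n → f v ≤ m
    ≤m v≤n = ≤-trans (gentle-mono gentle v≤n ≤-refl) (≤-reflexive at-n)

    positive : ∀ {v} → 0 < v → v ≤ n → 0 < f v
    positive 0<v v≤n = ≤-trans (≤-reflexive (sym at-1)) (gentle-mono gentle 0<v v≤n)

  open Based

  -- After j jumps of the ascending phase, raised by j.
  partway : (F G : ℕ → ℕ) → ℕ → ℕ → ℕ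
  partway F G j z = (F z + j) ⊓ ((G z + j) ⊔ (F z + left G F z))

  module _ {F G : ℕ → ℕ} (bF : Based F) (bG : Based G) where

    private
      bal : ∀ {v} → v ≤ n → F v + left G F v ≡ G v + left F G v
      bal {v} = balance (gentle bF) (gentle bG) (at-0 bF) (at-0 bG) v

    -- Let `x_i` and `y_i` be the `i`-th positions to leave and to be entered. The upward jumps
    -- among the first `j` pairs lower the height at `z` by the number of `i < j` with
    -- `x_i < z ≤ y_i`. If at least `j` positions leave before `z`, that number is
    -- `j - min(j, left G F z)`; the raise by `j` cancels the first term.
    partway-late : ∀ {j z} → z ≤ n → j ≤ left F G z → partway F G j z ≡ F z + (j ⊓ left G F z)
    partway-late {j} {z} z≤ j≤ = begin
      (F z + j) ⊓ ((G z + j) ⊔ (F z + left G F z))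
        ≡⟨ cong ((F z + j) ⊓_) (m≤n⇒m⊔n≡n (≤-trans (+-monoʳ-≤ (G z) j≤) (≤-reflexive (sym (bal z≤))))) ⟩
      (F z + j) ⊓ (F z + left G F z)                  ≡⟨ +-distribˡ-⊓ (F z) j _ ⟨
      F z + (j ⊓ left G F z)                          ∎
      where open ≡-Reasoning

    -- Here every departure before `z` belongs to a pair already treated, so the height at `z` has
    -- reached the minimum of `F` and `G`, up to the raise by `j`.
    partway-early : ∀ {j z} → z ≤ n → left F G z ≤ j → partway F G j z ≡ (F z + j) ⊓ (G z + j)
    partway-early {j} {z} z≤ ≤j = cong ((F z + j) ⊓_)
      (m≥n⇒m⊔n≡m (≤-trans (≤-reflexive (bal z≤)) (+-monoʳ-≤ (G z) ≤j)))

    partway-suc : ∀ {j z} → z ≤ n → left F G z ≤ j → partway F G (suc j) z ≡ suc (partway F G j z)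
    partway-suc {j} {z} z≤ ≤j = begin
      partway F G (suc j) z                 ≡⟨ partway-early z≤ (m≤n⇒m≤1+n ≤j) ⟩
      (F z + suc j) ⊓ (G z + suc j)         ≡⟨ cong₂ _⊓_ (+-suc (F z) j) (+-suc (G z) j) ⟩
      suc ((F z + j) ⊓ (G z + j))           ≡⟨ cong suc (partway-early z≤ ≤j) ⟨
      suc (partway F G j z)                 ∎
      where open ≡-Reasoning

    -- `F + j`, `G + j` and `F + left G F`, the last being the height of the union, grow strictly
    -- over every inner window, and strict inequalities survive `⊓` and `⊔`. The height of the union
    -- may gain more than `m` per turn, so windows past the base need the token at the base instead.
    partway-spanning : ∀ j → Spanning (partway F G j)
    partway-spanning j = record { total = tot ; inner = inn ; outer = out }
      where
      tot : partway F G j n ≡ partway F G j 0 + m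
      tot rewrite at-n bF | at-n bG | at-0 bF | at-0 bG =
        trans (⊓-absorbs-⊔ (m + j) _) (trans (+-comm m j) (cong (_+ m) (sym (⊓-absorbs-⊔ j 0))))
      inn : ∀ v → v + K ≤ n → partway F G j v < partway F G j (v + K)
      inn v v+K≤n = ⊓-mono-< (+-monoˡ-< j (inner (spanning bF) v v+K≤n))
        (⊔-mono-< (+-monoˡ-< j (inner (spanning bG) v v+K≤n))
                  (+-mono-<-≤ (inner (spanning bF) v v+K≤n) (cum-mono (leaving G F) (m≤m+n v K))))
      out : ∀ u v → u + n ≡ v + K → v < n → partway F G j v < partway F G j u + m
      out zero v eq v<n = <-≤-trans (inn v (≤-reflexive (sym eq)))
        (≤-trans (≤-reflexive (cong (partway F G j) (sym eq))) (≤-reflexive tot))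
      -- The left side is at most `m + j`, while the token at the base keeps the height at `u` at
      -- `1 + j` or more.
      out u@(suc _) v eq v<n = begin-strict
        partway F G j v            ≤⟨ m⊓n≤m (F v + j) _ ⟩
        F v + j                    ≤⟨ +-monoˡ-≤ j (≤m bF (<⇒≤ v<n)) ⟩
        m + j                      ≡⟨ +-comm m j ⟩
        j + m                      <⟨ +-monoˡ-< m (⊓-glb (+-monoˡ-≤ j (positive bF z<s u≤n))
                                        (≤-trans (+-monoˡ-≤ j (positive bG z<s u≤n)) (m≤m⊔n _ _))) ⟩
        partway F G j u + m        ∎
        where
        open ≤-Reasoning
        u≤n : u ≤ n
        u≤n = wrapped≤n eq v<n

    module _ {j x y : ℕ} (x<n : x < n) (y<n : y < n)
             (lx : Leave F G x) (ly : Leave G F y)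
             (nx : left F G x ≡ j) (ny : left G F y ≡ j) where

      private
        h h′ : ℕ → ℕ
        h  = partway F G j
        h′ = partway F G (suc j)

        nx+ : left F G (suc x) ≡ suc j
        nx+ = trans (proj₁ (left-suc F G x lx)) (cong suc nx)

        ny+ : left G F (suc y) ≡ suc j
        ny+ = trans (proj₁ (left-suc G F y ly)) (cong suc ny)

        after-x : ∀ {z} → x < z → suc j ≤ left F G z
        after-x x<z = ≤-trans (≤-reflexive (sym nx+)) (cum-mono (leaving F G) x<z)

        until-x : ∀ {z} → z ≤ x → left F G z ≤ j
        until-x z≤x = ≤-trans (cum-mono (leaving F G) z≤x) (≤-reflexive nx)

        after-y : ∀ {z} → y < z → suc j ≤ left G F z
        after-y y<z = ≤-trans (≤-reflexive (sym ny+)) (cum-mono (leaving G F) y<z)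

        until-y : ∀ {z} → z ≤ y → left G F z ≤ j
        until-y z≤y = ≤-trans (cum-mono (leaving G F) z≤y) (≤-reflexive ny)

        raised-before : ∀ {z} → z ≤ n → z ≤ x → h′ z ≡ suc (h z)
        raised-before z≤ z≤x = partway-suc z≤ (until-x z≤x)

        raised-after : ∀ {z} → z ≤ n → x < z → y < z → h′ z ≡ suc (h z)
        raised-after {z} z≤ x<z y<z = begin
          h′ z                                ≡⟨ partway-late z≤ (after-x x<z) ⟩
          F z + (suc j ⊓ left G F z)          ≡⟨ cong (F z +_) (m≤n⇒m⊓n≡m (after-y y<z)) ⟩
          F z + suc j                         ≡⟨ +-suc (F z) j ⟩
          suc (F z + j)                       ≡⟨ cong (λ w → suc (F z + w)) (m≤n⇒m⊓n≡m (<⇒≤ (after-y y<z))) ⟨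
          suc (F z + (j ⊓ left G F z))        ≡⟨ cong suc (partway-late z≤ (<⇒≤ (after-x x<z))) ⟨
          suc (h z)                           ∎
          where open ≡-Reasoning

        equal-between : ∀ {z} → z ≤ n → x < z → z ≤ y → h′ z ≡ h z
        equal-between {z} z≤ x<z z≤y = begin
          h′ z                                ≡⟨ partway-late z≤ (after-x x<z) ⟩
          F z + (suc j ⊓ left G F z)          ≡⟨ cong (F z +_) (m≥n⇒m⊓n≡n (m≤n⇒m≤1+n (until-y z≤y))) ⟩
          F z + left G F z                    ≡⟨ cong (F z +_) (m≥n⇒m⊓n≡n (until-y z≤y)) ⟨
          F z + (j ⊓ left G F z)              ≡⟨ partway-late z≤ (<⇒≤ (after-x x<z)) ⟨
          h z                                 ∎
          where open ≡-Reasoning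

      -- A pair that goes downwards is skipped in this phase: all heights rise by one, which leaves
      -- the encoded set unchanged.
      jump-void : y < x → tokens h ≡ tokens h′
      jump-void y<x = tokens-shift 1 eq
        where
        eq : ∀ z → z ≤ n → h′ z ≡ suc (h z)
        eq z z≤ with z ≤? x
        ... | yes z≤x = raised-before z≤ z≤x
        ... | no  z≰x = raised-after z≤ (≰⇒> z≰x) (<-trans y<x (≰⇒> z≰x))

      -- All heights rise by one except those at positions `z` with `x < z ≤ y`. Relative to the
      -- common raise this stretch drops by one, and that moves the token from `x` to `y`.
      jump-step : x < y → Step TJ (cycle n 3≤n) k (tokens h) (tokens h′)
      jump-step x<y = tokens-step {R = TJ} (partway-spanning j) (partway-spanning (suc j)) x<n y<n
        (≤-reflexive (sym hx)) (≤⇒≯ (≤-reflexive h′x)) (≤⇒≯ (≤-reflexive hy)) (≤-reflexive (sym h′y))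
        other tt
        where
        open ≡-Reasoning
        hx : h (suc x) ≡ suc (h x)
        hx = begin
          h (suc x)                                   ≡⟨ partway-late x<n (≤-trans (n≤1+n j) (≤-reflexive (sym nx+))) ⟩
          F (suc x) + (j ⊓ left G F (suc x))          ≡⟨ cong₂ (λ a c → a + (j ⊓ c)) (proj₁ lx) (proj₂ (left-suc F G x lx)) ⟩
          suc (F x + (j ⊓ left G F x))                ≡⟨ cong suc (partway-late (<⇒≤ x<n) (≤-reflexive (sym nx))) ⟨
          suc (h x)                                   ∎
        h′x : h′ (suc x) ≡ h′ x
        h′x = begin
          h′ (suc x)     ≡⟨ equal-between x<n ≤-refl x<y ⟩
          h (suc x)      ≡⟨ hx ⟩
          suc (h x)      ≡⟨ raised-before (<⇒≤ x<n) ≤-refl ⟨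
          h′ x           ∎
        hy : h (suc y) ≡ h y
        hy = begin
          h (suc y)                              ≡⟨ partway-late y<n (<⇒≤ (after-x (m<n⇒m<1+n x<y))) ⟩
          F (suc y) + (j ⊓ left G F (suc y))     ≡⟨ cong₂ _+_ (proj₂ ly) (trans (cong (j ⊓_) ny+) (m≤n⇒m⊓n≡m (n≤1+n j))) ⟩
          F y + j                                ≡⟨ cong (F y +_) (trans (cong (j ⊓_) ny) (⊓-idem j)) ⟨
          F y + (j ⊓ left G F y)                 ≡⟨ partway-late (<⇒≤ y<n) (<⇒≤ (after-x x<y)) ⟨
          h y                                    ∎
        h′y : h′ (suc y) ≡ suc (h′ y)
        h′y = begin
          h′ (suc y)        ≡⟨ raised-after y<n (m<n⇒m<1+n x<y) ≤-refl ⟩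
          suc (h (suc y))   ≡⟨ cong suc hy ⟩
          suc (h y)         ≡⟨ cong suc (equal-between (<⇒≤ y<n) x<y ≤-refl) ⟨
          suc (h′ y)        ∎
        other : ∀ z → z < n → z ≢ x → z ≢ y →
                (h z < h (suc z) → h′ z < h′ (suc z)) × (h′ z < h′ (suc z) → h z < h (suc z))
        other z z<n z≢x z≢y with <-cmp z x | <-cmp z y
        ... | tri< z<x _ _ | _ = raised (raised-before (<⇒≤ z<n) (<⇒≤ z<x)) (raised-before z<n z<x)
          where
          raised : h′ z ≡ suc (h z) → h′ (suc z) ≡ suc (h (suc z)) → _
          raised eq eq′ = (λ lt → subst₂ _<_ (sym eq) (sym eq′) (s≤s lt)) , λ lt → s≤s⁻¹ (subst₂ _<_ eq eq′ lt)
        ... | tri≈ _ z≡x _ | _ = contradiction z≡x z≢x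
        ... | tri> _ _ x<z | tri≈ _ z≡y _ = contradiction z≡y z≢y
        ... | tri> _ _ x<z | tri< z<y _ _ =
          let eq = equal-between (<⇒≤ z<n) x<z (<⇒≤ z<y) ; eq′ = equal-between z<n (m<n⇒m<1+n x<z) z<y in
          subst₂ _<_ (sym eq) (sym eq′) , subst₂ _<_ eq eq′
        ... | tri> _ _ x<z | tri> _ _ y<z =
          let eq = raised-after (<⇒≤ z<n) x<z y<z ; eq′ = raised-after z<n (m<n⇒m<1+n x<z) (m<n⇒m<1+n y<z) in
          (λ lt → subst₂ _<_ (sym eq) (sym eq′) (s≤s lt)) , λ lt → s≤s⁻¹ (subst₂ _<_ eq eq′ lt)

-- The program: choosing width and base, tabulating heights.

bound : Cmd → ℕ
bound skip                      = 1
bound (x := e)                  = suc (cost e)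
bound (a [ i ]:= e)             = suc (cost i + cost e)
bound (emit e)                  = suc (cost e)
bound (p ⨾ q)                   = bound p + bound q
bound (ifnz e then p else q)    = suc (cost e) + (bound p ⊔ bound q)
-- A filler value: `bound` is meant for loop-free commands, and loops are timed by `loopTime`.
bound (while e loop p)          = 0

run-then : ∀ {p q s T U} {Q R : State → Set} → Runs p s R T → (∀ {s′} → R s′ → Runs q s′ Q U) →
           Runs (p ⨾ q) s Q (T + U)
run-then r f = run-seq (run-weaken f ≤-refl r)

nᵛ widthᵛ baseᵛ posᵛ labelᵛ sizeᵛ roundᵛ leftᵛ enteredᵛ : ℕ
nᵛ = 0 ; widthᵛ = 1 ; baseᵛ = 2 ; posᵛ = 3 ; labelᵛ = 4 ; sizeᵛ = 5 ; roundᵛ = 6 ; leftᵛ = 7 ; enteredᵛ = 8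

Iᵃ Jᵃ Fᵃ Gᵃ labelᵃ xᵃ yᵃ : ℕ
Iᵃ = 0 ; Jᵃ = 1 ; Fᵃ = 2 ; Gᵃ = 3 ; labelᵃ = 4 ; xᵃ = 5 ; yᵃ = 6

next : Cmd
next = posᵛ := lit 1 ⊕ var posᵛ

forPos : Cmd → Cmd
forPos p = while var nᵛ ⊖ var posᵛ loop (p ⨾ next)

chooseWidth : ℕ → Cmd
chooseWidth k =
  widthᵛ := lit k ⨾
  ifnz var nᵛ ⊖ lit k then skip else (widthᵛ := lit 1 ⊕ var nᵛ)

findBase : Cmd
findBase =
  posᵛ := lit 0 ⨾
  forPos (ifnz Jᵃ [ var posᵛ ] then (baseᵛ := var posᵛ) else skip)

tabulateStep : Cmd
tabulateStep =
  labelᵃ [ var posᵛ ]:= var labelᵛ ⨾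
  Fᵃ [ lit 1 ⊕ var posᵛ ]:= Fᵃ [ var posᵛ ] ⊕ Iᵃ [ var labelᵛ ] ⨾
  Gᵃ [ lit 1 ⊕ var posᵛ ]:= Gᵃ [ var posᵛ ] ⊕ Jᵃ [ var labelᵛ ] ⨾
  labelᵛ := lit 1 ⊕ var labelᵛ ⨾
  ifnz var nᵛ ⊖ var labelᵛ then skip else (labelᵛ := lit 0)

tabulateEnd : Cmd
tabulateEnd =
  labelᵃ [ var nᵛ ]:= var labelᵛ ⨾
  sizeᵛ := Gᵃ [ var nᵛ ] ⨾
  -- A sentinel read when position `n` is treated: as long as the current set has no token at the
  -- base, the periodic extension is flat from `n` to `n + 1`.
  Fᵃ [ lit 1 ⊕ var nᵛ ]:= Fᵃ [ var nᵛ ]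

tabulateHeights : Cmd
tabulateHeights =
  labelᵛ := var baseᵛ ⨾
  posᵛ := lit 0 ⨾
  -- Starting at 1 when `I` misses the base gives height 1 at position 1 in either case; bringing a
  -- token to the base then only has to lower the height at 0 to 0.
  Fᵃ [ lit 0 ]:= lit 1 ⊖ Iᵃ [ var baseᵛ ] ⨾
  Gᵃ [ lit 0 ]:= lit 0 ⨾
  forPos tabulateStep ⨾
  tabulateEnd

setup : ℕ → Cmd
setup k = chooseWidth k ⨾ findBase ⨾ tabulateHeights

run-forPos : ∀ {p T} (n : ℕ) (Inv : ℕ → State → Set) →
  (∀ {v s} → Inv v s → vars s nᵛ ≡ n × vars s posᵛ ≡ v) →
  (∀ {v s} → v < n → Inv v s → Runs p s (λ s′ → Inv (suc v) (setVar posᵛ (suc (vars s′ posᵛ)) s′)) T) →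
  ∀ {v s} d → v + d ≡ n → Inv v s →
  Runs (forPos p) s (Inv n) (loopTime (var nᵛ ⊖ var posᵛ) d (T + bound next))
run-forPos n Inv counter body = run-while Inv n
  (λ _ inv → let eqn , eqv = counter inv in cong₂ _∸_ eqn eqv)
  (λ v<n inv → run-seq (run-weaken run-assign ≤-refl (body v<n inv)))

update-≤ : ∀ {f g : ℕ → ℕ} {v x} → (∀ z → z ≤ v → f z ≡ g z) → x ≡ g (suc v) →
           ∀ z → z ≤ suc v → (f [ suc v ↦ x ]) z ≡ g z
update-≤ {f} {v = v} {x} eq eqx z le with m≤n⇒m<n∨m≡n le
... | inj₁ z<  = trans (update-other f x (>⇒≢ z<)) (eq z (s≤s⁻¹ z<))
... | inj₂ refl = trans (update-same f (suc v) x) eqx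

update-< : ∀ {f g : ℕ → ℕ} {v x} → (∀ z → z < v → f z ≡ g z) → x ≡ g v →
           ∀ z → z < suc v → (f [ v ↦ x ]) z ≡ g z
update-< {f} {v = v} {x} eq eqx z le with m≤n⇒m<n∨m≡n (s≤s⁻¹ le)
... | inj₁ z<  = trans (update-other f x (>⇒≢ z<)) (eq z z<)
... | inj₂ refl = trans (update-same f v x) eqx

module Setup (n : ℕ) .{{_ : NonZero n}} (I J : Subset n) where

  Input : State → Set
  Input s = vars s nᵛ ≡ n × arrays s Iᵃ ≡ indicator I × arrays s Jᵃ ≡ indicator J × output s ≡ []

  run-chooseWidth : ∀ k {s} → Input s →
    Runs (chooseWidth k) s (λ s′ → Input s′ × Width n k (vars s′ widthᵛ)) (bound (chooseWidth k))
  run-chooseWidth k inp@(refl , _) = run-seq (run-assign (run-if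
    (λ ≢0 → run-skip (inp , inj₁ (m∸n≢0⇒n<m ≢0 , refl)))
    (λ ≡0 → run-assign (inp , inj₂ (m∸n≡0⇒m≤n ≡0 , refl)))))

  findBaseTime : ℕ
  findBaseTime = 2 + loopTime (var nᵛ ⊖ var posᵛ) n (bound (ifnz Jᵃ [ var posᵛ ] then (baseᵛ := var posᵛ) else skip) + bound next)

  run-findBase : ∀ {k s} → 0 < ∣ J ∣ → Input s × Width n k (vars s widthᵛ) →
    Runs findBase s (λ s′ → (Input s′ × Width n k (vars s′ widthᵛ)) ×
                            vars s′ baseᵛ < n × 0 < indicator J (vars s′ baseᵛ)) findBaseTime
  run-findBase {k} {s} pos inp = run-seq (run-assign
    (run-weaken (λ {s} → done {s}) ≤-refl (run-forPos n Inv (λ {_} {s} → counter {s = s}) body n refl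
      (inp , refl , inj₂ λ _ ()))))
    where
    Inv : ℕ → State → Set
    Inv v s = (Input s × Width n k (vars s widthᵛ)) × vars s posᵛ ≡ v ×
              ((vars s baseᵛ < n × 0 < indicator J (vars s baseᵛ)) ⊎ (∀ i → i < v → indicator J i ≡ 0))
    counter : ∀ {v s} → Inv v s → vars s nᵛ ≡ n × vars s posᵛ ≡ v
    counter ((inp , _) , eq , _) = proj₁ inp , eq
    body : ∀ {v s} → v < n → Inv v s → Runs _ s _ _
    body {v} {s} v<n (inp@((_ , _ , eqJ , _) , _) , refl , found) = run-if
      (λ ≢0 → run-assign (inp , refl , inj₁ (v<n , subst (λ f → 0 < f v) eqJ (n≢0⇒n>0 ≢0))))
      (λ ≡0 → run-skip (inp , refl , extend ≡0 found))
      where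
      extend : arrays s Jᵃ v ≡ 0 → _ ⊎ (∀ i → i < v → indicator J i ≡ 0) →
               (vars s baseᵛ < n × 0 < indicator J (vars s baseᵛ)) ⊎ (∀ i → i < suc v → indicator J i ≡ 0)
      extend ≡0 (inj₁ f)     = inj₁ f
      extend ≡0 (inj₂ zeros) = inj₂ λ i i< → case i (m≤n⇒m<n∨m≡n (s≤s⁻¹ i<))
        where
        case : ∀ i → i < v ⊎ i ≡ v → indicator J i ≡ 0
        case i (inj₁ lt)   = zeros i lt
        case i (inj₂ refl) = trans (cong (λ f → f v) (sym eqJ)) ≡0
    done : ∀ {s} → Inv n s → (Input s × Width n k (vars s widthᵛ)) × vars s baseᵛ < n × 0 < indicator J (vars s baseᵛ)
    done (inp , _ , inj₁ found) = inp , found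
    done (inp , _ , inj₂ zeros) = contradiction
      (subst (0 <_) (trans (sym (cum-indicator J)) (trans (cum-cong n zeros) (cum-zero n))) pos) (n≮n 0)
      where
      cum-zero : ∀ v → cum (λ _ → 0) v ≡ 0
      cum-zero zero    = refl
      cum-zero (suc v) = trans (+-identityʳ _) (cum-zero v)

  module _ (K b : ℕ) where

    record Tabulated (s : State) : Set where
      field
        n≡     : vars s nᵛ ≡ n
        width≡ : vars s widthᵛ ≡ K
        size≡  : vars s sizeᵛ ≡ ∣ J ∣
        label≡ : ∀ z → z ≤ n → arrays s labelᵃ z ≡ (b + z) % n
        F≡     : ∀ z → z ≤ n → arrays s Fᵃ z ≡ 1 ∸ indicator I b + heightFrom n I b z
        F-end  : arrays s Fᵃ (suc n) ≡ arrays s Fᵃ n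
        G≡     : ∀ z → z ≤ n → arrays s Gᵃ z ≡ heightFrom n J b z
        empty  : output s ≡ []

    tabulateTime : ℕ
    tabulateTime = 2 + (2 + (6 + (3 + (loopTime (var nᵛ ⊖ var posᵛ) n (bound tabulateStep + bound next) + bound tabulateEnd))))

    run-tabulateHeights : ∀ {s} → b < n → Input s → vars s widthᵛ ≡ K → vars s baseᵛ ≡ b →
                          Runs tabulateHeights s Tabulated tabulateTime
    run-tabulateHeights {s} b<n inp@(_ , eqI , _) eqK refl =
      run-seq $ run-assign $ run-seq $ run-assign $ run-seq $ run-store $ run-seq $ run-store $
      run-then (run-forPos n Inv (λ (inp , _ , eq , _) → proj₁ inp , eq) body n refl
          (inp , eqK , refl , trans (sym (m<n⇒m%n≡m b<n)) (cong (_% n) (sym (+-identityʳ b))) ,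
           (λ _ ()) ,
           (λ { zero z≤n → trans (cong (λ f → 1 ∸ f b) eqI) (sym (+-identityʳ _)) }) ,
           (λ { zero z≤n → refl })))
        finish
      where
      heightFrom-total : ∀ b → heightFrom n J b n ≡ ∣ J ∣
      heightFrom-total b = heightFrom-periodic n J b 0
      Inv : ℕ → State → Set
      Inv v s = Input s × vars s widthᵛ ≡ K × vars s posᵛ ≡ v × vars s labelᵛ ≡ (b + v) % n ×
        (∀ z → z < v → arrays s labelᵃ z ≡ (b + z) % n) ×
        (∀ z → z ≤ v → arrays s Fᵃ z ≡ 1 ∸ indicator I b + heightFrom n I b z) ×
        (∀ z → z ≤ v → arrays s Gᵃ z ≡ heightFrom n J b z)
      body : ∀ {v s} → v < n → Inv v s →
             Runs tabulateStep s (λ s′ → Inv (suc v) (setVar posᵛ (suc (vars s′ posᵛ)) s′)) (bound tabulateStep)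
      body {v} {s} v<n (inp@(refl , eqI , eqJ , _) , eqK , refl , eql , labels , Fs , Gs) =
        run-seq $ run-store $ run-seq $ run-store $ run-seq $ run-store $ run-seq $ run-assign $ run-if
          (λ ≢0 → run-skip (inp , eqK , refl , label-suc ≢0 , labels′ , Fs′ , Gs′))
          (λ ≡0 → run-assign (inp , eqK , refl , label-wrap ≡0 , labels′ , Fs′ , Gs′))
        where
        labels′ : ∀ z → z < suc v → _ ≡ (b + z) % n
        labels′ = update-< labels eql
        Fs′ : ∀ z → z ≤ suc v → _ ≡ 1 ∸ indicator I b + heightFrom n I b z
        Fs′ = update-≤ Fs (trans (cong₂ _+_ (Fs v ≤-refl) (trans (cong (λ f → f _) eqI) (cong (indicator I) eql))) (+-assoc (1 ∸ indicator I b) _ _))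
        Gs′ : ∀ z → z ≤ suc v → _ ≡ heightFrom n J b z
        Gs′ = update-≤ Gs (cong₂ _+_ (Gs v ≤-refl) (trans (cong (λ f → f _) eqJ) (cong (indicator J) eql)))
        label-suc : n ∸ suc (vars s labelᵛ) ≢ 0 → suc (vars s labelᵛ) ≡ (b + suc v) % n
        label-suc ≢0 with suc-% n (b + v)
        ... | inj₁ eq       = trans (cong suc eql) (trans (sym eq) (cong (_% n) (sym (+-suc b v))))
        ... | inj₂ (eq , _) = contradiction (trans (cong (λ w → n ∸ suc w) eql) (trans (cong (n ∸_) eq) (n∸n≡0 n))) ≢0
        label-wrap : n ∸ suc (vars s labelᵛ) ≡ 0 → 0 ≡ (b + suc v) % n
        label-wrap ≡0 with suc-% n (b + v)
        ... | inj₁ eq       = contradiction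
          (≤-trans (m∸n≡0⇒m≤n ≡0) (≤-reflexive (trans (cong suc eql) (sym eq)))) (<⇒≱ (m%n<n (suc (b + v)) n))
        ... | inj₂ (_ , eq) = trans (sym eq) (cong (_% n) (sym (+-suc b v)))

      finish : ∀ {s} → Inv n s → Runs tabulateEnd s Tabulated (bound tabulateEnd)
      finish {s} ((refl , _ , _ , out) , eqK , _ , eql , labels , Fs , Gs) =
        run-seq $ run-store $ run-seq $ run-assign $ run-store record
          { n≡ = refl ; width≡ = eqK
          ; size≡ = trans (Gs n ≤-refl) (heightFrom-total b)
          ; label≡ = λ z le → update-< labels eql z (s≤s le)
          ; F≡ = λ z le → trans (update-other (arrays s Fᵃ) _ (>⇒≢ (s≤s le))) (Fs z le)
          ; F-end = trans (update-same (arrays s Fᵃ) (suc n) _) (sym (update-other (arrays s Fᵃ) _ (>⇒≢ ≤-refl)))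
          ; G≡ = Gs
          ; empty = out }

  setupTime : ℕ → ℕ
  -- Width and base are found only at run time; the tabulation takes equally long for all of them,
  -- so its time is formed with the placeholders `0 0`.
  setupTime k = bound (chooseWidth k) + (findBaseTime + tabulateTime 0 0)

  run-setup : ∀ k {s} → 0 < ∣ J ∣ → Input s →
    Runs (setup k) s (λ s′ → ∃[ K ] ∃[ b ] (Width n k K × 0 < indicator J b × b < n × Tabulated K b s′)) (setupTime k)
  run-setup k pos inp = run-then (run-chooseWidth k inp) λ inp → run-then (run-findBase pos inp)
    λ ((inp , wd) , b<n , b∈) → run-weaken (λ tab → _ , _ , wd , b∈ , b<n , tab) ≤-refl
      (run-tabulateHeights _ _ b<n inp refl refl)

-- Alignment: bringing a token to the base.

lower : Cmd
lower =
  emit (labelᵃ [ var posᵛ ⊖ lit 1 ]) ⨾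
  emit (labelᵃ [ var posᵛ ]) ⨾
  Fᵃ [ var posᵛ ]:= Fᵃ [ var posᵛ ] ⊖ lit 1

whenLowerable : Cmd → Cmd
whenLowerable act =
  ifnz Fᵃ [ var posᵛ ] ⊖ Fᵃ [ var posᵛ ⊖ lit 1 ] then
    (ifnz Fᵃ [ lit 1 ⊕ var posᵛ ] ⊖ Fᵃ [ var posᵛ ] then skip else
      -- For a position below the width, the window ending there starts on the previous turn, at
      -- position `pos + n - K`, where heights are smaller by `m`.
      (ifnz var widthᵛ ⊖ var posᵛ
        then (ifnz (Fᵃ [ var posᵛ ] ⊕ var sizeᵛ) ⊖ (lit 1 ⊕ Fᵃ [ (var posᵛ ⊕ var nᵛ) ⊖ var widthᵛ ]) then act else skip)
        else (ifnz Fᵃ [ var posᵛ ] ⊖ (lit 1 ⊕ Fᵃ [ var posᵛ ⊖ var widthᵛ ]) then act else skip)))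
  else skip

alignRound : Cmd
alignRound =
  posᵛ := lit 1 ⨾
  forPos (whenLowerable lower) ⨾
  -- Position `n` is the base again: lowering it puts a token on the base, so the height at 0 drops
  -- as well.
  whenLowerable (lower ⨾ Fᵃ [ lit 0 ]:= lit 0)

align : Cmd
align =
  roundᵛ := var widthᵛ ⨾
  while var roundᵛ loop
    -- Height 0 at position 0 signals that the base is occupied; the remaining rounds are then idle.
    ((ifnz Fᵃ [ lit 0 ] then alignRound else skip) ⨾ roundᵛ := var roundᵛ ⊖ lit 1)

gentle-update : ∀ {n f z x} → Gentle n f → f z ≤ x → x ≤ suc (f z) →
                (suc z < n → x ≤ f (suc (suc z)) × f (suc (suc z)) ≤ suc x) → Gentle n (f [ suc z ↦ x ])
gentle-update {n} {f} {z} {x} gf lo hi after w w<n with w ≟ z | w ≟ suc z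
... | yes refl | _ rewrite update-same f (suc z) x | update-other f {suc z} {z} x (>⇒≢ ≤-refl) = lo , hi
... | no  _    | yes refl rewrite update-same f (suc z) x | update-other f {suc z} {suc (suc z)} x (<⇒≢ ≤-refl) = after w<n
... | no  w≢z  | no  w≢1+z
  rewrite update-other f {suc z} {w} x (w≢1+z ∘ sym) | update-other f {suc z} {suc w} x (w≢z ∘ sym ∘ suc-injective) = gf w w<n

module Align (n : ℕ) .{{_ : NonZero n}} (3≤n : 3 ≤ n) (k K m b : ℕ)
             (2≤k : 2 ≤ k) (width : Width n k K) (R : Rule) (I J : Subset n) where
  open Heights n 3≤n k K m b 2≤k width
  open Jumps n 3≤n k K m b 2≤k width
  open Spanning

  -- The part of the state that alignment and both solvers leave intact, among it the height of the
  -- target set.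
  Frame : State → Set
  Frame s = vars s nᵛ ≡ n × vars s widthᵛ ≡ K × vars s sizeᵛ ≡ m ×
            (∀ z → z ≤ n → arrays s labelᵃ z ≡ label z) ×
            Based (arrays s Gᵃ) × tokens (arrays s Gᵃ) ≡ J

  Trace : State → Set
  Trace s = Traced R G k I (tokens (arrays s Fᵃ)) (output s)

  -- For a gentle height, `up` and `flat` mean that `v - 1` carries a token and `v` is free. `inner`
  -- and `outer` ask for a second token in the window that ends at `v`, since the window loses the
  -- first.
  record Lowerable (f : ℕ → ℕ) (v : ℕ) : Set where
    field
      up    : f (v ∸ 1) < f v
      flat  : f (suc v) ≤ f v
      inner : ∀ w → w + K ≡ v → suc (f w) < f v
      outer : ∀ w → v + n ≡ w + K → w < n → suc (f w) < f v + m

  run-whenLowerable : ∀ {s Q act} → Frame s → 1 ≤ vars s posᵛ →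
    (Lowerable (arrays s Fᵃ) (vars s posᵛ) → Runs act s Q (bound act)) →
    (¬ Lowerable (arrays s Fᵃ) (vars s posᵛ) → Q s) →
    Runs (whenLowerable act) s Q (bound (whenLowerable act))
  run-whenLowerable {s} {Q} (eqn , eqK , eqm , _) 1≤v act skip′ = run-if
    (λ up → run-if
      (λ ≢0 → run-skip (skip′ λ l → <⇒≱ (m∸n≢0⇒n<m ≢0) (Lowerable.flat l)))
      (λ flat → run-if
        (λ K≢v → let v<K = subst (v <_) eqK (m∸n≢0⇒n<m K≢v) in run-if
          (λ ≢0 → act record
            { up = m∸n≢0⇒n<m up ; flat = m∸n≡0⇒m≤n flat
            ; inner = λ w eq → contradiction (m≤n+m K w) (<⇒≱ (subst (_< K) (sym eq) v<K))
            ; outer = λ w eq _ → subst₂ (λ x y → suc (f x) < f v + y) (wrapped eq) eqm (m∸n≢0⇒n<m {f v + vars s sizeᵛ} ≢0) })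
          (λ ≡0 → run-skip (skip′ λ l → <⇒≱ (Lowerable.outer l (v + n ∸ K)
              (sym (m∸n+n≡m (K≤v+n v<K))) (window-start v<K))
            (subst (λ x → f v + x ≤ suc (f (v + n ∸ K))) eqm
              (≤-trans (m∸n≡0⇒m≤n {f v + vars s sizeᵛ} ≡0) (≤-reflexive (cong (suc ∘ f) (cong₂ (λ x y → v + x ∸ y) eqn eqK))))))))
        (λ K≡v → let K≤v = subst (_≤ v) eqK (m∸n≡0⇒m≤n K≡v) in run-if
          (λ ≢0 → act record
            { up = m∸n≢0⇒n<m up ; flat = m∸n≡0⇒m≤n flat
            ; inner = λ w eq → subst (λ x → suc (f x) < f v) (trans (cong (v ∸_) eqK) (trans (cong (_∸ K) (sym eq)) (m+n∸n≡m w K)))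
                (m∸n≢0⇒n<m {f v} ≢0)
            ; outer = λ w eq w<n → contradiction eq (>⇒≢ (≤-<-trans (≤-reflexive (+-comm w K)) (+-mono-≤-< K≤v w<n))) })
          (λ ≡0 → run-skip (skip′ λ l → <⇒≱ (Lowerable.inner l (v ∸ K) (m∸n+n≡m K≤v))
            (subst (λ x → f v ≤ suc (f (v ∸ x))) eqK (m∸n≡0⇒m≤n {f v} ≡0)))))))
    (λ ≡0 → run-skip (skip′ λ l → <⇒≱ (Lowerable.up l) (m∸n≡0⇒m≤n ≡0)))
    where
    f : ℕ → ℕ
    f = arrays s Fᵃ
    v : ℕ
    v = vars s posᵛ
    wrapped : ∀ {w} → v + n ≡ w + K → v + vars s nᵛ ∸ vars s widthᵛ ≡ w
    wrapped {w} eq = trans (cong₂ (λ x y → v + x ∸ y) eqn eqK) (trans (cong (_∸ K) eq) (m+n∸n≡m w K))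
    -- For `K = n + 1` it is `1 ≤ v` that makes the truncated subtraction `v + n ∸ K` exact.
    K≤v+n : v < K → K ≤ v + n
    K≤v+n _ = ≤-trans K≤1+n (+-monoˡ-≤ n 1≤v)
    window-start : v < K → v + n ∸ K < n
    window-start v<K = +-cancelʳ-< K _ _ (≤-<-trans (≤-reflexive (m∸n+n≡m (K≤v+n v<K)))
      (≤-trans (+-monoˡ-< n v<K) (≤-reflexive (+-comm K n))))

  module _ {f : ℕ → ℕ} {z : ℕ} (sp : Spanning f) (gf : Gentle n f) (l : Lowerable f (suc z)) where
    private
      f′ : ℕ → ℕ
      f′ = f [ suc z ↦ f (suc z) ∸ 1 ]

      elsewhere : ∀ {w} → w ≢ suc z → f′ w ≡ f w
      elsewhere w≢ = update-other f _ (w≢ ∘ sym)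

      below : ∀ w → w ≤ n → f′ w ≤ f w
      below w _ with w ≟ suc z
      ... | yes refl = ≤-trans (≤-reflexive (update-same f (suc z) _)) (m∸n≤m _ 1)
      ... | no  w≢   = ≤-reflexive (elsewhere w≢)

    lower-up : suc z ≤ n → f (suc z) ≡ suc (f z)
    lower-up z<n = ≤-antisym (proj₂ (gf z z<n)) (Lowerable.up l)

    lower-flat : suc z < n → f (suc (suc z)) ≡ f (suc z)
    lower-flat 1+z<n = ≤-antisym (Lowerable.flat l) (proj₁ (gf (suc z) 1+z<n))

    lower-value : suc z ≤ n → f (suc z) ≡ suc (f′ (suc z))
    lower-value z<n = trans (lower-up z<n) (cong suc (sym (trans (update-same f (suc z) _) (cong (_∸ 1) (lower-up z<n)))))

    private
      clear : suc z ≤ n → ∀ (f″ : ℕ → ℕ) → f″ (suc z) ≡ f′ (suc z) →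
              (∀ v → v + K ≡ suc z → f v < f″ (suc z)) × (∀ v → suc z + n ≡ v + K → v < n → f v < f″ (suc z) + m)
      clear z<n f″ eq =
        (λ v eqv → s<s⁻¹ (subst (suc (f v) <_) value (Lowerable.inner l v eqv))) ,
        (λ v eqv v<n → s<s⁻¹ (subst (λ x → suc (f v) < x + m) value (Lowerable.outer l v eqv v<n)))
        where
        value : f (suc z) ≡ suc (f″ (suc z))
        value = trans (lower-value z<n) (cong suc (sym eq))

    lower-gentle : suc z ≤ n → Gentle n f′
    lower-gentle z<n = gentle-update gf
      (≤-reflexive (sym (cong (_∸ 1) (lower-up z<n))))
      (≤-trans (m∸n≤m _ 1) (≤-reflexive (lower-up z<n)))
      (λ 1+z<n → ≤-trans (m∸n≤m _ 1) (proj₁ (gf (suc z) 1+z<n)) ,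
                 ≤-trans (Lowerable.flat l) (≤-reflexive (trans (lower-up z<n) (cong suc (cong (_∸ 1) (sym (lower-up z<n)))))))

    lower-spanning : suc z < n → Spanning f′
    lower-spanning 1+z<n = Spanning-lower sp
      (trans (elsewhere (>⇒≢ 1+z<n)) (trans (total sp) (cong (_+ m) (sym (elsewhere λ ())))))
      below clear′
      where
      clear′ : ∀ w → w ≤ n → _
      clear′ w _ with w ≟ suc z
      ... | yes refl = inj₂ (clear (<⇒≤ 1+z<n) f′ refl)
      ... | no  w≢   = inj₁ (sym (elsewhere w≢))

    lower-step : suc z < n → Step R G k (tokens f) (tokens f′)
    lower-step 1+z<n = slide 1+z<n sp (lower-spanning 1+z<n) (lower-up (<⇒≤ 1+z<n)) (lower-flat 1+z<n)
      (lower-value (<⇒≤ 1+z<n)) (λ w _ w≢ → sym (elsewhere w≢))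

    module _ (eqn : suc z ≡ n) (f0 : f 0 ≡ 1) (f1 : f 1 ≡ 1) where
      private
        f″ : ℕ → ℕ
        f″ = f′ [ 0 ↦ 0 ]

        z≢0 : z ≢ 0
        z≢0 refl = <⇒≱ 3≤n (≤-trans (≤-reflexive (sym eqn)) (s≤s z≤n))

        1≢n : 1 ≢ suc z
        1≢n eq = z≢0 (suc-injective (sym eq))

        z<n : suc z ≤ n
        z<n = ≤-reflexive eqn

        f″n : f″ n ≡ m
        f″n = suc-injective (trans (cong (λ w → suc (f″ w)) (sym eqn))
          (trans (sym (lower-value z<n)) (trans (cong f eqn) (trans (total sp) (cong (_+ m) f0)))))

      close-based : Based f″
      close-based = record
        { spanning = Spanning-lower sp f″n below′ clear′
        ; gentle = gentle′
        ; at-0 = refl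
        ; at-1 = trans (elsewhere 1≢n) f1 }
        where
        below′ : ∀ w → w ≤ n → f″ w ≤ f w
        below′ zero    _  = z≤n
        below′ (suc w) le = below (suc w) le
        clear′ : ∀ w → w ≤ n → _
        -- No inner window ends at 0, as `K` is positive. A wrapped window with `u = 0` ends exactly
        -- at `n`, where the condition has been checked.
        clear′ zero    _ = inj₂
          ((λ v eq → contradiction eq (>⇒≢ (<-≤-trans (<-≤-trans z<s 2≤K) (m≤n+m K v)))) ,
           (λ v eq v<n → subst (f v <_) (trans (cong f″ eqn) f″n)
             (proj₁ (clear z<n f″ refl) v (trans (sym eq) (sym eqn)))))
        clear′ (suc w) _ with suc w ≟ suc z
        ... | yes refl = inj₂ (clear z<n f″ refl)
        ... | no  w≢   = inj₁ (sym (elsewhere w≢))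
        gentle′ : Gentle n f″
        gentle′ zero    _   = z≤n , ≤-reflexive (trans (elsewhere 1≢n) f1)
        gentle′ (suc w) w<n = lower-gentle z<n (suc w) w<n

      close-step : Σ[ s ∈ Step R G k (tokens f) (tokens f″) ] (Step.x s ≡ at z × Step.y s ≡ at 0)
      close-step = slide-to-base eqn z≢0 sp (Based.spanning close-based)
        (subst (λ w → f w ≡ suc (f z)) eqn (lower-up z<n)) (trans f1 (sym f0))
        (trans (total sp) (trans (cong (_+ m) f0) (cong suc (sym f″n)))) f0
        (λ { zero _ 0≢0 _ → contradiction refl 0≢0
           ; (suc w) _ _ w≢n → sym (elsewhere (λ eq → w≢n (trans eq eqn))) })

  -- The potential of the alignment: a height above this bound could have
  -- been lowered in round t. Every round thus advances the last token, and
  -- since it is less than K away from the base, K rounds suffice.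
  Low : ℕ → (ℕ → ℕ) → ℕ → Set
  Low t f v = ∀ j → j * K + v ≤ n + t → f v + j ≤ suc m

  1≤K : 1 ≤ K
  1≤K = <⇒≤ 2≤K

  low-mono : ∀ {t f v} → Low (suc t) f v → Low t f v
  low-mono low j le = low j (≤-trans le (+-monoʳ-≤ _ (n≤1+n _)))

  -- One unit of time tightens the bound by at most 1, since `K ≥ 1`, and the lowering pays for
  -- that.
  low-lowered : ∀ {t f v x} → v ≤ n → Low t f v → suc x ≡ f v → ∀ j → j * K + v ≤ n + suc t → x + j ≤ suc m
  low-lowered {t} {f} {v} {x} v≤n low eq zero    le = ≤-trans (n≤1+n _)
    (≤-trans (≤-reflexive (cong (_+ 0) eq)) (low 0 (≤-trans v≤n (m≤m+n n t))))
  low-lowered {t} {f} {v} {x} v≤n low eq (suc j) le = ≤-trans (≤-reflexive (trans (+-suc x j) (cong (_+ j) eq)))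
    (low j (s≤s⁻¹ (begin
      suc (j * K + v)      ≤⟨ +-monoˡ-≤ (j * K + v) 1≤K ⟩
      K + (j * K + v)      ≡⟨ +-assoc K (j * K) v ⟨
      suc j * K + v        ≤⟨ le ⟩
      n + suc t            ≡⟨ +-suc n t ⟩
      suc (n + t)          ∎)))
    where open ≤-Reasoning

  -- The potential says that `f v` is at most `m + 1` minus the integer part of `(n + t - v) / K`.
  -- If the bound for time `t + 1` fails at `suc v`, the height there equals the old bound exactly.
  -- The bounds at the neighbours and at the start of the window, new for positions already swept
  -- and old for the others, then yield every condition for lowering.
  align-progress : ∀ {t f v} → suc n ≤ m * K → v < n → (suc v ≡ n → f (suc (suc v)) ≤ f (suc v)) →
    (∀ u → u ≤ v → Low (suc t) f u) → (∀ u → suc v ≤ u → u ≤ n → Low t f u) →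
    ¬ Lowerable f (suc v) → Low (suc t) f (suc v)
  align-progress {t} {f} {v} slack v<n end new old stuck zero le =
    old (suc v) ≤-refl v<n 0 (≤-trans v<n (m≤m+n n t))
  align-progress {t} {f} {v} slack v<n end new old stuck (suc i) le with f (suc v) + suc i ≤? suc m
  ... | yes ok = ok
  ... | no  ≰  = contradiction record { up = up ; flat = flat ; inner = inn ; outer = out } stuck
    where
    open ≤-Reasoning
    le′ : K + (i * K + suc v) ≤ suc (n + t)
    le′ = subst₂ _≤_ (+-assoc K (i * K) (suc v)) (+-suc n t) le
    exact : f (suc v) + i ≡ suc m
    exact = ≤-antisym (old (suc v) ≤-refl v<n i (s≤s⁻¹ (≤-trans (+-monoˡ-≤ (i * K + suc v) 1≤K) le′)))
      (s≤s⁻¹ (≤-trans (≰⇒> ≰) (≤-reflexive (+-suc (f (suc v)) i))))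
    up : f v < f (suc v)
    up = +-cancelʳ-≤ i _ _ (≤-trans (≤-reflexive (sym (+-suc (f v) i)))
      (≤-trans (new v ≤-refl (suc i) (≤-trans (+-monoʳ-≤ (suc i * K) (n≤1+n v)) le)) (≤-reflexive (sym exact))))
    flat : f (suc (suc v)) ≤ f (suc v)
    flat with m≤n⇒m<n∨m≡n v<n
    ... | inj₂ eq = end eq
    ... | inj₁ lt = +-cancelʳ-≤ i _ _ (≤-trans (old (suc (suc v)) (n≤1+n _) lt i (s≤s⁻¹ (begin
      suc (i * K + suc (suc v))   ≡⟨ cong suc (+-suc (i * K) (suc v)) ⟩
      2 + (i * K + suc v)         ≤⟨ +-monoˡ-≤ (i * K + suc v) 2≤K ⟩
      K + (i * K + suc v)         ≤⟨ le′ ⟩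
      suc (n + t)                 ∎))) (≤-reflexive (sym exact)))
    shift : ∀ {w} → K + (K + i * K) + w ≡ K + (i * K + (w + K))
    shift {w} = lemma K (i * K) w
      where
      lemma : ∀ K J w → K + (K + J) + w ≡ K + (J + (w + K))
      lemma = solve-∀
    conclude : ∀ {w c d} → f w + suc (suc i) ≤ suc m + d → suc m + d ≡ c + i → suc (f w) < c
    conclude {w} {c} {d} le eq = +-cancelʳ-≤ i _ _ (begin
      suc (suc (f w)) + i       ≡⟨ trans (+-suc (f w) (suc i)) (cong suc (+-suc (f w) i)) ⟨
      f w + suc (suc i)         ≤⟨ le ⟩
      suc m + d                 ≡⟨ eq ⟩
      c + i                     ∎)
    inn : ∀ w → w + K ≡ suc v → suc (f w) < f (suc v)
    inn w eq = conclude {d = 0} (≤-trans (new w w≤v (suc (suc i)) (begin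
      K + (K + i * K) + w          ≡⟨ shift ⟩
      K + (i * K + (w + K))        ≡⟨ cong (λ x → K + (i * K + x)) eq ⟩
      K + (i * K + suc v)          ≤⟨ le′ ⟩
      suc (n + t)                  ≡⟨ +-suc n t ⟨
      n + suc t                    ∎)) (m≤m+n (suc m) 0)) (trans (+-identityʳ (suc m)) (sym exact))
      where
      w≤v : w ≤ v
      w≤v = s≤s⁻¹ (≤-trans (≤-trans (≤-reflexive (+-comm 1 w)) (+-monoʳ-≤ w 1≤K)) (≤-reflexive eq))
    out : ∀ w → suc v + n ≡ w + K → w < n → suc (f w) < f (suc v) + m
    out w eq w<n = conclude {d = m} bound′ (trans (cong (_+ m) (sym exact)) (lemma (f (suc v)) i m))
      where
      lemma : ∀ a i m → a + i + m ≡ a + m + i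
      lemma = solve-∀
      low : Low t f w
      low with w ≤? v
      ... | yes w≤v = low-mono {f = f} (new w w≤v)
      ... | no  w≰v = old w (≰⇒> w≰v) (<⇒≤ w<n)
      bound′ : f w + suc (suc i) ≤ suc m + m
      -- The window started one turn earlier. If `i + 2 ≥ m`, then `m` of the windows are exchanged
      -- for this turn, which costs `n + 1 ≤ m * K`: this is where slack is spent. Otherwise the
      -- crude bound `f w ≤ m + 1` suffices.
      bound′ with ≤-total m (suc (suc i))
      ... | inj₂ 2+i≤m = +-mono-≤ (≤-trans (≤-reflexive (sym (+-identityʳ _))) (low 0 (≤-trans (<⇒≤ w<n) (m≤m+n n t)))) 2+i≤m
      ... | inj₁ m≤2+i = let j = suc (suc i) ∸ m in begin
        f w + suc (suc i)       ≡⟨ cong (f w +_) (m∸n+n≡m m≤2+i) ⟨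
        f w + (j + m)           ≡⟨ +-assoc (f w) j m ⟨
        f w + j + m             ≤⟨ +-monoˡ-≤ m (low j (+-cancelʳ-≤ (m * K) _ _ (begin
          j * K + w + m * K         ≡⟨ lemma″ j K w m ⟩
          (j + m) * K + w           ≡⟨ cong (λ x → x * K + w) (m∸n+n≡m m≤2+i) ⟩
          K + (K + i * K) + w       ≡⟨ shift ⟩
          K + (i * K + (w + K))     ≡⟨ cong (λ x → K + (i * K + x)) eq ⟨
          K + (i * K + (suc v + n)) ≡⟨ lemma′ K (i * K) (suc v) n ⟩
          K + (i * K + suc v) + n   ≤⟨ +-monoˡ-≤ n le′ ⟩
          suc (n + t) + n           ≡⟨ +-suc (n + t) n ⟨
          n + t + suc n             ≤⟨ +-monoʳ-≤ (n + t) slack ⟩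
          n + t + m * K             ∎))) ⟩
        suc m + m               ∎
        where
        lemma′ : ∀ a c d e → a + (c + (d + e)) ≡ a + (c + d) + e
        lemma′ = solve-∀
        lemma″ : ∀ j K w m → j * K + w + m * K ≡ (j + m) * K + w
        lemma″ = solve-∀

  lowered : ℕ → State → State
  lowered p s = setArray Fᵃ p (arrays s Fᵃ p ∸ 1) (write (arrays s labelᵃ p) (write (arrays s labelᵃ (p ∸ 1)) s))

  run-lower : ∀ {s} {Q : State → Set} → Q (lowered (vars s posᵛ) s) → Runs lower s Q (bound lower)
  run-lower q = run-seq $ run-emit $ run-seq $ run-emit $ run-store q

  traced-slide : ∀ {s z X} → suc z ≤ n → Frame s → Trace s → (st : Step R G k (tokens (arrays s Fᵃ)) X) →
                 Step.x st ≡ at z → toℕ (Step.y st) ≡ label (suc z) →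
                 Traced R G k I X (output (lowered (suc z) s))
  traced-slide z<n (_ , _ , _ , labels , _) tr st eqx eqy = Traced-snoc tr st
    (trans (cong toℕ eqx) (trans (toℕ-at _) (sym (labels _ (<⇒≤ z<n)))))
    (trans eqy (sym (labels _ z<n)))

  record Unaligned (f : ℕ → ℕ) : Set where
    field
      spanning : Spanning f
      gentle   : Gentle n f
      at-0     : f 0 ≡ 1
      at-1     : f 1 ≡ 1
      end      : f (suc n) ≡ f n

  lower-effect : ∀ {s z p} → p ≡ suc z → suc z < n → Frame s → Trace s → Unaligned (arrays s Fᵃ) →
    Lowerable (arrays s Fᵃ) p →
    Trace (lowered p s) × Unaligned (arrays (lowered p s) Fᵃ) ×
    suc (arrays (lowered p s) Fᵃ (suc z)) ≡ arrays s Fᵃ (suc z) ×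
    (∀ u → u ≢ suc z → arrays (lowered p s) Fᵃ u ≡ arrays s Fᵃ u)
  lower-effect {s} {z} refl 1+z<n fr tr un l =
    traced-slide {s} (<⇒≤ 1+z<n) fr tr (lower-step spanning gentle l 1+z<n) refl (toℕ-at (suc z)) ,
    record
      { spanning = lower-spanning spanning gentle l 1+z<n
      ; gentle   = lower-gentle spanning gentle l (<⇒≤ 1+z<n)
      ; at-0     = at-0
      ; at-1     = trans (elsewhere 1 1≢) at-1
      ; end      = trans (elsewhere (suc n) (>⇒≢ (m<n⇒m<1+n 1+z<n))) (trans end (sym (elsewhere n (>⇒≢ 1+z<n))))
      } ,
    sym (lower-value spanning gentle l (<⇒≤ 1+z<n)) ,
    elsewhere
    where
    open Unaligned un
    elsewhere : ∀ u → u ≢ suc z → _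
    elsewhere u u≢ = update-other (arrays s Fᵃ) _ (u≢ ∘ sym)
    1≢ : 1 ≢ suc z
    1≢ refl = <⇒≢ (Lowerable.up l) (trans at-0 (sym at-1))

  close-effect : ∀ {s p} → p ≡ n → Frame s → Trace s → Unaligned (arrays s Fᵃ) → Lowerable (arrays s Fᵃ) p →
    Traced R G k I (tokens (arrays (lowered p s) Fᵃ [ 0 ↦ 0 ])) (output (lowered p s)) ×
    Based (arrays (lowered p s) Fᵃ [ 0 ↦ 0 ])
  close-effect {s} eq fr tr un l = go (pred n) (suc-pred n) (trans eq (sym (suc-pred n))) l
    where
    open Unaligned un
    go : ∀ z {p} → suc z ≡ n → p ≡ suc z → Lowerable (arrays s Fᵃ) p →
         Traced R G k I (tokens (arrays (lowered p s) Fᵃ [ 0 ↦ 0 ])) (output (lowered p s)) ×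
         Based (arrays (lowered p s) Fᵃ [ 0 ↦ 0 ])
    go z eqn refl l =
      traced-slide {s} (≤-reflexive eqn) fr tr (proj₁ st) (proj₁ (proj₂ st))
        (trans (cong toℕ (trans (proj₂ (proj₂ st)) (trans (sym (at-+n 0)) (cong at (trans (+-identityʳ n) (sym eqn)))))) (toℕ-at (suc z))) ,
      close-based spanning gentle l eqn at-0 at-1
      where
      st : _
      st = close-step spanning gentle l eqn at-0 at-1

  module _ (slack : suc n ≤ m * K) where

    Sweeping : ℕ → ℕ → ℕ → State → Set
    Sweeping r t v s = Frame s × Trace s × Unaligned (arrays s Fᵃ) × vars s roundᵛ ≡ r × vars s posᵛ ≡ v × 0 < v ×
      (∀ u → u < v → Low (suc t) (arrays s Fᵃ) u) × (∀ u → v ≤ u → u ≤ n → Low t (arrays s Fᵃ) u)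

    Phase : ℕ → ℕ → State → Set
    Phase r t s = Frame s × Trace s × vars s roundᵛ ≡ r ×
      (Based (arrays s Fᵃ) ⊎ (Unaligned (arrays s Fᵃ) × (∀ u → u ≤ n → Low t (arrays s Fᵃ) u)))

    align-sweep : ∀ {r t v s} → v < n → Sweeping r t v s →
      Runs (whenLowerable lower) s (λ s′ → Sweeping r t (suc v) (setVar posᵛ (suc (vars s′ posᵛ)) s′)) (bound (whenLowerable lower))
    align-sweep {v = zero} _ (_ , _ , _ , _ , _ , () , _)
    align-sweep {r} {t} {suc z} {s} v<n (fr , tr , un , eqr , eqp , _ , new , old) =
      run-whenLowerable fr (subst (1 ≤_) (sym eqp) (s≤s z≤n))
        (λ l → let tr′ , un′ , value , same = lower-effect {s} eqp v<n fr tr un l in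
          run-lower (fr , tr′ , un′ , eqr , cong suc eqp , z<s ,
            extend (λ u u< → transfer (same u (<⇒≢ u<)) (new u u<)) (low-lowered {f = f} (<⇒≤ v<n) (old (suc z) ≤-refl (<⇒≤ v<n)) value) ,
            (λ u u> u≤n → transfer (same u (>⇒≢ u>)) (old u (<⇒≤ u>) u≤n))))
        (λ ¬l → fr , tr , un , eqr , cong suc eqp , z<s ,
          extend new (align-progress slack (<⇒≤ v<n) (λ eq → contradiction eq (<⇒≢ v<n)) (λ u u≤ → new u (s≤s u≤)) old
            (λ l → ¬l (subst (Lowerable f) (sym eqp) l))) ,
          (λ u u> u≤n → old u (<⇒≤ u>) u≤n))
      where
      f : ℕ → ℕ
      f = arrays s Fᵃ
      f′ : ℕ → ℕ
      f′ = arrays (lowered (vars s posᵛ) s) Fᵃ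
      transfer : ∀ {t u} → f′ u ≡ f u → Low t f u → Low t f′ u
      transfer eq low j le = ≤-trans (≤-reflexive (cong (_+ j) eq)) (low j le)
      extend : ∀ {f′ : ℕ → ℕ} → (∀ u → u < suc z → Low (suc t) f′ u) → Low (suc t) f′ (suc z) →
               ∀ u → u < suc (suc z) → Low (suc t) f′ u
      extend lows low u u< with m≤n⇒m<n∨m≡n (s≤s⁻¹ u<)
      ... | inj₁ lt   = lows u lt
      ... | inj₂ refl = low

    sweepTime : ℕ
    sweepTime = loopTime (var nᵛ ⊖ var posᵛ) (pred n) (bound (whenLowerable lower) + bound next)

    closeTime : ℕ
    closeTime = bound (whenLowerable (lower ⨾ Fᵃ [ lit 0 ]:= lit 0))

    run-close : ∀ {r t s} → Sweeping r t n s →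
      Runs (whenLowerable (lower ⨾ Fᵃ [ lit 0 ]:= lit 0)) s (Phase r (suc t)) closeTime
    run-close {r} {t} {s} (fr , tr , un , eqr , eqp , _ , new , old) =
      run-whenLowerable fr (subst (1 ≤_) (sym eqp) (>-nonZero⁻¹ n))
        (λ l → let tr′ , based = close-effect {s} eqp fr tr un l in
          run-seq $ run-lower $ run-store (fr , tr′ , eqr , inj₁ based))
        (λ ¬l → fr , tr , eqr , inj₂ (un , λ u u≤n → low ¬l u (m≤n⇒m<n∨m≡n u≤n)))
      where
      f : ℕ → ℕ
      f = arrays s Fᵃ
      progress : ∀ z → suc z ≡ n → ¬ Lowerable f (suc z) → Low (suc t) f (suc z)
      progress z refl ¬l = align-progress slack ≤-refl (λ _ → ≤-reflexive (Unaligned.end un)) (λ u u≤ → new u (s≤s u≤))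
        (λ u u≥ u≤ → old u u≥ u≤) ¬l
      low : ¬ Lowerable f (vars s posᵛ) → ∀ u → u < n ⊎ u ≡ n → Low (suc t) f u
      low ¬l u (inj₁ lt)   = new u lt
      low ¬l u (inj₂ refl) = subst (Low (suc t) f) (suc-pred n) (progress (pred n) (suc-pred n)
        λ l → ¬l (subst (Lowerable f) (trans (suc-pred n) (sym eqp)) l))

    roundTime : ℕ
    roundTime = 2 + (sweepTime + closeTime)

    run-alignRound : ∀ {r t s} → t < K → Frame s → Trace s → vars s roundᵛ ≡ r →
      Unaligned (arrays s Fᵃ) → (∀ u → u ≤ n → Low t (arrays s Fᵃ) u) → Runs alignRound s (Phase r (suc t)) roundTime
    run-alignRound {r} {t} {s} t<K fr tr eqr un lows = run-seq $ run-assign $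
      run-then (run-forPos n (Sweeping r t) (λ (fr , _ , _ , _ , eqp , _) → proj₁ fr , eqp) align-sweep (pred n) (suc-pred n)
          (fr , tr , un , eqr , refl , z<s , start , λ u _ → lows u))
        run-close
      where
      start : ∀ u → u < 1 → Low (suc t) (arrays s Fᵃ) u
      -- The sweep never lowers position 0, so the tightened bound has to hold there outright. It
      -- does while `t < K`: from `j * K ≤ n + t + 1 < (m + 1) * K` follows `j ≤ m`.
      start zero _ j le = ≤-trans (≤-reflexive (cong (_+ j) (Unaligned.at-0 un))) (s≤s (s≤s⁻¹ (*-cancelʳ-< K j (suc m) (begin-strict
        j * K            ≡⟨ +-identityʳ _ ⟨
        j * K + 0        ≤⟨ le ⟩
        n + suc t        ≡⟨ +-suc n t ⟩
        suc n + t        <⟨ +-mono-≤-< slack t<K ⟩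
        m * K + K        ≡⟨ +-comm (m * K) K ⟩
        suc m * K        ∎))))
        where open ≤-Reasoning
      start (suc u) (s≤s ())

    alignTime : ℕ
    alignTime = 2 + loopTime (var roundᵛ) K (suc (cost (Fᵃ [ lit 0 ])) + (roundTime ⊔ 1) + 4)

    run-align : ∀ {s} → Frame s → Trace s →
      Based (arrays s Fᵃ) ⊎ (Unaligned (arrays s Fᵃ) × (∀ u → u ≤ n → Low 0 (arrays s Fᵃ) u)) →
      Runs align s (λ s′ → Frame s′ × Trace s′ × Based (arrays s′ Fᵃ)) alignTime
    run-align {s} fr tr phase = run-seq $ run-assign $ run-weaken (λ {s} → finish {s}) ≤-refl $
      run-while (λ t → Phase (K ∸ t) t) K (λ { _ (_ , _ , eqr , _) → eqr }) body K refl
        (fr , tr , proj₁ (proj₂ fr) , phase)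
      where
      body : ∀ {t s} → t < K → Phase (K ∸ t) t s → Runs _ s (Phase (K ∸ suc t) (suc t)) (suc (cost (Fᵃ [ lit 0 ])) + (roundTime ⊔ 1) + 4)
      body {t} {s} t<K (fr , tr , eqr , phase) = run-seq {T = suc (cost (Fᵃ [ lit 0 ])) + (roundTime ⊔ 1)} $ run-weaken
        (λ { (fr , tr , eqr , phase) → run-assign (fr , tr , trans (cong (_∸ 1) eqr) (trans (∸-+-assoc K t 1) (cong (K ∸_) (+-comm t 1))) , phase) })
        ≤-refl
        (run-if (λ ≢0 → whenUnaligned ≢0 phase) (λ ≡0 → run-skip (fr , tr , eqr , whenAligned ≡0 phase)))
        where
        whenUnaligned : arrays s Fᵃ 0 ≢ 0 → _ → Runs alignRound s (Phase (K ∸ t) (suc t)) roundTime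
        whenUnaligned ≢0 (inj₁ based)       = contradiction (Based.at-0 based) ≢0
        whenUnaligned ≢0 (inj₂ (un , lows)) = run-alignRound t<K fr tr eqr un lows
        whenAligned : arrays s Fᵃ 0 ≡ 0 → _ → Based (arrays s Fᵃ) ⊎ _
        whenAligned ≡0 (inj₁ based)    = inj₁ based
        whenAligned ≡0 (inj₂ (un , _)) = contradiction (trans (sym (Unaligned.at-0 un)) ≡0) λ ()
      finish : ∀ {s} → Phase (K ∸ K) K s → Frame s × Trace s × Based (arrays s Fᵃ)
      finish (fr , tr , _ , inj₁ based) = fr , tr , based
      -- At time `K` the potential with `j = 1` bounds `f n` by `m`, whereas a height that is still
      -- unaligned has `f n = m + 1`.
      finish {s} (fr , tr , _ , inj₂ (un , lows)) = contradiction
        (≤-trans (≤-reflexive (cong (_+ 1) (sym end))) (lows n ≤-refl 1 (≤-reflexive (trans (cong (_+ n) (+-identityʳ K)) (+-comm K n)))))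
        (<⇒≱ (≤-reflexive (+-comm 1 (suc m))))
        where
        end : arrays s Fᵃ n ≡ suc m
        end = trans (total (Unaligned.spanning un)) (cong (_+ m) (Unaligned.at-0 un))

-- Token sliding between two sets that share the base.

raise : Cmd
raise =
  emit (labelᵃ [ var posᵛ ]) ⨾
  emit (labelᵃ [ var posᵛ ⊖ lit 1 ]) ⨾
  Fᵃ [ var posᵛ ]:= lit 1 ⊕ Fᵃ [ var posᵛ ]

whenRaisable : Cmd → Cmd
whenRaisable act =
  ifnz Fᵃ [ lit 1 ⊕ var posᵛ ] ⊖ Fᵃ [ var posᵛ ] then
    (ifnz Fᵃ [ var posᵛ ] ⊖ Fᵃ [ var posᵛ ⊖ lit 1 ] then skip else
      (ifnz (var posᵛ ⊕ var widthᵛ) ⊖ var nᵛ then act else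
        (ifnz Fᵃ [ var posᵛ ⊕ var widthᵛ ] ⊖ (lit 1 ⊕ Fᵃ [ var posᵛ ]) then act else skip)))
  else skip

approach : Cmd
approach =
  ifnz Fᵃ [ var posᵛ ] ⊖ Gᵃ [ var posᵛ ] then whenLowerable lower else
    (ifnz Gᵃ [ var posᵛ ] ⊖ Fᵃ [ var posᵛ ] then whenRaisable raise else skip)

slideTokens : Cmd
slideTokens =
  roundᵛ := lit 1 ⊕ var nᵛ ⊕ var nᵛ ⊕ var nᵛ ⊕ var nᵛ ⊕ var nᵛ ⨾
  while var roundᵛ loop
    ((posᵛ := lit 1 ⨾ forPos approach) ⨾ roundᵛ := var roundᵛ ⊖ lit 1)

overweight : ∀ {a b} c → a ≡ suc c + b → ¬ a ≤ b
overweight {b = b} c refl = <⇒≱ (s≤s (m≤n+m b c))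

module Slides (n : ℕ) .{{_ : NonZero n}} (3≤n : 3 ≤ n) (k K m b : ℕ)
              (2≤k : 2 ≤ k) (width : Width n k K) (R : Rule) (I J : Subset n) where
  open Heights n 3≤n k K m b 2≤k width
  open Jumps n 3≤n k K m b 2≤k width
  open Align n 3≤n k K m b 2≤k width R I J
  open Spanning
  open Based

  -- Windows past the base are not tested: heights are raised only towards a target that is at most
  -- `m`, and the token at the base then settles those windows.
  record Raisable (f : ℕ → ℕ) (v : ℕ) : Set where
    field
      up    : f v < f (suc v)
      flat  : f v ≤ f (v ∸ 1)
      inner : v + K ≤ n → suc (f v) < f (v + K)

  run-whenRaisable : ∀ {s Q act} → Frame s →
    (Raisable (arrays s Fᵃ) (vars s posᵛ) → Runs act s Q (bound act)) →
    (¬ Raisable (arrays s Fᵃ) (vars s posᵛ) → Q s) →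
    Runs (whenRaisable act) s Q (bound (whenRaisable act))
  run-whenRaisable {s} (eqn , eqK , _) act skip′ = run-if
    (λ up → run-if
      (λ ≢0 → run-skip (skip′ λ r → <⇒≱ (m∸n≢0⇒n<m ≢0) (Raisable.flat r)))
      (λ flat → run-if
        (λ outside → act record
          { up = m∸n≢0⇒n<m up ; flat = m∸n≡0⇒m≤n flat
          ; inner = λ le → contradiction le (<⇒≱ (subst₂ (λ x y → x < vars s posᵛ + y) eqn eqK (m∸n≢0⇒n<m outside))) })
        (λ within → run-if
          (λ ≢0 → act record
            { up = m∸n≢0⇒n<m up ; flat = m∸n≡0⇒m≤n flat
            ; inner = λ _ → subst (λ y → suc (f v) < f (v + y)) eqK (m∸n≢0⇒n<m {f (v + vars s widthᵛ)} ≢0) })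
          (λ ≡0 → run-skip (skip′ λ r → <⇒≱
            (Raisable.inner r (subst₂ (λ x y → v + y ≤ x) eqn eqK (m∸n≡0⇒m≤n within)))
            (subst (λ y → f (v + y) ≤ suc (f v)) eqK (m∸n≡0⇒m≤n {f (v + vars s widthᵛ)} ≡0)))))))
    (λ ≡0 → run-skip (skip′ λ r → <⇒≱ (Raisable.up r) (m∸n≡0⇒m≤n ≡0)))
    where
    f : ℕ → ℕ
    f = arrays s Fᵃ
    v : ℕ
    v = vars s posᵛ

  raised : ℕ → State → State
  raised p s = setArray Fᵃ p (suc (arrays s Fᵃ p)) (write (arrays s labelᵃ (p ∸ 1)) (write (arrays s labelᵃ p) s))

  run-raise : ∀ {s} {Q : State → Set} → Q (raised (vars s posᵛ) s) → Runs raise s Q (bound raise)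
  run-raise q = run-seq $ run-emit $ run-seq $ run-emit $ run-store q

  module _ {f : ℕ → ℕ} {z : ℕ} (1+z<n : suc z < n) (bf : Based f) (r : Raisable f (suc z)) (room : f (suc z) < m) where
    private
      f′ : ℕ → ℕ
      f′ = f [ suc z ↦ suc (f (suc z)) ]

      elsewhere : ∀ {w} → w ≢ suc z → f′ w ≡ f w
      elsewhere w≢ = update-other f _ (w≢ ∘ sym)

      value : f′ (suc z) ≡ suc (f (suc z))
      value = update-same f (suc z) _

      flat : f (suc z) ≡ f z
      flat = ≤-antisym (Raisable.flat r) (proj₁ (gentle bf z (<⇒≤ 1+z<n)))

      up : f (suc (suc z)) ≡ suc (f (suc z))
      up = ≤-antisym (proj₂ (gentle bf (suc z) 1+z<n)) (Raisable.up r)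

      raise-spanning : Spanning f′
      raise-spanning = Spanning-raise (spanning bf)
        (trans (elsewhere (>⇒≢ 1+z<n)) (trans (total (spanning bf)) (cong (_+ m) (sym (elsewhere λ ())))))
        above clear
        where
        above : ∀ w → w ≤ n → f w ≤ f′ w
        above w _ with w ≟ suc z
        ... | yes refl = ≤-trans (n≤1+n _) (≤-reflexive (sym value))
        ... | no  w≢   = ≤-reflexive (sym (elsewhere w≢))
        outer′ : ∀ u → u + n ≡ suc z + K → suc (f (suc z)) < f u + m
        outer′ zero eq = <-≤-trans (Raisable.inner r (≤-reflexive (sym eq)))
          (≤-reflexive (trans (cong f (sym eq)) (total (spanning bf))))
        outer′ u@(suc _) eq = ≤-trans (s≤s room) (+-monoˡ-≤ m (positive bf z<s (wrapped≤n eq 1+z<n)))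
        clear : ∀ w → w ≤ n → _
        clear w _ with w ≟ suc z
        ... | yes refl = inj₂ ((λ le → ≤-<-trans (≤-reflexive value) (Raisable.inner r le)) ,
                               (λ u eq → ≤-<-trans (≤-reflexive value) (outer′ u eq)))
        ... | no  w≢   = inj₁ (sym (elsewhere w≢))

    raise-based : Based f′
    raise-based = record
      { spanning = raise-spanning
      ; gentle   = gentle-update (gentle bf) (≤-trans (≤-reflexive (sym flat)) (n≤1+n _)) (s≤s (Raisable.flat r))
          (λ _ → ≤-reflexive (sym up) , ≤-trans (≤-reflexive up) (n≤1+n _))
      ; at-0     = at-0 bf
      ; at-1     = trans (elsewhere 1≢) (at-1 bf) }
      where
      1≢ : 1 ≢ suc z
      1≢ refl = contradiction (trans (sym (at-1 bf)) (trans flat (at-0 bf))) λ ()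

    raise-step : Step R G k (tokens f) (tokens f′)
    raise-step = Step-sym (slide {R} {z = z} 1+z<n raise-spanning (spanning bf)
      (trans value (cong suc (trans flat (sym (elsewhere (<⇒≢ ≤-refl))))))
      (trans (elsewhere (>⇒≢ ≤-refl)) (trans up (sym value)))
      value (λ w _ w≢ → elsewhere w≢))

  module _ {f : ℕ → ℕ} {z : ℕ} (1+z<n : suc z < n) (bf : Based f) (l : Lowerable f (suc z)) where

    lower-based : 1 < f (suc z) → Based (f [ suc z ↦ f (suc z) ∸ 1 ])
    lower-based 1<f = record
      { spanning = lower-spanning (spanning bf) (gentle bf) l 1+z<n
      ; gentle   = lower-gentle (spanning bf) (gentle bf) l (<⇒≤ 1+z<n)
      ; at-0     = at-0 bf
      ; at-1     = trans (update-other f _ 1≢) (at-1 bf) }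
      where
      1≢ : suc z ≢ 1
      1≢ refl = <⇒≢ 1<f (sym (at-1 bf))

  -- The two potentials of the sweeps: a height differing from its target by
  -- more than they allow would have been moved before time t.
  Upper Lower Near : ℕ → (f g : ℕ → ℕ) → ℕ → Set
  Upper t f g u = f u ≤ g u ⊎ 3 * f u + t ≤ 3 * n + 2 * u
  Lower t f g u = g u ≤ f u ⊎ 2 * u + t ≤ 3 * f u + 2 * n
  Near t f g u = Upper t f g u × Lower t f g u

  module _ {f g : ℕ → ℕ} {t z : ℕ} (1+z<n : suc z < n) (bf : Based f) (bg : Based g)
           (new : ∀ u → u ≤ z → Near (suc t) f g u) (old : ∀ u → suc z ≤ u → u ≤ n → Near t f g u) where

    -- A position whose height violates the bound for time `t + 1` is shown to be lowerable. A
    -- neighbour or window start that blocked it would lie above its own target too, hence obey its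
    -- own bound. That bound is `n + (2u - t) / 3`, and 2/3 is the simplest slope between 1/2 and 1:
    -- it is below 1, so a token ahead cannot block, and over `K ≥ 2` positions the bound gains more
    -- than 1, so the start of a window cannot block either.
    stuck-upper : g (suc z) < f (suc z) → ¬ Lowerable f (suc z) → Near (suc t) f g (suc z)
    stuck-upper above stuck = upper (proj₁ (old (suc z) ≤-refl (<⇒≤ 1+z<n))) , inj₁ (<⇒≤ above)
      where
      module _ (late : 3 * n + 2 * suc z ≤ 3 * f (suc z) + t) where
        up : f z < f (suc z)
        up with f z <? f (suc z)
        ... | yes lt = lt
        ... | no  ≮ with proj₁ (new z ≤-refl)
        ...   | inj₁ below = contradiction (≤-trans (≮⇒≥ ≮) (≤-trans below (proj₁ (gentle bg z (<⇒≤ 1+z<n))))) (<⇒≱ above)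
        ...   | inj₂ early = contradiction (+-mono-≤ (+-mono-≤ early late) (*-monoʳ-≤ 3 (≮⇒≥ ≮)))
                  (overweight 2 (lemma n t z (f z) (f (suc z))))
          where
          lemma : ∀ n t z x y → 3 * x + suc t + (3 * n + 2 * suc z) + 3 * y ≡ 3 + (3 * n + 2 * z + (3 * y + t) + 3 * x)
          lemma = solve-∀
        flat : f (suc (suc z)) ≤ f (suc z)
        flat with f (suc (suc z)) ≤? f (suc z)
        ... | yes le = le
        ... | no  ≰ with proj₁ (old (suc (suc z)) (n≤1+n _) 1+z<n)
        ...   | inj₁ below = contradiction (≤-trans (≤-trans (s≤s above) (≰⇒> ≰)) (≤-trans below (proj₂ (gentle bg (suc z) 1+z<n)))) (<⇒≱ ≤-refl)
        ...   | inj₂ early = contradiction (+-mono-≤ (+-mono-≤ early late) (*-monoʳ-≤ 3 (≰⇒> ≰)))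
                  (overweight 0 (lemma n t z (f (suc (suc z))) (f (suc z))))
          where
          lemma : ∀ n t z x y → 3 * x + t + (3 * n + 2 * suc z) + 3 * suc y ≡ 1 + (3 * n + 2 * suc (suc z) + (3 * y + t) + 3 * x)
          lemma = solve-∀
        inn : ∀ w → w + K ≡ suc z → suc (f w) < f (suc z)
        inn w eq with suc (f w) <? f (suc z)
        ... | yes lt = lt
        ... | no  ≮ with proj₁ (new w w≤z)
          where
          w≤z : w ≤ z
          w≤z = s≤s⁻¹ (≤-trans (≤-trans (≤-reflexive (+-comm 1 w)) (+-monoʳ-≤ w 1≤K)) (≤-reflexive eq))
        ...   | inj₁ below = contradiction (begin-strict
                  f w             ≤⟨ below ⟩
                  g w             <⟨ inner (spanning bg) w (≤-trans (≤-reflexive eq) (<⇒≤ 1+z<n)) ⟩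
                  g (w + K)       ≡⟨ cong g eq ⟩
                  g (suc z)       ≤⟨ s≤s⁻¹ (≤-trans above (≮⇒≥ ≮)) ⟩
                  f w             ∎) (n≮n _)
          where open ≤-Reasoning
        ...   | inj₂ early = contradiction (+-mono-≤ (+-mono-≤ early (subst (λ v → 3 * n + 2 * v ≤ 3 * f (suc z) + t) (sym eq) late))
                                 (+-mono-≤ (*-monoʳ-≤ 3 (≮⇒≥ ≮)) (*-monoʳ-≤ 2 2≤K)))
                  (overweight 1 (lemma n t w K (f w) (f (suc z))))
          where
          lemma : ∀ n t w K x y → 3 * x + suc t + (3 * n + 2 * (w + K)) + (3 * y + 4) ≡
                                  2 + (3 * n + 2 * w + (3 * y + t) + (3 * suc x + 2 * K))
          lemma = solve-∀
        out : ∀ w → suc z + n ≡ w + K → w < n → suc (f w) < f (suc z) + m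
        -- The token at the base again: `f (suc z)` exceeds a target of at least 1, while `f w ≤ m`.
        out w _ w<n = +-mono-≤ (≤-trans (s≤s (positive bg z<s (<⇒≤ 1+z<n))) above) (≤m bf (<⇒≤ w<n))
      upper : Upper t f g (suc z) → Upper (suc t) f g (suc z)
      upper (inj₁ le) = inj₁ le
      upper (inj₂ early) with 3 * f (suc z) + suc t ≤? 3 * n + 2 * suc z
      ... | yes le = inj₂ le
      ... | no  ≰  = let late = s≤s⁻¹ (≤-trans (≰⇒> ≰) (≤-reflexive (+-suc (3 * f (suc z)) t))) in
        contradiction record { up = up late ; flat = flat late ; inner = inn late ; outer = out late } stuck

    -- The mirror image, with the lower bound `(2u + t - 2n) / 3`. The far end of the window has not
    -- yet been visited in this sweep, so `2 * K ≥ 4` has to beat 3 without help from the clock.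
    stuck-lower : f (suc z) < g (suc z) → ¬ Raisable f (suc z) → Near (suc t) f g (suc z)
    stuck-lower below stuck = inj₁ (<⇒≤ below) , low (proj₂ (old (suc z) ≤-refl (<⇒≤ 1+z<n)))
      where
      module _ (late : 3 * f (suc z) + 2 * n ≤ 2 * suc z + t) where
        up : f (suc z) < f (suc (suc z))
        up with f (suc z) <? f (suc (suc z))
        ... | yes lt = lt
        ... | no  ≮ with proj₂ (old (suc (suc z)) (n≤1+n _) 1+z<n)
        ...   | inj₁ above = contradiction (≤-trans (proj₁ (gentle bg (suc z) 1+z<n)) (≤-trans above (≮⇒≥ ≮))) (<⇒≱ below)
        ...   | inj₂ early = contradiction (+-mono-≤ (+-mono-≤ early late) (*-monoʳ-≤ 3 (≮⇒≥ ≮)))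
                  (overweight 1 (lemma n t z (f (suc (suc z))) (f (suc z))))
          where
          lemma : ∀ n t z x y → 2 * suc (suc z) + t + (3 * y + 2 * n) + 3 * x ≡ 2 + (3 * x + 2 * n + (2 * suc z + t) + 3 * y)
          lemma = solve-∀
        flat : f (suc z) ≤ f z
        flat with f (suc z) ≤? f z
        ... | yes le = le
        ... | no  ≰ with proj₂ (new z ≤-refl)
        ...   | inj₁ above = contradiction (≤-trans (s≤s (≰⇒> ≰)) (≤-trans below (≤-trans (proj₂ (gentle bg z (<⇒≤ 1+z<n))) (s≤s above)))) (<⇒≱ ≤-refl)
        ...   | inj₂ early = contradiction (+-mono-≤ (+-mono-≤ early late) (*-monoʳ-≤ 3 (≰⇒> ≰)))
                  (overweight 1 (lemma n t z (f z) (f (suc z))))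
          where
          lemma : ∀ n t z x y → 2 * z + suc t + (3 * y + 2 * n) + 3 * suc x ≡ 2 + (3 * x + 2 * n + (2 * suc z + t) + 3 * y)
          lemma = solve-∀
        inn : suc z + K ≤ n → suc (f (suc z)) < f (suc z + K)
        inn le with suc (f (suc z)) <? f (suc z + K)
        ... | yes lt = lt
        ... | no  ≮ with proj₂ (old (suc z + K) (m≤m+n (suc z) K) le)
        ...   | inj₁ above = contradiction (begin-strict
                  suc (f (suc z))    ≤⟨ below ⟩
                  g (suc z)          <⟨ inner (spanning bg) (suc z) le ⟩
                  g (suc z + K)      ≤⟨ above ⟩
                  f (suc z + K)      ≤⟨ ≮⇒≥ ≮ ⟩
                  suc (f (suc z))    ∎) (n≮n _)
          where open ≤-Reasoning
        ...   | inj₂ early = contradiction (+-mono-≤ (+-mono-≤ early late) (+-mono-≤ (*-monoʳ-≤ 3 (≮⇒≥ ≮)) (*-monoʳ-≤ 2 2≤K)))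
                  (overweight 0 (lemma n t (suc z) K (f (suc z + K)) (f (suc z))))
          where
          lemma : ∀ n t v K x y → 2 * (v + K) + t + (3 * y + 2 * n) + (3 * x + 4) ≡
                                  1 + (3 * x + 2 * n + (2 * v + t) + (3 * suc y + 2 * K))
          lemma = solve-∀
      low : Lower t f g (suc z) → Lower (suc t) f g (suc z)
      low (inj₁ le) = inj₁ le
      low (inj₂ early) with 2 * suc z + suc t ≤? 3 * f (suc z) + 2 * n
      ... | yes le = inj₂ le
      ... | no  ≰  = let late = s≤s⁻¹ (≤-trans (≰⇒> ≰) (≤-reflexive (+-suc (2 * suc z) t))) in
        contradiction record { up = up late ; flat = flat late ; inner = inn late } stuck

  lower-effect′ : ∀ {s z p} → p ≡ suc z → suc z < n → Frame s → Trace s → Based (arrays s Fᵃ) →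
    Lowerable (arrays s Fᵃ) p → 1 < arrays s Fᵃ (suc z) →
    Trace (lowered p s) × Based (arrays (lowered p s) Fᵃ) ×
    suc (arrays (lowered p s) Fᵃ (suc z)) ≡ arrays s Fᵃ (suc z) ×
    (∀ u → u ≢ suc z → arrays (lowered p s) Fᵃ u ≡ arrays s Fᵃ u)
  lower-effect′ {s} {z} refl 1+z<n fr tr bf l 1<f =
    traced-slide {s} (<⇒≤ 1+z<n) fr tr (lower-step (spanning bf) (gentle bf) l 1+z<n) refl (toℕ-at (suc z)) ,
    lower-based 1+z<n bf l 1<f ,
    sym (lower-value (spanning bf) (gentle bf) l (<⇒≤ 1+z<n)) ,
    λ u u≢ → update-other (arrays s Fᵃ) _ (u≢ ∘ sym)

  raise-effect : ∀ {s z p} → p ≡ suc z → suc z < n → Frame s → Trace s → Based (arrays s Fᵃ) →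
    Raisable (arrays s Fᵃ) p → arrays s Fᵃ (suc z) < m →
    Trace (raised p s) × Based (arrays (raised p s) Fᵃ) ×
    arrays (raised p s) Fᵃ (suc z) ≡ suc (arrays s Fᵃ (suc z)) ×
    (∀ u → u ≢ suc z → arrays (raised p s) Fᵃ u ≡ arrays s Fᵃ u)
  raise-effect {s} {z} refl 1+z<n (_ , _ , _ , labels , _) tr bf r room =
    Traced-snoc tr (raise-step 1+z<n bf r room)
      (trans (toℕ-at (suc z)) (sym (labels (suc z) (<⇒≤ 1+z<n))))
      (trans (toℕ-at z) (sym (labels z (<⇒≤ (<⇒≤ 1+z<n))))) ,
    raise-based 1+z<n bf r room ,
    update-same (arrays s Fᵃ) (suc z) _ ,
    λ u u≢ → update-other (arrays s Fᵃ) _ (u≢ ∘ sym)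

  near-transfer : ∀ {t f f′ g u} → f′ u ≡ f u → Near t f g u → Near t f′ g u
  near-transfer eq near rewrite eq = near

  -- A move changes `3 * f u` by 3, more than the one unit that the clock takes. It never passes the
  -- target, so the opposite bound holds by its first alternative.
  near-lowered : ∀ {t f f′ g u} → g u < f u → suc (f′ u) ≡ f u → Near t f g u → Near (suc t) f′ g u
  near-lowered {t} {f} {f′} {g} {u} above eq (upper , _) = go upper , inj₁ (s≤s⁻¹ (≤-trans above (≤-reflexive (sym eq))))
    where
    lemma : ∀ x t → 3 * suc x + t ≡ 2 + (3 * x + suc t)
    lemma = solve-∀
    go : Upper t f g u → Upper (suc t) f′ g u
    go (inj₁ below) = contradiction below (<⇒≱ above)
    go (inj₂ early) = inj₂ (≤-trans (≤-trans (m≤n+m _ 2) (≤-reflexive (trans (sym (lemma (f′ u) t)) (cong (λ x → 3 * x + t) eq)))) early)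

  near-raised : ∀ {t f f′ g u} → f u < g u → f′ u ≡ suc (f u) → Near t f g u → Near (suc t) f′ g u
  near-raised {t} {f} {f′} {g} {u} below eq (_ , lower) = inj₁ (≤-trans (≤-reflexive eq) below) , go lower
    where
    lemma : ∀ x n → 3 * suc x + 2 * n ≡ 3 + (3 * x + 2 * n)
    lemma = solve-∀
    go : Lower t f g u → Lower (suc t) f′ g u
    go (inj₁ above) = contradiction above (<⇒≱ below)
    go (inj₂ early) = inj₂ (begin
      2 * u + suc t             ≡⟨ +-suc (2 * u) t ⟩
      suc (2 * u + t)           ≤⟨ s≤s early ⟩
      1 + (3 * f u + 2 * n)     ≤⟨ +-monoˡ-≤ (3 * f u + 2 * n) (s≤s {n = 2} z≤n) ⟩
      3 + (3 * f u + 2 * n)     ≡⟨ lemma (f u) n ⟨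
      3 * suc (f u) + 2 * n     ≡⟨ cong (λ x → 3 * x + 2 * n) eq ⟨
      3 * f′ u + 2 * n          ∎)
      where open ≤-Reasoning

  Approaching : ℕ → ℕ → ℕ → State → Set
  Approaching r t v s = Frame s × Trace s × Based (arrays s Fᵃ) × vars s roundᵛ ≡ r × vars s posᵛ ≡ v × 0 < v ×
    (∀ u → u < v → Near (suc t) (arrays s Fᵃ) (arrays s Gᵃ) u) ×
    (∀ u → v ≤ u → u ≤ n → Near t (arrays s Fᵃ) (arrays s Gᵃ) u)

  Round : ℕ → ℕ → State → Set
  Round r t s = Frame s × Trace s × Based (arrays s Fᵃ) × vars s roundᵛ ≡ r ×
    (∀ u → u ≤ n → Near t (arrays s Fᵃ) (arrays s Gᵃ) u)

  run-approach : ∀ {r t v s} → v < n → Approaching r t v s →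
    Runs approach s (λ s′ → Approaching r t (suc v) (setVar posᵛ (suc (vars s′ posᵛ)) s′)) (bound approach)
  run-approach {v = zero} _ (_ , _ , _ , _ , _ , () , _)
  run-approach {r} {t} {suc z} {s} v<n (fr@(_ , _ , _ , _ , bg , _) , tr , bf , eqr , eqp , _ , new , old) = run-if
    (λ f>g → let above = subst (λ p → g p < f p) eqp (m∸n≢0⇒n<m f>g) in
      run-whenLowerable fr (subst (1 ≤_) (sym eqp) (s≤s z≤n))
        (λ l → let tr′ , bf′ , value , same = lower-effect′ {s} eqp v<n fr tr bf l (≤-trans (s≤s (positive bg z<s (<⇒≤ v<n))) above) in
          run-lower (fr , tr′ , bf′ , eqr , cong suc eqp , z<s ,
            extend (λ u u< → near-transfer {f = f} {f′ = f↓} {g} (same u (<⇒≢ u<)) (new u u<)) (near-lowered {f = f} {f↓} {g} above value current) ,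
            (λ u u> u≤n → near-transfer {f = f} {f′ = f↓} {g} (same u (>⇒≢ u>)) (old u (<⇒≤ u>) u≤n))))
        (λ ¬l → unmoved (stuck-upper v<n bf bg (λ u u≤ → new u (s≤s u≤)) old above (λ l → ¬l (subst (Lowerable f) (sym eqp) l)))))
    (λ f≤g → run-if
      (λ g>f → let below = subst (λ p → f p < g p) eqp (m∸n≢0⇒n<m g>f) in
        run-whenRaisable fr
          (λ r → let tr′ , bf′ , value , same = raise-effect {s} eqp v<n fr tr bf r (<-≤-trans below (≤m bg (<⇒≤ v<n))) in
            run-raise (fr , tr′ , bf′ , eqr , cong suc eqp , z<s ,
              extend (λ u u< → near-transfer {f = f} {f′ = f↑} {g} (same u (<⇒≢ u<)) (new u u<)) (near-raised {f = f} {f↑} {g} below value current) ,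
              (λ u u> u≤n → near-transfer {f = f} {f′ = f↑} {g} (same u (>⇒≢ u>)) (old u (<⇒≤ u>) u≤n))))
          (λ ¬r → unmoved (stuck-lower v<n bf bg (λ u u≤ → new u (s≤s u≤)) old below (λ r → ¬r (subst (Raisable f) (sym eqp) r)))))
      (λ g≤f → run-skip (unmoved (inj₁ (subst (λ p → f p ≤ g p) eqp (m∸n≡0⇒m≤n f≤g)) ,
                                  inj₁ (subst (λ p → g p ≤ f p) eqp (m∸n≡0⇒m≤n g≤f))))))
    where
    f g f↓ f↑ : ℕ → ℕ
    f  = arrays s Fᵃ
    g  = arrays s Gᵃ
    f↓ = arrays (lowered (vars s posᵛ) s) Fᵃ
    f↑ = arrays (raised (vars s posᵛ) s) Fᵃ
    current : Near t f g (suc z)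
    current = old (suc z) ≤-refl (<⇒≤ v<n)
    extend : ∀ {f′ : ℕ → ℕ} → (∀ u → u < suc z → Near (suc t) f′ g u) → Near (suc t) f′ g (suc z) →
             ∀ u → u < suc (suc z) → Near (suc t) f′ g u
    extend nears near u u< with m≤n⇒m<n∨m≡n (s≤s⁻¹ u<)
    ... | inj₁ lt   = nears u lt
    ... | inj₂ refl = near
    unmoved : Near (suc t) f g (suc z) → Approaching r t (suc (suc z)) (setVar posᵛ (suc (vars s posᵛ)) s)
    unmoved near = fr , tr , bf , eqr , cong suc eqp , z<s , extend new near , λ u u> u≤n → old u (<⇒≤ u>) u≤n

  near-fixed : ∀ {f g t} u → f u ≡ g u → Near t f g u
  near-fixed u eq = inj₁ (≤-reflexive eq) , inj₁ (≤-reflexive (sym eq))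

  approachTime : ℕ
  approachTime = loopTime (var nᵛ ⊖ var posᵛ) (pred n) (bound approach + bound next)

  run-approachRound : ∀ {r t s} → Round r t s → Runs (posᵛ := lit 1 ⨾ forPos approach) s (Round r (suc t)) (2 + approachTime)
  run-approachRound {r} {t} {s} (fr@(_ , _ , _ , _ , bg , _) , tr , bf , eqr , nears) = run-seq $ run-assign $
    run-weaken (λ {s} → finish {s}) ≤-refl
      (run-forPos n (Approaching r t) (λ (fr , _ , _ , _ , eqp , _) → proj₁ fr , eqp) run-approach (pred n) (suc-pred n)
        (fr , tr , bf , eqr , refl , z<s ,
         (λ { zero _ → near-fixed {arrays s Fᵃ} {arrays s Gᵃ} 0 (trans (at-0 bf) (sym (at-0 bg))) ; (suc _) (s≤s ()) }) ,
         (λ u _ → nears u)))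
    where
    finish : ∀ {s} → Approaching r t n s → Round r (suc t) s
    finish {s} (fr@(_ , _ , _ , _ , bg , _) , tr , bf , eqr , _ , _ , new , _) = fr , tr , bf , eqr , λ u u≤n → near u (m≤n⇒m<n∨m≡n u≤n)
      where
      near : ∀ u → u < n ⊎ u ≡ n → Near (suc t) (arrays s Fᵃ) (arrays s Gᵃ) u
      near u (inj₁ lt)   = new u lt
      near u (inj₂ refl) = near-fixed {arrays s Fᵃ} {arrays s Gᵃ} n (trans (at-n bf) (sym (at-n bg)))

  height≤ : ∀ {f} → Based f → ∀ u → u ≤ n → f u ≤ u
  height≤ bf zero    _   = ≤-reflexive (at-0 bf)
  height≤ bf (suc u) u<n = ≤-trans (proj₂ (gentle bf u u<n)) (s≤s (height≤ bf u (<⇒≤ u<n)))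

  -- With `u` and `f u` at most `n`, neither `3 * n + 2 * u` nor `3 * f u + 2 * n` exceeds `5n`. At
  -- time `5n + 1` the second alternatives of `Upper` and `Lower` are therefore impossible.
  rounds : ℕ
  rounds = 1 + n + n + n + n + n

  slideTime : ℕ
  slideTime = 12 + loopTime (var roundᵛ) rounds (2 + approachTime + 4)

  run-slideTokens : ∀ {s} → Frame s → Trace s → Based (arrays s Fᵃ) →
    Runs slideTokens s (λ s′ → Traced R G k I J (output s′)) slideTime
  run-slideTokens {s} fr@(eqn , _) tr bf = run-seq $ run-assign $ run-weaken (λ {s} → finish {s}) ≤-refl $
    run-while (λ t → Round (rounds ∸ t) t) rounds (λ { _ (_ , _ , _ , eqr , _) → eqr })
      (λ {t} _ rd → run-seq {T = 2 + approachTime} $ run-weaken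
        (λ { (fr , tr , bf , eqr , nears) → run-assign (fr , tr , bf , trans (cong (_∸ 1) eqr) (trans (∸-+-assoc rounds t 1) (cong (rounds ∸_) (+-comm t 1))) , nears) })
        ≤-refl (run-approachRound rd))
      rounds refl
      (fr , tr , bf , cong (λ n → 1 + n + n + n + n + n) eqn , λ u u≤n →
        -- The offsets `3 * n` and `2 * n` of the potentials are chosen so that both hold at time 0,
        -- by `f u ≤ n` and `u ≤ n`.
        inj₂ (≤-trans (≤-reflexive (+-identityʳ _)) (≤-trans (*-monoʳ-≤ 3 (≤-trans (height≤ bf u u≤n) u≤n)) (m≤m+n _ _))) ,
        inj₂ (≤-trans (≤-reflexive (+-identityʳ _)) (≤-trans (*-monoʳ-≤ 2 u≤n) (m≤n+m (2 * n) (3 * arrays s Fᵃ u)))))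
    where
    5n : ∀ n → 1 + n + n + n + n + n ≡ 1 + (3 * n + 2 * n)
    5n = solve-∀
    finish : ∀ {s} → Round (rounds ∸ rounds) rounds s → Traced R G k I J (output s)
    finish {s} ((_ , _ , _ , _ , bg , eqJ) , tr , bf , _ , nears) =
      subst (λ X → Traced R G k I X (output s)) (trans (tokens-cong λ u u≤n → sym (reached u u≤n (nears u u≤n))) eqJ) tr
      where
      f g : ℕ → ℕ
      f = arrays s Fᵃ
      g = arrays s Gᵃ
      reached : ∀ u → u ≤ n → Near rounds f g u → f u ≡ g u
      reached u u≤n (upper , lower) = ≤-antisym (below upper) (above lower)
        where
        below : Upper rounds f g u → f u ≤ g u
        below (inj₁ le)    = le
        below (inj₂ early) = contradiction (≤-trans (≤-trans (m≤n+m rounds (3 * f u)) early) (+-monoʳ-≤ (3 * n) (*-monoʳ-≤ 2 u≤n)))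
          (overweight 0 (5n n))
        above : Lower rounds f g u → g u ≤ f u
        above (inj₁ le)    = le
        above (inj₂ early) = contradiction (≤-trans (≤-trans (m≤n+m rounds (2 * u)) early) (+-monoˡ-≤ (2 * n) (*-monoʳ-≤ 3 (≤-trans (height≤ bf u u≤n) u≤n))))
          (overweight 0 (5n n))

-- Token jumping between two sets that share the base.

collectStep : Cmd
collectStep =
  ifnz (Fᵃ [ lit 1 ⊕ var posᵛ ] ⊖ Fᵃ [ var posᵛ ]) ⊖ (Gᵃ [ lit 1 ⊕ var posᵛ ] ⊖ Gᵃ [ var posᵛ ])
    then (xᵃ [ var leftᵛ ]:= var posᵛ ⨾ leftᵛ := lit 1 ⊕ var leftᵛ) else
  (ifnz (Gᵃ [ lit 1 ⊕ var posᵛ ] ⊖ Gᵃ [ var posᵛ ]) ⊖ (Fᵃ [ lit 1 ⊕ var posᵛ ] ⊖ Fᵃ [ var posᵛ ])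
    then (yᵃ [ var enteredᵛ ]:= var posᵛ ⨾ enteredᵛ := lit 1 ⊕ var enteredᵛ) else
  skip)

collect : Cmd
collect = leftᵛ := lit 0 ⨾ enteredᵛ := lit 0 ⨾ posᵛ := lit 0 ⨾ forPos collectStep

emitJump : ℕ → Cmd
emitJump v = emit (labelᵃ [ xᵃ [ var v ] ]) ⨾ emit (labelᵃ [ yᵃ [ var v ] ])

ascendStep descendStep : Cmd
ascendStep  = ifnz yᵃ [ var posᵛ ] ⊖ xᵃ [ var posᵛ ] then emitJump posᵛ else skip
descendStep = ifnz xᵃ [ var leftᵛ ] ⊖ yᵃ [ var leftᵛ ] then emitJump leftᵛ else skip

ascend descend : Cmd
ascend  = posᵛ := lit 0 ⨾ while var leftᵛ ⊖ var posᵛ loop (ascendStep ⨾ next)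
descend = while var leftᵛ loop (leftᵛ := var leftᵛ ⊖ lit 1 ⨾ descendStep)

-- The i-th token to leave jumps to the i-th position to be entered. The jumps
-- with x < y are made in ascending order, then those with x > y in descending
-- order.
jumpTokens : Cmd
jumpTokens = collect ⨾ ascend ⨾ descend

loopTime-mono : ∀ e {c d} T → c ≤ d → loopTime e c T ≤ loopTime e d T
loopTime-mono e T c≤d = +-monoˡ-≤ _ (*-monoˡ-≤ _ c≤d)

m<n⇒n∸m≡1+ : ∀ {m n} → m < n → n ∸ m ≡ suc (n ∸ suc m)
m<n⇒n∸m≡1+ {zero}  {suc n} _         = refl
m<n⇒n∸m≡1+ {suc m} {suc n} (s≤s m<n) = m<n⇒n∸m≡1+ m<n

-- The array enumerates the departing positions below `v` in ascending order: its entry `j` is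
-- identified by its rank, the number of departures before it.
Listed : (F G a : ℕ → ℕ) → ℕ → Set
Listed F G a v = ∀ j → j < left F G v → a j < v × left F G (a j) ≡ j × Leave F G (a j)

Listed-same : ∀ F G a {v} → leaving F G v ≡ 0 → Listed F G a v → Listed F G a (suc v)
Listed-same F G a {v} eq listed j j< =
  let a< , rest = listed j (subst (j <_) (trans (cong (left F G v +_) eq) (+-identityʳ _)) j<) in m<n⇒m<1+n a< , rest

Listed-suc : ∀ F G a {v c} → c ≡ left F G v → Leave F G v → Listed F G a v → Listed F G (a [ c ↦ v ]) (suc v)
Listed-suc F G a {v} refl lv listed j j< with m≤n⇒m<n∨m≡n (s≤s⁻¹ (subst (j <_) (proj₁ (left-suc F G v lv)) j<))
... | inj₂ refl rewrite update-same a (left F G v) v = ≤-refl , refl , lv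
... | inj₁ lt   rewrite update-other a {y = j} v (>⇒≢ lt) = let a< , rest = listed j lt in m<n⇒m<1+n a< , rest

module JumpRun (n : ℕ) .{{_ : NonZero n}} (3≤n : 3 ≤ n) (k K m b : ℕ)
               (2≤k : 2 ≤ k) (width : Width n k K) (I J : Subset n) where
  open Heights n 3≤n k K m b 2≤k width hiding (G)
  open Jumps n 3≤n k K m b 2≤k width
  open Align n 3≤n k K m b 2≤k width TJ I J
  open Spanning
  open Based

  leaving-positive : ∀ {F G z} → Gentle n F → Gentle n G → z < n → leaving F G z ≢ 0 → Leave F G z
  leaving-positive {F} {G} {z} gF gG z<n ≢0 with leave-cases gF gG z z<n
  ... | inj₁ lv                    = lv
  ... | inj₂ (inj₁ lv)             = contradiction (proj₂ (Leave⇒leaving G F z lv)) ≢0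
  ... | inj₂ (inj₂ (eq , _ , _))   = contradiction eq ≢0

  left≤ : ∀ {F G} → Gentle n F → ∀ v → v ≤ n → left F G v ≤ v
  left≤         gF zero    _   = z≤n
  left≤ {F} {G} gF (suc v) v<n = ≤-trans (+-mono-≤ (left≤ {F} {G} gF v (<⇒≤ v<n)) leaving≤1) (≤-reflexive (+-comm v 1))
    where
    leaving≤1 : leaving F G v ≤ 1
    leaving≤1 = ≤-trans (m∸n≤m _ (G (suc v) ∸ G v))
      (≤-trans (∸-monoˡ-≤ (F v) (proj₂ (gF v v<n))) (≤-reflexive (m+n∸n≡m 1 (F v))))

  -- Both sets have `m` tokens, so as many positions are entered as are left, and the two lists can
  -- be paired.
  left-balanced : ∀ {F G} → Based F → Based G → left G F n ≡ left F G n
  left-balanced {F} {G} bF bG = +-cancelˡ-≡ m _ _ (begin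
    m + left G F n      ≡⟨ cong (_+ left G F n) (at-n bF) ⟨
    F n + left G F n    ≡⟨ balance (gentle bF) (gentle bG) (at-0 bF) (at-0 bG) n ≤-refl ⟩
    G n + left F G n    ≡⟨ cong (_+ left F G n) (at-n bG) ⟩
    m + left F G n      ∎)
    where open ≡-Reasoning

  Lists : ℕ → State → Set
  Lists v s = Based (arrays s Fᵃ) ×
    Listed (arrays s Fᵃ) (arrays s Gᵃ) (arrays s xᵃ) v × Listed (arrays s Gᵃ) (arrays s Fᵃ) (arrays s yᵃ) v

  Collecting : ℕ → State → Set
  Collecting v s = Frame s × Trace s × vars s posᵛ ≡ v × Lists v s ×
    vars s leftᵛ ≡ left (arrays s Fᵃ) (arrays s Gᵃ) v × vars s enteredᵛ ≡ left (arrays s Gᵃ) (arrays s Fᵃ) v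

  run-collectStep : ∀ {v s} → v < n → Collecting v s →
    Runs collectStep s (λ s′ → Collecting (suc v) (setVar posᵛ (suc (vars s′ posᵛ)) s′)) (bound collectStep)
  run-collectStep {v} {s} v<n (fr@(_ , _ , _ , _ , bG , _) , tr , refl , (bF , xs , ys) , eql , eqe) = run-if
    (λ ≢0 → let lv = leaving-positive {F} {G} (gentle bF) (gentle bG) v<n ≢0 ; eq , eq′ = left-suc F G v lv in
      run-seq $ run-store $ run-assign
        (fr , tr , refl ,
         (bF , Listed-suc F G (arrays s xᵃ) eql lv xs , Listed-same G F (arrays s yᵃ) (proj₂ (Leave⇒leaving F G v lv)) ys) ,
         trans (cong suc eql) (sym eq) , trans eqe (sym eq′)))
    (λ ≡0 → run-if
      (λ ≢0 → let lv = leaving-positive {G} {F} (gentle bG) (gentle bF) v<n ≢0 ; eq , eq′ = left-suc G F v lv in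
        run-seq $ run-store $ run-assign
          (fr , tr , refl ,
           (bF , Listed-same F G (arrays s xᵃ) ≡0 xs , Listed-suc G F (arrays s yᵃ) eqe lv ys) ,
           trans eql (sym eq′) , trans (cong suc eqe) (sym eq)))
      (λ ≡0′ → run-skip
        (fr , tr , refl , (bF , Listed-same F G (arrays s xᵃ) ≡0 xs , Listed-same G F (arrays s yᵃ) ≡0′ ys) ,
         trans eql (sym (trans (cong (left F G v +_) ≡0) (+-identityʳ _))) ,
         trans eqe (sym (trans (cong (left G F v +_) ≡0′) (+-identityʳ _))))))
    where
    F G : ℕ → ℕ
    F = arrays s Fᵃ
    G = arrays s Gᵃ

  collectTime : ℕ
  collectTime = 2 + (2 + (2 + loopTime (var nᵛ ⊖ var posᵛ) n (bound collectStep + bound next)))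

  run-collect : ∀ {s} → Frame s → Trace s → Based (arrays s Fᵃ) → Runs collect s (Collecting n) collectTime
  run-collect fr tr bF = run-seq $ run-assign $ run-seq $ run-assign $ run-seq $ run-assign $
    run-forPos n Collecting (λ (fr , _ , eqp , _) → proj₁ fr , eqp) run-collectStep n refl
      (fr , tr , refl , (bF , (λ _ ()) , (λ _ ())) , refl , refl)

  module _ (N : ℕ) where

    Ready : State → Set
    Ready s = Frame s × Lists n s × left (arrays s Fᵃ) (arrays s Gᵃ) n ≡ N

    Midway : (F G : ℕ → ℕ) → ℕ → State → Set
    Midway F G j s = Traced TJ (cycle n 3≤n) k I (tokens (partway F G j)) (output s)

    Jump : ℕ → State → Set
    Jump j s = let F = arrays s Fᵃ ; G = arrays s Gᵃ ; x = arrays s xᵃ j ; y = arrays s yᵃ j in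
      (x < n × left F G x ≡ j × Leave F G x) × (y < n × left G F y ≡ j × Leave G F y) × x ≢ y ×
      toℕ (at x) ≡ arrays s labelᵃ x × toℕ (at y) ≡ arrays s labelᵃ y

    ready⇒jump : ∀ {j s} → j < N → Ready s → Jump j s
    ready⇒jump {j} {s} j<N ((_ , _ , _ , labels , bG , _) , (bF , xs , ys) , eqN) =
      onX , onY , differ , trans (toℕ-at _) (sym (labels _ (<⇒≤ (proj₁ onX)))) , trans (toℕ-at _) (sym (labels _ (<⇒≤ (proj₁ onY))))
      where
      onX : _
      onX = xs j (subst (j <_) (sym eqN) j<N)
      onY : _
      onY = ys j (subst (j <_) (sym (trans (left-balanced bF bG) eqN)) j<N)
      differ : arrays s xᵃ j ≢ arrays s yᵃ j
      differ eq = m≢1+m+n (arrays s Fᵃ (arrays s yᵃ j)) {0} (begin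
        arrays s Fᵃ (arrays s yᵃ j)             ≡⟨ proj₂ (proj₂ (proj₂ onY)) ⟨
        arrays s Fᵃ (suc (arrays s yᵃ j))       ≡⟨ subst (λ z → arrays s Fᵃ (suc z) ≡ suc (arrays s Fᵃ z)) eq (proj₁ (proj₂ (proj₂ onX))) ⟩
        suc (arrays s Fᵃ (arrays s yᵃ j))       ≡⟨ cong suc (+-identityʳ _) ⟨
        suc (arrays s Fᵃ (arrays s yᵃ j) + 0)   ∎)
        where open ≡-Reasoning

    Ascending Descending : ℕ → State → Set
    Ascending j s = Ready s × vars s leftᵛ ≡ N × vars s posᵛ ≡ j × Midway (arrays s Fᵃ) (arrays s Gᵃ) j s
    Descending t s = Ready s × vars s leftᵛ ≡ N ∸ t × Midway (arrays s Gᵃ) (arrays s Fᵃ) (N ∸ t) s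

    run-ascendStep : ∀ {j s} → j < N → Ascending j s →
      Runs ascendStep s (λ s′ → Ascending (suc j) (setVar posᵛ (suc (vars s′ posᵛ)) s′)) (bound ascendStep)
    run-ascendStep {j} {s} j<N (rd@((_ , _ , _ , _ , bG , _) , (bF , _) , _) , eql , refl , tr) =
      let (x< , nx , lx) , (y< , ny , ly) , x≢y , labelx , labely = ready⇒jump {s = s} j<N rd in run-if
      (λ ≢0 → run-seq $ run-emit $ run-emit
        (rd , eql , refl , Traced-snoc tr (jump-step bF bG x< y< lx ly nx ny (m∸n≢0⇒n<m ≢0)) labelx labely))
      (λ ≡0 → run-skip
        (rd , eql , refl , subst (λ X → Traced TJ (cycle n 3≤n) k I X (output s))
          (jump-void bF bG x< y< lx ly nx ny (≤∧≢⇒< (m∸n≡0⇒m≤n ≡0) (x≢y ∘ sym))) tr))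

    run-descendStep : ∀ {j s} → j < N → Ready s → vars s leftᵛ ≡ j → Midway (arrays s Gᵃ) (arrays s Fᵃ) (suc j) s →
      Runs descendStep s (λ s′ → Ready s′ × vars s′ leftᵛ ≡ j × Midway (arrays s′ Gᵃ) (arrays s′ Fᵃ) j s′) (bound descendStep)
    run-descendStep {j} {s} j<N rd@((_ , _ , _ , _ , bG , _) , (bF , _) , _) refl tr =
      let (x< , nx , lx) , (y< , ny , ly) , x≢y , labelx , labely = ready⇒jump {s = s} j<N rd in run-if
      (λ ≢0 → run-seq $ run-emit $ run-emit
        (rd , refl , Traced-snoc tr (Step-sym (jump-step bG bF y< x< ly lx ny nx (m∸n≢0⇒n<m ≢0))) labelx labely))
      (λ ≡0 → run-skip
        (rd , refl , subst (λ X → Traced TJ (cycle n 3≤n) k I X (output s))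
          (sym (jump-void bG bF y< x< ly lx ny nx (≤∧≢⇒< (m∸n≡0⇒m≤n ≡0) x≢y))) tr))

    ascendTime descendTime : ℕ → ℕ
    ascendTime d  = 2 + loopTime (var leftᵛ ⊖ var posᵛ) d (bound ascendStep + bound next)
    descendTime d = loopTime (var leftᵛ) d (4 + bound descendStep)

    run-ascend : ∀ {s} → Ready s → vars s leftᵛ ≡ N → Trace s → Runs ascend s (Descending 0) (ascendTime N)
    run-ascend {s} rd@(_ , (bF , _) , _) eql tr = run-seq $ run-assign $ run-weaken (λ {s} → finish {s}) ≤-refl $
      run-while Ascending N (λ { _ (_ , eql , eqp , _) → cong₂ _∸_ eql eqp })
        (λ j<N asc → run-seq (run-weaken run-assign ≤-refl (run-ascendStep j<N asc))) N refl
        (rd , eql , refl , subst (λ X → Traced TJ (cycle n 3≤n) k I X (output s))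
          (tokens-cong λ z le → trans (partway-late bF bG le z≤n) (+-identityʳ _)) tr)
      where
      bG : Based (arrays s Gᵃ)
      bG = proj₁ (proj₂ (proj₂ (proj₂ (proj₂ (proj₁ rd)))))
      finish : ∀ {s} → Ascending N s → Descending 0 s
      finish {s} (rd@((_ , _ , _ , _ , bG , _) , (bF , _) , eqN) , eql , _ , tr) = rd , eql ,
        subst (λ X → Traced TJ (cycle n 3≤n) k I X (output s)) (tokens-cong meet) tr
        where
        F G : ℕ → ℕ
        F = arrays s Fᵃ
        G = arrays s Gᵃ
        -- Once all `N` pairs are treated the formula is `(F + N) ⊓ (G + N)`, which is symmetric.
        -- Here the invariant changes to the ascending phase from `J` to `I`, to be traversed
        -- backwards.
        meet : ∀ z → z ≤ n → partway G F N z ≡ partway F G N z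
        meet z le = trans
          (partway-early bG bF le (≤-trans (cum-mono (leaving G F) le) (≤-reflexive (trans (left-balanced bF bG) eqN))))
          (trans (⊓-comm (G z + N) (F z + N))
            (sym (partway-early bF bG le (≤-trans (cum-mono (leaving F G) le) (≤-reflexive eqN)))))

    run-descend : ∀ {s} → Descending 0 s → Runs descend s (λ s′ → Traced TJ (cycle n 3≤n) k I J (output s′)) (descendTime N)
    run-descend start = run-weaken (λ {s} → finish {s}) ≤-refl $
      run-while Descending N (λ { _ (_ , eql , _) → eql }) body N refl start
      where
      body : ∀ {t s} → t < N → Descending t s →
             Runs (leftᵛ := var leftᵛ ⊖ lit 1 ⨾ descendStep) s (Descending (suc t)) (4 + bound descendStep)
      body {t} {s} t<N (rd , eql , tr) = run-seq $ run-assign $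
        run-descendStep (∸-monoʳ-< z<s t<N) rd (trans (cong (_∸ 1) eql) (cong (_∸ 1) (m<n⇒n∸m≡1+ t<N)))
          (subst (λ j → Midway (arrays s Gᵃ) (arrays s Fᵃ) j s) (m<n⇒n∸m≡1+ t<N) tr)
      finish : ∀ {s} → Descending N s → Traced TJ (cycle n 3≤n) k I J (output s)
      finish {s} (((_ , _ , _ , _ , bG , eqJ) , (bF , _) , _) , _ , tr) =
        subst (λ X → Traced TJ (cycle n 3≤n) k I X (output s)) (trans (tokens-cong start′) eqJ)
          (subst (λ j → Midway (arrays s Gᵃ) (arrays s Fᵃ) j s) (n∸n≡0 N) tr)
        where
        start′ : ∀ z → z ≤ n → arrays s Gᵃ z ≡ partway (arrays s Gᵃ) (arrays s Fᵃ) 0 z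
        start′ z le = sym (trans (partway-late bG bF le z≤n) (+-identityʳ _))

  jumpTime : ℕ
  -- The number of pairs is known only at run time and is at most `n`; the `0` stands in for it as
  -- module parameter.
  jumpTime = collectTime + (ascendTime 0 n + descendTime 0 n)

  run-jumpTokens : ∀ {s} → Frame s → Trace s → Based (arrays s Fᵃ) →
    Runs jumpTokens s (λ s′ → Traced TJ (cycle n 3≤n) k I J (output s′)) jumpTime
  run-jumpTokens fr tr bF = run-then (run-collect fr tr bF) λ {s} (fr , tr , _ , lists , eql , _) →
    let N≤n = left≤ {arrays s Fᵃ} {arrays s Gᵃ} (gentle (proj₁ lists)) n ≤-refl in
    run-then
      (run-weaken (λ q → q) (s≤s (s≤s (loopTime-mono (var leftᵛ ⊖ var posᵛ) (bound ascendStep + bound next) N≤n)))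
        (run-ascend _ (fr , lists , refl) eql tr))
      λ desc → run-weaken (λ q → q) (loopTime-mono (var leftᵛ) (4 + bound descendStep) N≤n) (run-descend _ desc)

-- The programs, and the invariants that hold after setup.

program : Rule → ℕ → Cmd
program TS k = setup k ⨾ align ⨾ slideTokens
program TJ k = setup k ⨾ align ⨾ jumpTokens

module _ (n : ℕ) .{{_ : NonZero n}} (3≤n : 3 ≤ n) (k K m b : ℕ)
         (2≤k : 2 ≤ k) (width : Width n k K) where
  open Heights n 3≤n k K m b 2≤k width
  open Jumps n 3≤n k K m b 2≤k width

  module _ {X : Subset n} (win : Windowed n K X) (size : ∣ X ∣ ≡ m) {c : ℕ} {f : ℕ → ℕ}
           (eq : ∀ z → z ≤ n → f z ≡ c + heightFrom n X b z) where
    private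
      h : ℕ → ℕ
      h = heightFrom n X b

      h-periodic : ∀ v → h (v + n) ≡ h v + m
      h-periodic v = trans (heightFrom-periodic n X b v) (cong (h v +_) size)

    tabulated-rec : ∀ z → z < n → f (suc z) ≡ f z + indicator X (label z)
    tabulated-rec z z<n = trans (eq (suc z) z<n)
      (trans (sym (+-assoc c (h z) _)) (cong (_+ indicator X (label z)) (sym (eq z (<⇒≤ z<n)))))

    tabulated-tokens : tokens f ≡ X
    tabulated-tokens = tokens-indicator X tabulated-rec

    tabulated-gentle : Gentle n f
    tabulated-gentle z z<n = ≤-trans (m≤m+n _ _) (≤-reflexive (sym (tabulated-rec z z<n))) ,
      ≤-trans (≤-reflexive (tabulated-rec z z<n))
        (≤-trans (+-monoʳ-≤ (f z) (indicator≤1 X (label z))) (≤-reflexive (+-comm (f z) 1)))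

    tabulated-spanning : Spanning f
    tabulated-spanning = record
      { total = trans (eq n ≤-refl) (trans (cong (c +_) (h-periodic 0))
          (trans (sym (+-assoc c 0 m)) (cong (_+ m) (sym (eq 0 z≤n)))))
      ; inner = λ v le → subst₂ _<_ (sym (eq v (≤-trans (m≤m+n v K) le))) (sym (eq (v + K) le))
          (+-monoʳ-< c (heightFrom-grow n win b v))
      ; outer = λ u v eqv v<n → subst₂ _<_ (sym (eq v (<⇒≤ v<n)))
          (trans (cong (c +_) (trans (cong h (sym eqv)) (h-periodic u)))
            (trans (sym (+-assoc c (h u) m)) (cong (_+ m) (sym (eq u (wrapped≤n eqv v<n))))))
          (+-monoʳ-< c (heightFrom-grow n win b v)) }

    -- Each of the `j` windows that fit between `u` and `n` gains at least 1. For `c = 1` this is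
    -- the alignment potential at time 0.
    tabulated-low : ∀ u → u ≤ n → ∀ j → j * K + u ≤ n → f u + j ≤ c + m
    tabulated-low u u≤n j le = begin
      f u + j              ≡⟨ cong (_+ j) (eq u u≤n) ⟩
      c + h u + j          ≡⟨ +-assoc c (h u) j ⟩
      c + (h u + j)        ≤⟨ +-monoʳ-≤ c (grow-multiple h K (heightFrom-grow n win b) j u) ⟩
      c + h (u + j * K)    ≤⟨ +-monoʳ-≤ c (cum-mono _ (≤-trans (≤-reflexive (+-comm u _)) le)) ⟩
      c + h n              ≡⟨ cong (c +_) (h-periodic 0) ⟩
      c + m                ∎
      where open ≤-Reasoning

    tabulated-at-0 : f 0 ≡ c
    tabulated-at-0 = trans (eq 0 z≤n) (+-identityʳ c)

    tabulated-at-1 : b < n → f 1 ≡ c + indicator X b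
    tabulated-at-1 b<n = trans (eq 1 (≤-trans (s≤s z≤n) 3≤n))
      (cong (λ x → c + indicator X x) (trans (cong (_% n) (+-identityʳ b)) (m<n⇒m%n≡m b<n)))

    tabulated-based : b < n → c ≡ 0 → indicator X b ≡ 1 → Based f
    tabulated-based b<n refl eqb = record
      { spanning = tabulated-spanning ; gentle = tabulated-gentle
      ; at-0 = tabulated-at-0 ; at-1 = trans (tabulated-at-1 b<n) eqb }

  module _ (R : Rule) (I J : Subset n) (winI : Windowed n K I) (winJ : Windowed n K J)
           (sizeI : ∣ I ∣ ≡ m) (sizeJ : ∣ J ∣ ≡ m) (b<n : b < n) (b∈J : 0 < indicator J b) where
    open Align n 3≤n k K m b 2≤k width R I J

    module _ {s : State} (tab : Setup.Tabulated n I J K b s) where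
      open Setup.Tabulated tab

      tabulated-frame : Frame s
      tabulated-frame = n≡ , width≡ , trans size≡ sizeJ , label≡ ,
        tabulated-based winJ sizeJ {c = 0} G≡ b<n refl (≤-antisym (indicator≤1 J b) b∈J) ,
        tabulated-tokens winJ sizeJ {c = 0} G≡

      tabulated-trace : Trace s
      tabulated-trace = subst (λ X → Traced R G k I X (output s)) (sym (tabulated-tokens winI sizeI F≡)) (ε , empty)

      tabulated-phase : Based (arrays s Fᵃ) ⊎
                        (Unaligned (arrays s Fᵃ) × (∀ u → u ≤ n → Low 0 (arrays s Fᵃ) u))
      tabulated-phase = by-base (indicator I b) refl (indicator≤1 I b)
        where
        by-base : ∀ i → indicator I b ≡ i → i ≤ 1 → Based (arrays s Fᵃ) ⊎
                  (Unaligned (arrays s Fᵃ) × (∀ u → u ≤ n → Low 0 (arrays s Fᵃ) u))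
        by-base zero i≡ _ = inj₂ (record
          { spanning = tabulated-spanning winI sizeI F≡
          ; gentle   = tabulated-gentle winI sizeI F≡
          ; at-0     = trans (tabulated-at-0 winI sizeI F≡) (cong (1 ∸_) i≡)
          ; at-1     = trans (tabulated-at-1 winI sizeI F≡ b<n) (cong (λ i → 1 ∸ i + i) i≡)
          ; end      = F-end } ,
          λ u u≤n j le → ≤-trans (tabulated-low winI sizeI F≡ u u≤n j (≤-trans le (≤-reflexive (+-identityʳ n))))
            (≤-reflexive (cong (λ i → 1 ∸ i + m) i≡)))
        by-base (suc zero) i≡ _ = inj₁ (tabulated-based winI sizeI F≡ b<n (cong (1 ∸_) i≡) i≡)
        by-base (suc (suc _)) _ (s≤s ())

-- Running times

loopBound : Expr → ℕ → ℕ → ℕ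
loopBound e D E = D * (suc (cost e) + E) + suc (cost e)

-- A record, so that the constant C can be left to unification.
record Within (C N T : ℕ) : Set where
  constructor within
  field time≤ : T ≤ C * N

open Within

const-bound : ∀ {N} c → 1 ≤ N → Within c N c
const-bound {N} c 1≤N = within (≤-trans (≤-reflexive (sym (*-identityʳ c))) (*-monoʳ-≤ c 1≤N))

+-bound : ∀ {N T U C D} → Within C N T → Within D N U → Within (C + D) N (T + U)
+-bound {N} {C = C} {D} (within T≤) (within U≤) =
  within (≤-trans (+-mono-≤ T≤ U≤) (≤-reflexive (sym (*-distribʳ-+ N C D))))

⊔-bound : ∀ {N T U C D} → Within C N T → Within D N U → Within (C + D) N (T ⊔ U)
⊔-bound {T = T} {U} T≤ U≤ = within (≤-trans (m⊔n≤m+n T U) (time≤ (+-bound T≤ U≤)))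

loop-bound : ∀ e {d T D E N₁ N₂} → 1 ≤ N₁ → 1 ≤ N₂ → d ≤ D * N₁ → Within E N₂ T →
             Within (loopBound e D E) (N₁ * N₂) (loopTime e d T)
loop-bound e {d} {T} {D} {E} {N₁} {N₂} 1≤N₁ 1≤N₂ d≤ T≤ = +-bound
  (within (≤-trans (*-mono-≤ d≤ (time≤ (+-bound (const-bound (suc (cost e)) 1≤N₂) T≤)))
    (≤-reflexive (lemma D N₁ (suc (cost e) + E) N₂))))
  (const-bound (suc (cost e)) (*-mono-≤ 1≤N₁ 1≤N₂))
  where
  lemma : ∀ D N M P → D * N * (M * P) ≡ D * M * (N * P)
  lemma = solve-∀

linear-loop : ∀ e {n d} T → 1 ≤ n → d ≤ n → Within (loopBound e 1 T) n (loopTime e d T)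
linear-loop e {n} {d} T 1≤n d≤n = subst (λ N → Within (loopBound e 1 T) N (loopTime e d T)) (*-identityʳ n)
  (loop-bound e {D = 1} 1≤n ≤-refl (≤-trans d≤n (≤-reflexive (sym (*-identityˡ n)))) (const-bound T ≤-refl))

const-loop : ∀ e {n d T E} D → 1 ≤ n → d ≤ D → Within E n T → Within (loopBound e D E) n (loopTime e d T)
const-loop e {n} {d} {T} {E} D 1≤n d≤D T≤ = subst (λ N → Within (loopBound e D E) N (loopTime e d T)) (*-identityˡ n)
  (loop-bound e {D = D} ≤-refl 1≤n (≤-trans d≤D (≤-reflexive (sym (*-identityʳ D)))) T≤)

setup-bound : ∀ k → ∃[ C ] (∀ n .{{_ : NonZero n}} I J → Within C n (Setup.setupTime n I J k))
setup-bound k = _ , λ n I J → let 1≤n = >-nonZero⁻¹ n in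
  +-bound (const-bound (bound (chooseWidth k)) 1≤n)
    (+-bound (+-bound (const-bound 2 1≤n) (linear-loop (var nᵛ ⊖ var posᵛ) _ 1≤n ≤-refl))
      (+-bound (const-bound 2 1≤n) (+-bound (const-bound 2 1≤n) (+-bound (const-bound 6 1≤n) (+-bound (const-bound 3 1≤n)
        (+-bound (linear-loop (var nᵛ ⊖ var posᵛ) _ 1≤n ≤-refl) (const-bound (bound tabulateEnd) 1≤n)))))))

-- In the wide case `n` itself is at most `k`, so the number of alignment sweeps is bounded in terms
-- of the program alone.
width≤1+k : ∀ {n k K} .{{_ : NonZero n}} → Width n k K → K ≤ suc k
width≤1+k {k = k} (inj₁ (_ , refl))   = n≤1+n k
width≤1+k         (inj₂ (n≤k , refl)) = s≤s n≤k

align-bound : ∀ k → ∃[ C ] (∀ n .{{_ : NonZero n}} 3≤n K m b 2≤k (width : Width n k K) R I J slack →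
              Within C n (Align.alignTime n 3≤n k K m b 2≤k width R I J slack))
align-bound k = _ , λ n 3≤n K m b 2≤k width R I J slack → let 1≤n = >-nonZero⁻¹ n in
  +-bound (const-bound 2 1≤n) (const-loop (var roundᵛ) (suc k) 1≤n (width≤1+k width)
    (+-bound (+-bound (const-bound 3 1≤n)
      (⊔-bound (+-bound (const-bound 2 1≤n)
                 (+-bound (linear-loop (var nᵛ ⊖ var posᵛ) (bound (whenLowerable lower) + bound next) 1≤n pred[n]≤n)
                          (const-bound (bound (whenLowerable (lower ⨾ Fᵃ [ lit 0 ]:= lit 0))) 1≤n)))
               (const-bound 1 1≤n)))
      (const-bound 4 1≤n)))

jump-bound : ∃[ C ] (∀ n .{{_ : NonZero n}} 3≤n k K m b 2≤k (width : Width n k K) I J →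
             Within C n (JumpRun.jumpTime n 3≤n k K m b 2≤k width I J))
jump-bound = _ , λ n 3≤n k K m b 2≤k width I J → let 1≤n = >-nonZero⁻¹ n in
  +-bound
    (+-bound (const-bound 2 1≤n) (+-bound (const-bound 2 1≤n) (+-bound (const-bound 2 1≤n)
      (linear-loop (var nᵛ ⊖ var posᵛ) _ 1≤n ≤-refl))))
    (+-bound (+-bound (const-bound 2 1≤n) (linear-loop (var leftᵛ ⊖ var posᵛ) _ 1≤n ≤-refl))
             (linear-loop (var leftᵛ) _ 1≤n ≤-refl))

slide-bound : ∃[ C ] (∀ n .{{_ : NonZero n}} 3≤n k K m b 2≤k (width : Width n k K) R I J →
              Within C (n * n) (Slides.slideTime n 3≤n k K m b 2≤k width R I J))
slide-bound = _ , λ n 3≤n k K m b 2≤k width R I J → let 1≤n = >-nonZero⁻¹ n in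
  +-bound (const-bound 12 (*-mono-≤ 1≤n 1≤n))
    -- The `5n + 1` rounds are at most `6n`.
    (loop-bound (var roundᵛ) {D = 6} 1≤n 1≤n
      (≤-trans (+-monoˡ-≤ n (+-monoˡ-≤ n (+-monoˡ-≤ n (+-monoˡ-≤ n (+-monoˡ-≤ n 1≤n))))) (≤-reflexive (six n)))
      (+-bound (+-bound (const-bound 2 1≤n) (linear-loop (var nᵛ ⊖ var posᵛ) _ 1≤n pred[n]≤n)) (const-bound 4 1≤n)))
  where
  six : ∀ n → n + n + n + n + n + n ≡ 6 * n
  six = solve-∀

quadratic : ∀ {C n T} → 1 ≤ n → Within C n T → Within C (n * n) T
quadratic {C} {n} 1≤n (within T≤) = within (≤-trans T≤ (*-monoʳ-≤ C (≤-trans (≤-reflexive (sym (*-identityʳ n))) (*-monoʳ-≤ n 1≤n))))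

jumpConstant slideConstant : ℕ → ℕ
jumpConstant k  = proj₁ (setup-bound k) + (proj₁ (align-bound k) + proj₁ jump-bound)
slideConstant k = proj₁ (setup-bound k) + (proj₁ (align-bound k) + proj₁ slide-bound)

-- Solving an instance

module _ (n : ℕ) .{{_ : NonZero n}} (3≤n : 3 ≤ n) (k : ℕ) .{{_ : NonZero k}} (2≤k : 2 ≤ k) (I J : Subset n)
         (covI : IsPathCover (cycle n 3≤n) k I) (covJ : IsPathCover (cycle n 3≤n) k J)
         (I≢J : I ≢ J) (size : ∣ I ∣ ≡ ∣ J ∣) (unfrozen : ¬ Frozen n k I J) where
  private
    posJ : 0 < ∣ J ∣
    posJ = subst (0 <_) size (distinct⇒positive size I≢J)

    windowed : ∀ {K X} → Width n k K → IsPathCover (cycle n 3≤n) k X → 0 < ∣ X ∣ → Windowed n K X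
    windowed width cov pos = cover⇒windowed n 3≤n k width cov (positive⇒nonempty pos)

  -- Common to both rules: `rest` takes over once the current set and `J` share the base, and `f` is
  -- the growth function, `n` for jumping and `n * n` for sliding.
  solution : ∀ R {p} f {C D E} →
    Within C f (Setup.setupTime n I J k) →
    (∀ {K b} (width : Width n k K) slack → Within D f (Align.alignTime n 3≤n k K (∣ J ∣) b 2≤k width R I J slack)) →
    (∀ {K b} (width : Width n k K) {s} → Align.Frame n 3≤n k K (∣ J ∣) b 2≤k width R I J s →
       Align.Trace n 3≤n k K (∣ J ∣) b 2≤k width R I J s →
       Jumps.Based n 3≤n k K (∣ J ∣) b 2≤k width (arrays s Fᵃ) →
       Runs p s (λ s′ → Traced R (cycle n 3≤n) k I J (output s′)) (E * f)) →
    Runs (setup k ⨾ align ⨾ p) (initial I J) (λ s → Traced R (cycle n 3≤n) k I J (output s)) ((C + (D + E)) * f)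
  solution R f {C} {D} {E} setup≤ align≤ rest = run-weaken (λ q → q)
    (≤-reflexive (sym (trans (*-distribʳ-+ f C (D + E)) (cong (C * f +_) (*-distribʳ-+ f D E)))))
    (run-then (run-weaken (λ q → q) (time≤ setup≤) (Setup.run-setup n I J k posJ (refl , refl , refl , refl)))
      λ (K , b , width , b∈J , b<n , tab) →
        let winI  = windowed width covI (subst (0 <_) (sym size) posJ)
            winJ  = windowed width covJ posJ
            slack = subst (λ m → n < m * K) size
              (unfrozen⇒slack n 3≤n k {I} {J} width winI (subst (0 <_) (sym size) posJ) size unfrozen)
        in run-then
          (run-weaken (λ q → q) (time≤ (align≤ {b = b} width slack))
            (Align.run-align n 3≤n k K (∣ J ∣) b 2≤k width R I J slack
              (tabulated-frame n 3≤n k K (∣ J ∣) b 2≤k width R I J winI winJ size refl b<n b∈J tab)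
              (tabulated-trace n 3≤n k K (∣ J ∣) b 2≤k width R I J winI winJ size refl b<n b∈J tab)
              (tabulated-phase n 3≤n k K (∣ J ∣) b 2≤k width R I J winI winJ size refl b<n b∈J tab)))
          λ (fr , tr , based) → rest width fr tr based)

  jump-solution : Runs (program TJ k) (initial I J) (λ s → Traced TJ (cycle n 3≤n) k I J (output s)) (jumpConstant k * n)
  jump-solution = solution TJ n {proj₁ (setup-bound k)} {proj₁ (align-bound k)} {proj₁ jump-bound} (proj₂ (setup-bound k) n I J)
    (λ {K} {b} width slack → proj₂ (align-bound k) n 3≤n K (∣ J ∣) b 2≤k width TJ I J slack)
    (λ {K} {b} width fr tr based → run-weaken (λ q → q) (time≤ (proj₂ jump-bound n 3≤n k K (∣ J ∣) b 2≤k width I J))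
      (JumpRun.run-jumpTokens n 3≤n k K (∣ J ∣) b 2≤k width I J fr tr based))

  slide-solution : Runs (program TS k) (initial I J) (λ s → Traced TS (cycle n 3≤n) k I J (output s)) (slideConstant k * (n * n))
  slide-solution = solution TS (n * n) {proj₁ (setup-bound k)} {proj₁ (align-bound k)} {proj₁ slide-bound} (quadratic (>-nonZero⁻¹ n) (proj₂ (setup-bound k) n I J))
    (λ {K} {b} width slack → quadratic (>-nonZero⁻¹ n) (proj₂ (align-bound k) n 3≤n K (∣ J ∣) b 2≤k width TS I J slack))
    (λ {K} {b} width fr tr based → run-weaken (λ q → q) (time≤ (proj₂ slide-bound n 3≤n k K (∣ J ∣) b 2≤k width TS I J))
      (Slides.run-slideTokens n 3≤n k K (∣ J ∣) b 2≤k width TS I J fr tr based))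

  reconfiguration : ∀ R → Reconfigurable R (cycle n 3≤n) k I J
  reconfiguration TS = let _ , _ , _ , (σ , _) , _ = slide-solution in σ
  reconfiguration TJ = let _ , _ , _ , (σ , _) , _ = jump-solution in σ

theorem8 : (k : ℕ) .{{_ : NonZero k}} → 2 ≤ k →
    ((n : ℕ) (3≤n : 3 ≤ n) (I J : Subset n) →
    IsPathCover (cycle n 3≤n) k I → IsPathCover (cycle n 3≤n) k J → I ≢ J →
    (R : Rule) →
    (Frozen n k I J → ¬ Reconfigurable R (cycle n 3≤n) k I J)
    × (¬ Frozen n k I J → (Reconfigurable R (cycle n 3≤n) k I J ⇔ ∣ I ∣ ≡ ∣ J ∣)))
    × CycleSequencesComputableIn (λ n → n) TJ k
    × CycleSequencesComputableIn (λ n → n ^ 2) TS k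
theorem8 k 2≤k =
  (λ n 3≤n I J covI covJ I≢J R → let instance n≢0 = positive 3≤n in
    frozen⇒irreconfigurable n 3≤n k 2≤k I≢J ,
    λ unfrozen → mk⇔ (reconfigurable⇒∣∣≡ n) λ size → reconfiguration n 3≤n k 2≤k I J covI covJ I≢J size unfrozen R) ,
  (program TJ k , jumpConstant k , λ n 3≤n I J covI covJ I≢J σ → let instance n≢0 = positive 3≤n in
    -- The given sequence shows that the sizes agree and that the instance is not frozen; the
    -- sequence returned is the one traced by the program.
    collected (jump-solution n 3≤n k 2≤k I J covI covJ I≢J (reconfigurable⇒∣∣≡ n σ)
      λ frozen → frozen⇒irreconfigurable n 3≤n k 2≤k I≢J frozen σ)) ,
  (program TS k , slideConstant k , λ n 3≤n I J covI covJ I≢J σ → let instance n≢0 = positive 3≤n in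
    collected (run-weaken (λ q → q) (≤-reflexive (cong (λ x → slideConstant k * (n * x)) (sym (*-identityʳ n))))
      (slide-solution n 3≤n k 2≤k I J covI covJ I≢J (reconfigurable⇒∣∣≡ n σ)
        λ frozen → frozen⇒irreconfigurable n 3≤n k 2≤k I≢J frozen σ)))
  where
  positive : ∀ {n} → 3 ≤ n → NonZero n
  positive (s≤s _) = _
  collected : ∀ {n R} {G : Graph n} {I J p T} → Runs p (initial I J) (λ s → Traced R G k I J (output s)) T →
    Σ[ σ ∈ Reconfigurable R G k I J ] ∃[ s ] ∃[ t ] (p ∶ initial I J ⇓ s in-time t × output s ≡ moves σ × t ≤ T)
  collected (s , t , run , (σ , eq) , t≤T) = σ , s , t , run , eq , t≤T
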